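{- Let $G=(V,E)$ be a finite simple connected graph. Then $G$ is distance-regular if and only if every two isometric subsets $U,U'\subseteq V$ are perturb-cospectral.
   Context: $\partial(u,v)$ denotes the distance between vertices $u,v$ in $G$. Distance-regular has its standard meaning: for all $i,j,k$, the number of vertices at distance $i$ from $u$ and at distance $j$ from $v$ depends only on $i,j$ and $k=\partial(u,v)$. Two graphs or pseudographs (graphs possibly with loops and multiple edges) are cospectral if their adjacency matrices have the same spectrum with multiplicities. Two vertex subsets $U,U'\subseteq V$ are isometric if there is a one-to-one correspondence $U\to U'$, $u\mapsto u'$, such that $\partial(u,v)=\partial(u',v')$ for all $u,v\in U$. Perturbations of a (pseudo)graph $H$ with adjacency matrix $A=(a_{xy})$, at a vertex $u$ or at two distinct vertices $u,v$: - P1: remove $u$ and all incident edges. - P2: add a loop at $u$ (increase the diagonal entry $a_{uu}$ by $1$). - P3: add a new vertex $\bar u$ adjacent only to $u$ (by a single edge). - P4: flip $uv$, i.e. change the edge $uv$ into a non-edge or vice versa ($a_{uv}$ becomes $0$ if it is nonzero, and $1$ if it is $0$). - P5: amalgamate $u$ and $v$ into one new vertex $u+v$: adjacencies among other vertices are unchanged, the entry for $u+v$ and another vertex $x$ is $a_{ux}+a_{vx}$, and the diagonal entry at $u+v$ is $a_{uu}+a_{vv}+a_{uv}$ (so an edge $uv$ becomes a loop). - P6: add a new vertex $\bar u$ adjacent exactly to $u$ and $v$ (by single edges). Vertex subsets $U,U'$ are perturb-cospectral if there is a one-to-one correspondence $U\to U'$ such that, for every subset $S\subseteq U$ with corresponding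 subset $S'\subseteq U'$, the following holds: whenever $\widetilde G$ is obtained from $G$ by applying perturbations P1–P6 (possibly several, in succession) to the vertices of $S$ and to new vertices created by earlier perturbations, and $\widetilde G'$ is obtained from $G$ by applying the same perturbations in the same order to the corresponding vertices of $S'$ (and corresponding new vertices), the graphs $\widetilde G$ and $\widetilde G'$ are cospectral. -}

module Defs where

open import Level using (0ℓ)
open import Algebra.Apartness.Bundles using (HeytingField; HeytingCommutativeRing)
open import Algebra.Bundles using (CommutativeRing; Semiring)
import Algebra.Definitions.RawSemiring as RawSemiringOps
open import Data.Bool.Base using (if_then_else_; _∧_; _∨_)
open import Data.Fin.Base using (Fin; zero; suc; toℕ; punchIn; lift)
open import Data.Fin.Properties using (_≟_; any?)
open import Data.Fin.Subset using (Subset; inside; _∈_; _⊆_; _-_; ⊤)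
open import Data.Fin.Subset.Properties using (_∈?_)
open import Data.List.Base using (List; length; filter; allFin; lookup; foldr; map)
open import Data.Nat.Base using (ℕ; zero; suc; _+_; _*_; _≤_; z≤n; s≤s)
import Data.Nat.Properties as ℕ
open import Data.Product.Base using (∃; _×_; _,_; proj₁; proj₂)
open import Data.Vec.Base using (_∷_)
open import Function.Base using (id)
open import Function.Bundles using (_⇔_)
open import Relation.Binary.Core using (Rel)
open import Relation.Binary.Definitions using (Decidable; Symmetric)
open import Relation.Binary.PropositionalEquality.Core using (_≡_; _≢_)
open import Relation.Nullary.Decidable.Core using (yes; no; does; _×-dec_)
open import Relation.Nullary.Negation.Core using (¬_; contradiction)
import Relation.Unary as Unary

private
  variable
    k m n : ℕ

record Graph (n : ℕ) : Set₁ where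
  infix 4 _~_ _~?_
  field
    _~_      : Rel (Fin n) 0ℓ
    _~?_     : Decidable _~_
    ~-sym    : Symmetric _~_
    ~-irrefl : ∀ {u} → ¬ (u ~ u)

module _ (G : Graph n) where
  open Graph G

  -- Walk k u v: there is a walk with exactly k edges from u to v.
  Walk : ℕ → Rel (Fin n) 0ℓ
  Walk zero    u v = u ≡ v
  Walk (suc k) u v = ∃ λ w → u ~ w × Walk k w v

  walk? : ∀ k → Decidable (Walk k)
  walk? zero    u v = u ≟ v
  walk? (suc k) u v = any? λ w → (u ~? w) ×-dec walk? k w v

  Connected : Set
  Connected = ∀ u v → ∃ λ k → Walk k u v

least : {P : ℕ → Set} → Unary.Decidable P → ∃ P →
        ∃ λ k → P k × (∀ j → P j → k ≤ j)
least P? (b , pb) = go P? b pb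
  where
  go : {Q : ℕ → Set} → Unary.Decidable Q → ∀ b → Q b →
       ∃ λ k → Q k × (∀ j → Q j → k ≤ j)
  go Q? zero    qb = zero , qb , λ _ _ → z≤n
  go {Q} Q? (suc b) qb with Q? zero
  ... | yes q0 = zero , q0 , λ _ _ → z≤n
  ... | no ¬q0 with go (λ j → Q? (suc j)) b qb
  ...   | k , qk , k≤ = suc k , qk , minimal
    where
    minimal : ∀ j → Q j → suc k ≤ j
    minimal zero    q0 = contradiction q0 ¬q0
    minimal (suc j) qj = s≤s (k≤ j qj)

module _ (G : Graph n) (conn : Connected G) where

  ∂ : Fin n → Fin n → ℕ
  ∂ u v = proj₁ (least (λ k → walk? G k u v) (conn u v))

  #atDistances : (i j : ℕ) (u v : Fin n) → ℕ
  #atDistances i j u v =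
    length (filter (λ w → (∂ u w ℕ.≟ i) ×-dec (∂ v w ℕ.≟ j)) (allFin n))

  DistanceRegular : Set
  DistanceRegular = ∀ i j {u v u′ v′} → ∂ u v ≡ ∂ u′ v′ →
                    #atDistances i j u v ≡ #atDistances i j u′ v′

-- A one-to-one correspondence U → U′, given by a function on all of
-- Fin n whose values outside U are irrelevant.
record _≅_via_ (U U′ : Subset n) (f : Fin n → Fin n) : Set where
  field
    maps-to    : ∀ {u} → u ∈ U → f u ∈ U′
    injective  : ∀ {u v} → u ∈ U → v ∈ U → f u ≡ f v → u ≡ v
    surjective : ∀ {u′} → u′ ∈ U′ → ∃ λ u → u ∈ U × f u ≡ u′

Isometric : (G : Graph n) → Connected G → (U U′ : Subset n) → Set
Isometric G conn U U′ = ∃ λ f → U ≅ U′ via f ×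
  (∀ {u v} → u ∈ U → v ∈ U → ∂ G conn u v ≡ ∂ G conn (f u) (f v))

-- The vertices form a subset of the label type Fin m, so that deleting
-- a vertex leaves the labels of the others unchanged.  Values of adj at
-- labels that are not vertices carry no meaning.
record Pseudograph (m : ℕ) : Set where
  constructor pseudograph
  field
    vertices : Subset m
    adj      : Fin m → Fin m → ℕ

Matrix : Set → ℕ → Set
Matrix A n = Fin n → Fin n → A

module _ (H : Pseudograph m) where
  open Pseudograph H

  vertexList : List (Fin m)
  vertexList = filter (_∈? vertices) (allFin m)

  order : ℕ
  order = length vertexList

  adjacencyMatrix : Matrix ℕ order
  adjacencyMatrix i j = adj (lookup vertexList i) (lookup vertexList j)

module _ (K : HeytingField 0ℓ 0ℓ 0ℓ) where
  open HeytingField K using (Carrier; _≈_; _#_; 0#; 1#; heytingCommutativeRing)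
    renaming (_*_ to _·_; -_ to neg)
  open CommutativeRing
    (HeytingCommutativeRing.commutativeRing heytingCommutativeRing)
    using (semiring) renaming (_-_ to _⊖_)
  open Semiring semiring using (rawSemiring)
  open RawSemiringOps rawSemiring using (sum; _^_) renaming (_×_ to _⨯_)

  CharZero : Set
  CharZero = ∀ n → (suc n ⨯ 1#) # 0#

  -- Laplace expansion along the first row.
  det : ∀ {n} → Matrix Carrier n → Carrier
  det {zero}  M = 1#
  det {suc n} M = sum λ j →
    ((neg 1# ^ toℕ j) · M zero j) · det (λ i l → M (suc i) (punchIn j l))

  -- The matrix x I − M.
  charMatrix : Matrix ℕ n → Carrier → Matrix Carrier n
  charMatrix M x i j = (if does (i ≟ j) then x else 0#) ⊖ (M i j ⨯ 1#)

  -- The list λs consists of all eigenvalues of M with their algebraic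
  -- multiplicities: det (x I − M) = ∏ (x − λ).  Over a field of
  -- characteristic zero, polynomials agree when all their values agree.
  IsSpectrum : Matrix ℕ n → List Carrier → Set
  IsSpectrum M λs =
    ∀ x → det (charMatrix M x) ≈ foldr _·_ 1# (map (x ⊖_) λs)

-- The library has neither the real numbers nor an algebraic closure of ℚ,
-- so the field containing the eigenvalues is arbitrary of characteristic
-- zero.  When the eigenvalues of one matrix all lie in K, the condition
-- says that the other matrix has the same eigenvalues, with the same
-- multiplicities.
Cospectral : Pseudograph m → Pseudograph k → Set₁
Cospectral H H′ =
  (K : HeytingField 0ℓ 0ℓ 0ℓ) → CharZero K → ∀ λs →
  IsSpectrum K (adjacencyMatrix H) λs ⇔ IsSpectrum K (adjacencyMatrix H′) λs

toPseudograph : Graph n → Pseudograph n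
toPseudograph G = pseudograph ⊤ λ u v → if does (u ~? v) then 1 else 0
  where open Graph G

δ : Fin m → Fin m → ℕ
δ u x = if does (u ≟ x) then 1 else 0

-- Add a new vertex, labelled zero, with a x edges to each old vertex x
-- (whose label becomes suc x) and with diagonal entry d.
extend : (Fin m → ℕ) → ℕ → Pseudograph m → Pseudograph (suc m)
extend {m} a d (pseudograph V adj) = pseudograph (inside ∷ V) adj′
  where
  adj′ : Fin (suc m) → Fin (suc m) → ℕ
  adj′ zero    zero    = d
  adj′ zero    (suc y) = a y
  adj′ (suc x) zero    = a x
  adj′ (suc x) (suc y) = adj x y

remove : Fin m → Pseudograph m → Pseudograph m
remove u (pseudograph V adj) = pseudograph (V - u) adj

addLoop : Fin m → Pseudograph m → Pseudograph m
addLoop u (pseudograph V adj) = pseudograph V λ x y → adj x y + δ u x * δ u y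

addPendant : Fin m → Pseudograph m → Pseudograph (suc m)
addPendant u = extend (δ u) 0

flipEntry : ℕ → ℕ
flipEntry zero    = 1
flipEntry (suc _) = 0

flipEdge : (u v : Fin m) → Pseudograph m → Pseudograph m
flipEdge u v (pseudograph V adj) = pseudograph V λ x y →
  if (does (x ≟ u) ∧ does (y ≟ v)) ∨ (does (x ≟ v) ∧ does (y ≟ u))
  then flipEntry (adj x y) else adj x y

amalgamate : (u v : Fin m) → Pseudograph m → Pseudograph (suc m)
amalgamate u v H =
  extend (λ x → adj u x + adj v x) (adj u u + adj v v + adj u v)
         (remove v (remove u H))
  where open Pseudograph H

addCommonNeighbour : (u v : Fin m) → Pseudograph m → Pseudograph (suc m)
addCommonNeighbour u v = extend (λ x → δ u x + δ v x) 0

-- Finite sequences of perturbations in which the vertices that may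
-- be perturbed are those of S.  A vertex that disappears leaves S; a newly
-- created vertex joins it, as zero, and the earlier vertices are shifted
-- by suc.
data Perturbations : {k : ℕ} → Subset k → Set where
  done         : {S : Subset k} → Perturbations S
  removing     : {S : Subset k} (u : Fin k) → u ∈ S →
                 Perturbations (S - u) → Perturbations S
  looping      : {S : Subset k} (u : Fin k) → u ∈ S →
                 Perturbations S → Perturbations S
  hanging      : {S : Subset k} (u : Fin k) → u ∈ S →
                 Perturbations (inside ∷ S) → Perturbations S
  flipping     : {S : Subset k} (u v : Fin k) → u ∈ S → v ∈ S → u ≢ v →
                 Perturbations S → Perturbations S
  amalgamating : {S : Subset k} (u v : Fin k) → u ∈ S → v ∈ S → u ≢ v →
                 Perturbations (inside ∷ (S - u - v)) → Perturbations S
  bridging     : {S : Subset k} (u v : Fin k) → u ∈ S → v ∈ S → u ≢ v →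
                 Perturbations (inside ∷ S) → Perturbations S

-- Carry out the perturbations on H, where the vertex u of the sequence
-- stands for the vertex h u of H.  A new vertex corresponds to the new
-- vertex of H.
perturb : {S : Subset k} → Perturbations S →
          (Fin k → Fin m) → Pseudograph m → ∃ Pseudograph
perturb done                       h H = _ , H
perturb (removing u _ π)           h H = perturb π h (remove (h u) H)
perturb (looping u _ π)            h H = perturb π h (addLoop (h u) H)
perturb (hanging u _ π)            h H = perturb π (lift 1 h) (addPendant (h u) H)
perturb (flipping u v _ _ _ π)     h H = perturb π h (flipEdge (h u) (h v) H)
perturb (amalgamating u v _ _ _ π) h H =
  perturb π (lift 1 h) (amalgamate (h u) (h v) H)
perturb (bridging u v _ _ _ π)     h H =
  perturb π (lift 1 h) (addCommonNeighbour (h u) (h v) H)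

-- The subset S′ ⊆ U′ corresponding to S ⊆ U is the image of S under f.
PerturbCospectral : Graph n → (U U′ : Subset n) → Set₁
PerturbCospectral G U U′ = ∃ λ f → U ≅ U′ via f ×
  (∀ {S} → S ⊆ U → (π : Perturbations S) →
   Cospectral (proj₂ (perturb π id (toPseudograph G)))
              (proj₂ (perturb π f  (toPseudograph G))))

{-# OPTIONS --safe #-}
module Submission where

-- Write M for x I − A, where A is the adjacency matrix of G.
--
-- If G is distance-regular, then the entries of the powers of A depend only on distances, and so do
-- those of adj M: for two pairs of vertices at equal distance, the differences g k of the entries of
-- A ^ k · adj M satisfy g (k + 1) = x g k, which is impossible for nonzero polynomials of bounded
-- degree.  By Jacobi's identity, det M and the S × S entries of adj M determine det M after any
-- change of the S × S entries of M, so the determinants remain equal for isometric copies of S.  Each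
-- perturbation can be expressed by such changes: a new row supported on S by its Schur complement, a
-- deletion by a difference of two determinants, an amalgamation by adding the rows and columns of u and
-- v to a new vertex and deleting u and v.
--
-- Conversely, hanging a vertex at u and bridging u and v reveal the entries of adj M, hence those of the
-- powers of A; the distance matrices are linear combinations of these powers, and the intersection
-- numbers are the entries of their products.  The hypothesis speaks about spectra in a field containing
-- the eigenvalues; a splitting field over ℚ exists only up to double negation, which suffices because
-- equality of rational determinants is decidable.

open import Defs

import Algebra.Definitions.RawSemiring as RawSemiringOps
import Algebra.Morphism.Construct.Composition as Composition
import Algebra.Morphism.Construct.Identity as Identity
import Algebra.Properties.AbelianGroup as AbelianGroupProperties
import Algebra.Properties.CommutativeMonoid.Sum as CommutativeMonoidSum
import Algebra.Properties.CommutativeSemigroup as CommutativeSemigroupProperties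
import Algebra.Properties.Monoid.Mult as MonoidMult
import Algebra.Properties.Monoid.Sum as MonoidSum
import Algebra.Properties.Ring as RingProperties
import Algebra.Properties.Semiring.Mult as SemiringMult
import Algebra.Properties.Semiring.Sum as SemiringSum
import Algebra.Solver.Ring as RingSolver
import Data.List.Base as List
import Data.List.Relation.Unary.All as All
import Data.List.Relation.Unary.Unique.Propositional.Properties as Unique
import Data.Nat.ListAction as ListAction
import Data.Nat.Properties as ℕ
import Data.Rational.Unnormalised.Base as ℚ
import Data.Rational.Unnormalised.Properties as ℚ
import Data.Vec.Base as Vec
import Relation.Binary.Reasoning.Setoid as SetoidReasoning
open import Algebra.Apartness.Bundles using (HeytingField; HeytingCommutativeRing)
open import Algebra.Bundles using (CommutativeMonoid; CommutativeRing; CommutativeSemiring; RawRing; Ring; Semiring)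
open import Algebra.Morphism.Structures using (module RingMorphisms)
open import Algebra.Solver.Ring.AlmostCommutativeRing using (fromCommutativeRing; _-Raw-AlmostCommutative⟶_)
open import Data.Bool.Base using (if_then_else_; true; false; _∧_; _∨_)
open import Data.Bool.Properties using (∧-comm; ∨-comm)
open import Data.Fin.Base using (Fin; zero; suc; toℕ; punchIn; lift)
open import Data.Fin.Properties using (_≟_; any?; suc-injective; punchInᵢ≢i)
open import Data.Fin.Subset using (Subset; inside; outside; _∈_; _∉_; _⊆_; ⁅_⁆; _∪_) renaming (_-_ to _∖_)
open import Data.Fin.Subset.Properties using (_∈?_; ∈⊤; p─q⊆p; x∈p∧x≢y⇒x∈p-y; x∈⁅x⁆; x∈⁅y⁆⇒x≡y; x∈p∪q⁺; x∈p∪q⁻)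
open import Data.List.Base using (List; []; _∷_)
open import Data.List.Membership.Propositional using () renaming (_∈_ to _∈ˡ_)
open import Data.List.Membership.Propositional.Properties using (∈-∃++; ∈-allFin; ∈-cartesianProduct⁺; ∈-filter⁺; ∈-filter⁻; ∈-lookup)
open import Data.List.Properties using (map-tabulate)
open import Data.List.Relation.Binary.Permutation.Propositional.Properties using (filter-↭; ↭-length; map⁺; shift)
open import Data.List.Relation.Unary.All using (All; []; _∷_)
open import Data.List.Relation.Unary.All.Properties using (all-filter)
open import Data.List.Relation.Unary.AllPairs using (_∷_)
open import Data.List.Relation.Unary.Any using (here; there)
open import Data.List.Relation.Unary.Unique.Propositional using (Unique)
open import Data.Maybe.Base using (Maybe; just; nothing)
open import Data.Nat.Base as ℕ using (ℕ; zero; suc)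
open import Data.Nat.Induction using (<-rec)
open import Data.Nat.ListAction.Properties using (sum-↭)
open import Data.Product.Base using (∃; _×_; _,_; proj₁; proj₂)
open import Data.Sum.Base as Sum using (_⊎_; inj₁; inj₂)
open import Data.Vec.Base using (Vec; []; _∷_; here; there)
open import Data.Vec.Functional using (updateAt)
open import Data.Vec.Functional.Properties using (updateAt-updates; updateAt-minimal)
open import Data.Vec.Properties using (map-∘)
open import Function.Base using (const; _∘_; id)
open import Function.Bundles using (_⇔_; Equivalence; mk⇔)
open import Level using (0ℓ; _⊔_)
open import Relation.Binary.Definitions using (Decidable; tri<; tri≈; tri>)
open import Relation.Binary.PropositionalEquality as ≡ using (_≡_; _≢_)
open import Relation.Nullary.Decidable using (dec-true; dec-false; decidable-stable)
open import Relation.Nullary.Decidable.Core using (Dec; yes; no; does; _×-dec_)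
open import Relation.Nullary.Negation.Core using (¬_; contradiction)

-- The forward direction lives in an arbitrary Heyting field, where det M can neither be tested for
-- zero nor inverted. Hence adjugates take the place of inverse matrices, identities are multiplied
-- through by det M, and this factor is cancelled at the end as a monic polynomial function of x;
-- the cancellation rests on positive integers not being zero divisors. Deleted vertices keep their
-- labels and contribute rows and columns of the identity matrix, so that a deletion does not change
-- the size of the matrix. In the converse, the correspondence supplied by perturb-cospectrality
-- need not be the isometry that was put in: for pairs it may exchange u′ and v′, which is harmless
-- as adj M is symmetric. A vertex hung on u shows only the diagonal entry at u, and all diagonal
-- entries agree because any two singletons are isometric. Bridging u and v shows the sum of the
-- four entries on {u, v}, from which the entry (u, v) is recovered by cancelling the diagonal ones
-- and halving.

-- A ring solver with integer coefficients over any commutative ring.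

module CommutativeRingSolver {c ℓ} (R : CommutativeRing c ℓ) where
  open CommutativeRing R hiding (zero)
  open RingProperties ring using (-‿distribˡ-*; -‿distribʳ-*; -0#≈0#; -‿involutive)
  open AbelianGroupProperties +-abelianGroup using (⁻¹-∙-comm)
  open MonoidMult +-monoid using (×-homo-+) renaming (_×_ to _⨯_)
  open SemiringMult semiring using (×1-homo-*)
  open CommutativeSemigroupProperties (CommutativeMonoid.commutativeSemigroup +-commutativeMonoid)
    using (interchange)
  open SetoidReasoning setoid

  -- The pair (a , b) stands for the integer a − b; one of its components is kept zero.
  private
    reduce : ℕ × ℕ → ℕ × ℕ
    reduce (suc a , suc b) = reduce (a , b)
    reduce p               = p

    differences : RawRing 0ℓ 0ℓ
    differences = record
      { Carrier = ℕ × ℕ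
      ; _≈_     = _≡_
      ; _+_     = λ (a , b) (a′ , b′) → reduce (a ℕ.+ a′ , b ℕ.+ b′)
      ; _*_     = λ (a , b) (a′ , b′) → reduce (a ℕ.* a′ ℕ.+ b ℕ.* b′ , a ℕ.* b′ ℕ.+ b ℕ.* a′)
      ; -_      = λ (a , b) → b , a
      ; 0#      = 0 , 0
      ; 1#      = 1 , 0
      }

    -- The constants 0 and 1 of the solver have to denote 0# and 1# on the nose.
    ⟦_⟧ : ℕ × ℕ → Carrier
    ⟦ 0 , 0 ⟧ = 0#
    ⟦ 1 , 0 ⟧ = 1#
    ⟦ a , b ⟧ = a ⨯ 1# - b ⨯ 1#

    value : ∀ p → ⟦ p ⟧ ≈ proj₁ p ⨯ 1# - proj₂ p ⨯ 1#
    value (0 , 0)                 = sym (-‿inverseʳ 0#)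
    value (1 , 0)                 = sym (trans (+-cong (+-identityʳ 1#) -0#≈0#) (+-identityʳ 1#))
    value (0 , suc b)             = refl
    value (1 , suc b)             = refl
    value (suc (suc a) , b)       = refl

    sub-interchange : ∀ a b c d → (a + b) - (c + d) ≈ (a - c) + (b - d)
    sub-interchange a b c d = trans (+-congˡ (sym (⁻¹-∙-comm c d))) (interchange a b (- c) (- d))

    cancel-right : ∀ x y z → (x + z) - (y + z) ≈ x - y
    cancel-right x y z = trans (sub-interchange x z y z) (trans (+-congˡ (-‿inverseʳ z)) (+-identityʳ _))

    value-reduce : ∀ p → ⟦ reduce p ⟧ ≈ proj₁ p ⨯ 1# - proj₂ p ⨯ 1#
    value-reduce (zero  , b)     = value (zero , b)
    value-reduce (suc a , zero)  = value (suc a , zero)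
    value-reduce (suc a , suc b) = trans (value-reduce (a , b))
      (trans (sym (cancel-right _ _ 1#)) (+-cong (+-comm _ _) (-‿cong (+-comm _ _))))

    mul-sub : ∀ a b c d → (a * c + b * d) - (a * d + b * c) ≈ (a - b) * (c - d)
    mul-sub a b c d = sym (begin
      (a - b) * (c - d)                                   ≈⟨ distribˡ _ _ _ ⟩
      (a - b) * c + (a - b) * - d                         ≈⟨ +-cong (distribʳ _ _ _) (distribʳ _ _ _) ⟩
      (a * c + - b * c) + (a * - d + - b * - d)           ≈⟨ +-cong (+-congˡ (sym (-‿distribˡ-* b c)))
                                                             (+-cong (sym (-‿distribʳ-* a d))
                                                               (trans (sym (-‿distribˡ-* b (- d)))
                                                                 (trans (-‿cong (sym (-‿distribʳ-* b d)))
                                                                   (-‿involutive _)))) ⟩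
      (a * c + - (b * c)) + (- (a * d) + b * d)           ≈⟨ +-congˡ (+-comm _ _) ⟩
      (a * c + - (b * c)) + (b * d + - (a * d))           ≈⟨ interchange _ _ _ _ ⟩
      (a * c + b * d) + (- (b * c) + - (a * d))           ≈⟨ +-congˡ (trans (⁻¹-∙-comm _ _) (-‿cong (+-comm _ _))) ⟩
      (a * c + b * d) - (a * d + b * c)                   ∎)

    morphism : differences -Raw-AlmostCommutative⟶ fromCommutativeRing R
    morphism = record
      { ⟦_⟧    = ⟦_⟧
      ; +-homo = λ (a , b) (a′ , b′) → by-value (a ℕ.+ a′ , b ℕ.+ b′) (+-cong (value (a , b)) (value (a′ , b′)))
            (trans
          (+-cong (×-homo-+ 1# a a′) (-‿cong (×-homo-+ 1# b b′))) (sub-interchange _ _ _ _))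
      ; *-homo = λ (a , b) (a′ , b′) → by-value (a ℕ.* a′ ℕ.+ b ℕ.* b′ , a ℕ.* b′ ℕ.+ b ℕ.* a′)
          (*-cong (value (a , b)) (value (a′ , b′))) (trans
          (+-cong (trans (×-homo-+ 1# (a ℕ.* a′) (b ℕ.* b′)) (+-cong (×1-homo-* a a′) (×1-homo-* b b′)))
            (-‿cong (trans (×-homo-+ 1# (a ℕ.* b′) (b ℕ.* a′)) (+-cong (×1-homo-* a b′) (×1-homo-* b a′)))))
          (mul-sub _ _ _ _))
      ; -‿homo = λ (a , b) → trans (value (b , a)) (trans
          (sym (trans (sym (⁻¹-∙-comm _ _)) (trans (+-comm _ _) (+-congʳ (-‿involutive _)))))
          (-‿cong (sym (value (a , b)))))
      ; 0-homo = refl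
      ; 1-homo = refl
      }
      where
      by-value : ∀ p {x y} → x ≈ y → proj₁ p ⨯ 1# - proj₂ p ⨯ 1# ≈ y → ⟦ reduce p ⟧ ≈ x
      by-value p x≈y e = trans (value-reduce p) (trans e (sym x≈y))

    -- Reduced pairs coincide as soon as the integers do, so comparing components loses nothing.
    equal? : ∀ p q → Maybe (⟦ p ⟧ ≈ ⟦ q ⟧)
    equal? (a , b) (a′ , b′) with a ℕ.≟ a′ | b ℕ.≟ b′
    ... | yes ≡.refl | yes ≡.refl = just refl
    ... | _          | _          = nothing

  open RingSolver differences (fromCommutativeRing R) morphism equal? public
    using (solve; _:=_; _:+_; _:*_; _:-_; :-_; con)

  :0 :1 : ∀ {n} → RingSolver.Polynomial differences (fromCommutativeRing R) morphism equal? n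
  :0 = con (0 , 0)
  :1 = con (1 , 0)

-- Finite sums over a commutative semiring.

module FiniteSums {c ℓ} (S : CommutativeSemiring c ℓ) where
  open CommutativeSemiring S hiding (zero) renaming (Carrier to A)
  open SetoidReasoning setoid

  private
    variable
      m n : ℕ

  Row : ℕ → Set c
  Row n = Fin n → A

  -- Opaque, so that the number of summands can be inferred.
  opaque
    ∑ : Row n → A
    ∑ = MonoidSum.sum +-monoid

    ∑-sum : (f : Row n) → ∑ f ≈ MonoidSum.sum +-monoid f
    ∑-sum f = refl

    ∑-empty : (f : Row 0) → ∑ f ≈ 0#
    ∑-empty f = refl

    ∑-suc : (f : Row (suc n)) → ∑ f ≈ f zero + ∑ (f ∘ suc)
    ∑-suc f = refl

    ∑-cong : {f g : Row n} → (∀ i → f i ≈ g i) → ∑ f ≈ ∑ g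
    ∑-cong = MonoidSum.sum-cong-≋ +-monoid

    ∑-zero : {f : Row n} → (∀ i → f i ≈ 0#) → ∑ f ≈ 0#
    ∑-zero {n} f≈0 = trans (∑-cong f≈0) (MonoidSum.sum-replicate-zero +-monoid n)

    ∑-+ : (f g : Row n) → ∑ (λ i → f i + g i) ≈ ∑ f + ∑ g
    ∑-+ = CommutativeMonoidSum.∑-distrib-+ +-commutativeMonoid

    ∑-*ˡ : (a : A) (f : Row n) → a * ∑ f ≈ ∑ (λ i → a * f i)
    ∑-*ˡ = SemiringSum.*-distribˡ-sum semiring

    ∑-swap : (f : Fin m → Fin n → A) → ∑ (λ i → ∑ (f i)) ≈ ∑ (λ j → ∑ λ i → f i j)
    ∑-swap = CommutativeMonoidSum.∑-comm +-commutativeMonoid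

    ∑-single : (f : Row n) (i : Fin n) → (∀ j → j ≢ i → f j ≈ 0#) → ∑ f ≈ f i
    ∑-single {suc n} f i f≈0 = begin
      ∑ f                          ≈⟨ CommutativeMonoidSum.sum-remove +-commutativeMonoid {i = i} f ⟩
      f i + ∑ (f ∘ punchIn i)      ≈⟨ +-congˡ (∑-zero λ j → f≈0 _ λ e → punchInᵢ≢i i j e) ⟩
      f i + 0#                     ≈⟨ +-identityʳ _ ⟩
      f i                          ∎

-- Determinants: multilinearity, transposition and equal rows.

module Determinants {c ℓ} (R : CommutativeRing c ℓ) where
  open CommutativeRing R hiding (zero) renaming (Carrier to A)
  open CommutativeRingSolver R
  open FiniteSums commutativeSemiring public
  open RawSemiringOps (Semiring.rawSemiring semiring) using (_^_) renaming (_×_ to _⨯_)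
  open SetoidReasoning setoid

  private
    variable
      m n : ℕ

  Mat : ℕ → Set c
  Mat n = Fin n → Row n

  infix 4 _≋_
  _≋_ : Mat n → Mat n → Set ℓ
  M ≋ N = ∀ i j → M i j ≈ N i j

  minor : Fin (suc n) → Fin (suc n) → Mat (suc n) → Mat n
  minor i j M k l = M (punchIn i k) (punchIn j l)

  sign : Fin n → A
  sign j = (- 1#) ^ toℕ j

  opaque
    -- The expansion that defines `det`, over any commutative ring. Being opaque, it is used only
    -- through `det-empty` and `det-first-row`.
    det′ : Mat n → A
    det′ {zero}  M = 1#
    det′ {suc n} M = ∑ λ j → (sign j * M zero j) * det′ (minor zero j M)

    det-empty : (M : Mat 0) → det′ M ≈ 1#
    det-empty M = refl

    det-first-row : (M : Mat (suc n)) → det′ M ≈ ∑ λ j → (sign j * M zero j) * det′ (minor zero j M)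
    det-first-row M = refl

  det-cong : {M N : Mat n} → M ≋ N → det′ M ≈ det′ N
  det-cong {zero}  M≋N = trans (det-empty _) (sym (det-empty _))
  det-cong {suc n} M≋N = trans (det-first-row _) (trans (∑-cong λ j →
    *-cong (*-congˡ (M≋N zero j)) (det-cong λ k l → M≋N (suc k) (punchIn j l))) (sym (det-first-row _)))

  -- Additivity and homogeneity in a single rule. The three matrices are compared entry by entry
  -- instead of being built as updates of one matrix, so that the rule also applies to borders and
  -- to matrices defined by cases.
  det-linear : (i : Fin n) (M N P : Mat n) (a : A) →
    (∀ k → k ≢ i → ∀ j → M k j ≈ N k j) → (∀ k → k ≢ i → ∀ j → M k j ≈ P k j) →
    (∀ j → M i j ≈ a * N i j + P i j) → det′ M ≈ a * det′ N + det′ P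
  det-linear {suc n} zero M N P a M≈N M≈P Mi = begin
    det′ M
      ≈⟨ det-first-row M ⟩
    ∑ (λ j → (sign j * M zero j) * det′ (minor zero j M))
      ≈⟨ ∑-cong (λ j → trans (*-congʳ (*-congˡ (Mi j)))
           (trans (solve 5 (λ s a x y d → (s :* (a :* x :+ y)) :* d := a :* ((s :* x) :* d) :+ (s :* y) :* d) refl
                    (sign j) a (N zero j) (P zero j) (det′ (minor zero j M)))
             (+-cong (*-congˡ (*-congˡ (det-cong λ k l → M≈N (suc k) (λ ()) _)))
                     (*-congˡ (det-cong λ k l → M≈P (suc k) (λ ()) _))))) ⟩
    ∑ (λ j → a * ((sign j * N zero j) * det′ (minor zero j N)) + (sign j * P zero j) * det′ (minor zero j P))
      ≈⟨ ∑-+ _ _ ⟩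
    ∑ (λ j → a * ((sign j * N zero j) * det′ (minor zero j N))) +
      ∑ (λ j → (sign j * P zero j) * det′ (minor zero j P))
      ≈⟨ +-cong (trans (*-congˡ (det-first-row N)) (∑-*ˡ a _)) (det-first-row P) ⟨
    a * det′ N + det′ P ∎
  det-linear {suc n} (suc i) M N P a M≈N M≈P Mi = begin
    det′ M
      ≈⟨ det-first-row M ⟩
    ∑ (λ j → (sign j * M zero j) * det′ (minor zero j M))
      ≈⟨ ∑-cong (λ j → trans (*-congˡ (det-linear i (minor zero j M) (minor zero j N) (minor zero j P) a
                (λ k k≢i l → M≈N (suc k) (k≢i ∘ suc-injective) _)
                (λ k k≢i l → M≈P (suc k) (k≢i ∘ suc-injective) _) (λ l → Mi _)))
           (trans (solve 4 (λ t a x y → t :* (a :* x :+ y) := a :* (t :* x) :+ t :* y) refl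
                    (sign j * M zero j) a (det′ (minor zero j N)) (det′ (minor zero j P)))
             (+-cong (*-congˡ (*-congʳ (*-congˡ (M≈N zero (λ ()) j))))
                     (*-congʳ (*-congˡ (M≈P zero (λ ()) j)))))) ⟩
    ∑ (λ j → a * ((sign j * N zero j) * det′ (minor zero j N)) + (sign j * P zero j) * det′ (minor zero j P))
      ≈⟨ ∑-+ _ _ ⟩
    ∑ (λ j → a * ((sign j * N zero j) * det′ (minor zero j N))) +
      ∑ (λ j → (sign j * P zero j) * det′ (minor zero j P))
      ≈⟨ +-cong (trans (*-congˡ (det-first-row N)) (∑-*ˡ a _)) (det-first-row P) ⟨
    a * det′ N + det′ P ∎

  -- Expanding the minors of a first-row (first-column) expansion along their
  -- first column (row) gives the same double sum.
  det-first-column : (M : Mat (suc n)) →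
    det′ M ≈ ∑ λ i → (sign i * M i zero) * det′ (minor i zero M)
  det-first-column {zero}  M = trans (det-first-row M) (∑-cong λ { zero → refl })
  det-first-column {suc n} M = trans (trans (det-first-row M) (∑-suc _)) (trans (+-congˡ (begin
    ∑ (λ j → (sign (suc j) * M zero (suc j)) * det′ (minor zero (suc j) M))
      ≈⟨ ∑-cong (λ j → trans (*-congˡ (det-first-column (minor zero (suc j) M))) (∑-*ˡ _ _)) ⟩
    ∑ (λ j → ∑ λ i → (sign (suc j) * M zero (suc j)) * ((sign i * M (suc i) zero) * D i j))
      ≈⟨ ∑-swap _ ⟩
    ∑ (λ i → ∑ λ j → (sign (suc j) * M zero (suc j)) * ((sign i * M (suc i) zero) * D i j))
      ≈⟨ ∑-cong (λ i → ∑-cong λ j →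
           solve 6 (λ o s x t y d → ((o :* s) :* x) :* ((t :* y) :* d) := ((o :* t) :* y) :* ((s :* x) :* d)) refl
             (- 1#) (sign j) (M zero (suc j)) (sign i) (M (suc i) zero) (D i j)) ⟩
    ∑ (λ i → ∑ λ j → (sign (suc i) * M (suc i) zero) * ((sign j * M zero (suc j)) * D i j))
      ≈⟨ ∑-cong (λ i → trans (*-congˡ (det-first-row (minor (suc i) zero M))) (∑-*ˡ _ _)) ⟨
    ∑ (λ i → (sign (suc i) * M (suc i) zero) * det′ (minor (suc i) zero M)) ∎)) (sym (∑-suc _)))
    where
    D : Fin (suc n) → Fin (suc n) → A
    D i j = det′ (λ k l → M (suc (punchIn i k)) (suc (punchIn j l)))

  infix 30 _ᵀ
  _ᵀ : Mat n → Mat n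
  (M ᵀ) i j = M j i

  det-transpose : (M : Mat n) → det′ (M ᵀ) ≈ det′ M
  det-transpose {zero}  M = trans (det-empty _) (sym (det-empty M))
  det-transpose {suc n} M = trans (trans (det-first-row (M ᵀ))
    (∑-cong λ j → *-congˡ (det-transpose (minor j zero M))))
    (sym (det-first-column M))

  infixl 20 _[_]≔_
  _[_]≔_ : ∀ {b} {B : Set b} → (Fin n → B) → Fin n → B → Fin n → B
  M [ i ]≔ r = updateAt M i (const r)

  at-same : ∀ {b} {B : Set b} (M : Fin n → B) i {r} → (M [ i ]≔ r) i ≡ r
  at-same M i = updateAt-updates i M

  at-other : ∀ {b} {B : Set b} (M : Fin n → B) {i k} {r} → k ≢ i → (M [ i ]≔ r) k ≡ M k
  at-other M k≢i = updateAt-minimal _ _ M k≢i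

  row-same : (M : Mat n) (i : Fin n) {r : Row n} (j : Fin n) → (M [ i ]≔ r) i j ≈ r j
  row-same M i j = reflexive (≡.cong-app (at-same M i) j)

  row-other : (M : Mat n) {i k : Fin n} {r : Row n} → k ≢ i → (j : Fin n) → (M [ i ]≔ r) k j ≈ M k j
  row-other M k≢i j = reflexive (≡.cong-app (at-other M k≢i) j)

  set-cong : (M N : Mat n) (i : Fin n) {r s : Row n} → (∀ k → k ≢ i → ∀ j → M k j ≈ N k j) →
             (∀ j → r j ≈ s j) → (M [ i ]≔ r) ≋ (N [ i ]≔ s)
  set-cong M N i M≈N r≈s k j with k ≟ i
  ... | yes ≡.refl = trans (row-same M k j)
                       (trans (r≈s j) (sym (row-same N k j)))
  ... | no  k≢i    = trans (row-other M k≢i j)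
                       (trans (M≈N k k≢i j) (sym (row-other N k≢i j)))

  set-id : (M : Mat n) (i : Fin n) {r : Row n} → (∀ j → r j ≈ M i j) → (M [ i ]≔ r) ≋ M
  set-id M i r≈ k j with k ≟ i
  ... | yes ≡.refl = trans (row-same M k j) (r≈ j)
  ... | no  k≢i    = row-other M k≢i j

  det-set-linear : (M : Mat n) (i : Fin n) (a : A) (r s : Row n) →
    det′ (M [ i ]≔ (λ j → a * r j + s j)) ≈ a * det′ (M [ i ]≔ r) + det′ (M [ i ]≔ s)
  det-set-linear M i a r s = det-linear i _ _ _ a
    (λ k k≢i j → reflexive (≡.cong-app (≡.trans (at-other M k≢i) (≡.sym (at-other M k≢i))) j))
    (λ k k≢i j → reflexive (≡.cong-app (≡.trans (at-other M k≢i) (≡.sym (at-other M k≢i))) j))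
    (λ j → trans (row-same M i j)
      (sym (+-cong (*-congˡ (row-same M i j)) (row-same M i j))))

  det-set-+ : (M : Mat n) (i : Fin n) (r s : Row n) →
    det′ (M [ i ]≔ (λ j → r j + s j)) ≈ det′ (M [ i ]≔ r) + det′ (M [ i ]≔ s)
  det-set-+ M i r s = trans (det-cong (set-cong M M i (λ _ _ _ → refl) λ j → +-congʳ (sym (*-identityˡ _))))
    (trans (det-set-linear M i 1# r s) (+-congʳ (*-identityˡ _)))

  -- A zero row equals -1 times itself plus itself, so linearity gives det M = - det M + det M.
  det-zero-row : (M : Mat n) (i : Fin n) → (∀ j → M i j ≈ 0#) → det′ M ≈ 0#
  det-zero-row M i Mi≈0 = begin
    det′ M                  ≈⟨ det-linear i M M M (- 1#) (λ _ _ _ → refl) (λ _ _ _ → refl)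
                                (λ j → trans (Mi≈0 j) (solve 1 (λ x → :0 := (:- :1) :* x :+ x) refl (M i j))) ⟩
    - 1# * det′ M + det′ M   ≈⟨ solve 1 (λ x → (:- :1) :* x :+ x := :0) refl (det′ M) ⟩
    0#                     ∎

  private
    Alternating : ℕ → Set _
    Alternating n = (M : Mat n) (i j : Fin n) → i ≢ j → (∀ l → M i l ≈ M j l) → det′ M ≈ 0#

    equal-later-rows : Alternating n → (M : Mat (suc n)) (i j : Fin n) → i ≢ j →
      (∀ l → M (suc i) l ≈ M (suc j) l) → det′ M ≈ 0#
    equal-later-rows alt M i j i≢j eq = trans (det-first-row M) (∑-zero λ l →
      trans (*-congˡ (alt (minor zero l M) i j i≢j λ _ → eq _)) (zeroʳ _))

    -- In the expansion along the first column, the first two terms have equal minors and opposite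
    -- signs; in every other minor the two equal rows survive.
    equal-first-rows : Alternating (suc n) → (M : Mat (suc (suc n))) →
      (∀ l → M zero l ≈ M (suc zero) l) → det′ M ≈ 0#
    equal-first-rows {n} alt M eq = begin
      det′ M
        ≈⟨ trans (det-first-column M) (trans (∑-suc _) (+-congˡ (∑-suc _))) ⟩
      (1# * M zero zero) * det′ (minor zero zero M) +
        (((- 1#) * 1#) * M (suc zero) zero * det′ (minor (suc zero) zero M) +
          ∑ (λ i → (sign (suc (suc i)) * M (suc (suc i)) zero) * det′ (minor (suc (suc i)) zero M)))
        ≈⟨ +-cong (*-cong (*-congˡ (eq zero)) (det-cong minors))
                  (+-congˡ (∑-zero λ i → trans (*-congˡ (later alt M eq i)) (zeroʳ _))) ⟩
      (1# * M (suc zero) zero) * d + (((- 1#) * 1#) * M (suc zero) zero * d + 0#)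
        ≈⟨ solve 2 (λ x d → (:1 :* x) :* d :+ (((:- :1) :* :1) :* x :* d :+ :0) := :0) refl (M (suc zero) zero) d ⟩
      0# ∎
      where
      d = det′ (minor (suc zero) zero M)
      minors : minor zero zero M ≋ minor (suc zero) zero M
      minors zero    l = sym (eq (suc l))
      minors (suc k) l = refl
      -- The existence of `i` makes the size positive, so that the minor really has two rows to
      -- compare.
      later : ∀ {n} → Alternating (suc n) → (M : Mat (suc (suc n))) → (∀ l → M zero l ≈ M (suc zero) l) →
              (i : Fin n) → det′ (minor (suc (suc i)) zero M) ≈ 0#
      later {suc n} alt M eq i = alt (minor (suc (suc i)) zero M) zero (suc zero) (λ ()) λ l → eq (suc l)

    -- D x y, the determinant with rows zero and one replaced by x and y, vanishes for x = y, and for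
    -- y = a, the row that occurs again further down; hence D a b = − D b a = 0.
    equal-first-row : Alternating n → (M : Mat (suc n)) (j : Fin n) →
      (∀ l → M zero l ≈ M (suc j) l) → det′ M ≈ 0#
    equal-first-row {suc n} alt M zero    eq = equal-first-rows alt M eq
    equal-first-row {suc n} alt M (suc j) eq = begin
      det′ M                          ≈⟨ det-cong (λ { zero _ → refl ; (suc zero) _ → refl ; (suc (suc _)) _ →
            refl }) ⟩
      D a b                          ≈⟨ solve 1 (λ x → x := (:0 :+ x) :+ (:0 :+ :0)) refl (D a b) ⟩
      (0# + D a b) + (0# + 0#)       ≈⟨ +-cong (+-congʳ (D-diagonal a)) (+-cong Dba (D-diagonal b)) ⟨
      (D a a + D a b) + (D b a + D b b) ≈⟨ +-cong (D-+ʳ a a b) (D-+ʳ b a b) ⟨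
      D a (a ⊕ b) + D b (a ⊕ b)      ≈⟨ D-+ˡ a b (a ⊕ b) ⟨
      D (a ⊕ b) (a ⊕ b)              ≈⟨ D-diagonal (a ⊕ b) ⟩
      0#                             ∎
      where
      _⊕_ : Row (suc (suc n)) → Row (suc (suc n)) → Row (suc (suc n))
      (r ⊕ s) l = r l + s l
      a = M zero
      b = M (suc zero)
      N : Row (suc (suc n)) → Row (suc (suc n)) → Mat (suc (suc n))
      N x y zero          = x
      N x y (suc zero)    = y
      N x y (suc (suc k)) = M (suc (suc k))
      D : Row (suc (suc n)) → Row (suc (suc n)) → A
      D x y = det′ (N x y)
      D-diagonal : ∀ x → D x x ≈ 0#
      D-diagonal x = equal-first-rows alt (N x x) λ _ → refl
      Dba : D b a ≈ 0#
      Dba = equal-later-rows alt (N b a) zero (suc j) (λ ()) eq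
      D-+ʳ : ∀ x y z → D x (y ⊕ z) ≈ D x y + D x z
      D-+ʳ x y z = trans (det-linear (suc zero) (N x (y ⊕ z)) (N x y) (N x z) 1# off off
            (λ l → +-congʳ (sym (*-identityˡ _)))) (+-congʳ (*-identityˡ _))
        where
        off : ∀ {v w} k → k ≢ suc zero → ∀ l → N x v k l ≈ N x w k l
        off zero          _   l = refl
        off (suc zero)    k≢1 l = contradiction ≡.refl k≢1
        off (suc (suc k)) _   l = refl
      D-+ˡ : ∀ x y z → D (x ⊕ y) z ≈ D x z + D y z
      D-+ˡ x y z = trans (det-linear zero (N (x ⊕ y) z) (N x z) (N y z) 1# off off
            (λ l → +-congʳ (sym (*-identityˡ _)))) (+-congʳ (*-identityˡ _))
        where
        off : ∀ {v w} k → k ≢ zero → ∀ l → N v z k l ≈ N w z k l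
        off zero          k≢0 l = contradiction ≡.refl k≢0
        off (suc zero)    _   l = refl
        off (suc (suc k)) _   l = refl

  det-equal-rows : (M : Mat n) (i j : Fin n) → i ≢ j → (∀ l → M i l ≈ M j l) → det′ M ≈ 0#
  det-equal-rows M zero    zero    i≢j eq = contradiction ≡.refl i≢j
  det-equal-rows M zero    (suc j) i≢j eq = equal-first-row det-equal-rows M j eq
  det-equal-rows M (suc i) zero    i≢j eq = equal-first-row det-equal-rows M i (sym ∘ eq)
  det-equal-rows M (suc i) (suc j) i≢j eq = equal-later-rows det-equal-rows M i j (i≢j ∘ ≡.cong suc) eq

-- Adjugates, changes of single entries and Jacobi's identity.

module Adjugates {c ℓ} (R : CommutativeRing c ℓ) where
  open CommutativeRing R hiding (zero) renaming (Carrier to A)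
  open CommutativeRingSolver R
  open Determinants R
  open SetoidReasoning setoid

  private
    variable
      m n : ℕ

  -- Used both as the unit rows and, as a whole, as the identity matrix.
  e : Fin n → Row n
  e u i = if does (u ≟ i) then 1# else 0#

  e-same : (u : Fin n) → e u u ≈ 1#
  e-same u with u ≟ u
  ... | yes _   = refl
  ... | no  u≢u = contradiction ≡.refl u≢u

  e-other : {u i : Fin n} → u ≢ i → e u i ≈ 0#
  e-other {u = u} {i} u≢i with u ≟ i
  ... | yes u≡i = contradiction u≡i u≢i
  ... | no  _   = refl

  e-sym : (u i : Fin n) → e u i ≈ e i u
  e-sym u i with u ≟ i
  ... | yes ≡.refl = sym (e-same u)
  ... | no  u≢i    = sym (e-other (u≢i ∘ ≡.sym))

  ∑-e : (u : Fin n) (f : Row n) → ∑ (λ i → f i * e u i) ≈ f u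
  ∑-e u f = trans (∑-single _ u λ i i≢u → trans (*-congˡ (e-other (i≢u ∘ ≡.sym))) (zeroʳ _))
                  (trans (*-congˡ (e-same u)) (*-identityʳ _))

  ∑-linear : (a : A) (f g : Row n) → ∑ (λ i → a * f i + g i) ≈ a * ∑ f + ∑ g
  ∑-linear a f g = trans (∑-+ _ _) (+-congʳ (sym (∑-*ˡ a f)))

  -- The one rule for a * r + s also yields the value 0 at the zero row, by taking a = -1; this
  -- starts the induction on the number of summands.
  linear-expansion : (f : Row n → A) → (∀ {r s} → (∀ i → r i ≈ s i) → f r ≈ f s) →
    (∀ a r s → f (λ i → a * r i + s i) ≈ a * f r + f s) → ∀ r → f r ≈ ∑ λ u → r u * f (e u)
  linear-expansion {n} f f-cong f-linear r = trans (f-cong (λ i → sym (expand i))) (f-sum n _ _)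
    where
    f-zero : f (λ _ → 0#) ≈ 0#
    f-zero = begin
      f (λ _ → 0#)                         ≈⟨ f-cong (λ _ → solve 0 (:0 := (:- :1) :* :0 :+ :0) refl) ⟩
      f (λ _ → - 1# * 0# + 0#)             ≈⟨ f-linear _ _ _ ⟩
      - 1# * f (λ _ → 0#) + f (λ _ → 0#)   ≈⟨ solve 1 (λ x → (:- :1) :* x :+ x := :0) refl _ ⟩
      0#                                   ∎
    f-sum : ∀ m (c : Row m) (v : Fin m → Row n) → f (λ i → ∑ λ k → c k * v k i) ≈ ∑ λ k → c k * f (v k)
    f-sum zero    c v = trans (f-cong λ _ → ∑-empty _) (trans f-zero (sym (∑-empty _)))
    f-sum (suc m) c v = begin
      f (λ i → ∑ λ k → c k * v k i)
        ≈⟨ f-cong (λ i → ∑-suc _) ⟩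
      f (λ i → c zero * v zero i + ∑ λ k → c (suc k) * v (suc k) i)
        ≈⟨ f-linear _ _ _ ⟩
      c zero * f (v zero) + f (λ i → ∑ λ k → c (suc k) * v (suc k) i)
        ≈⟨ +-congˡ (f-sum m _ _) ⟩
      c zero * f (v zero) + ∑ (λ k → c (suc k) * f (v (suc k)))
        ≈⟨ ∑-suc _ ⟨
      ∑ (λ k → c k * f (v k)) ∎
    expand : ∀ i → ∑ (λ u → r u * e u i) ≈ r i
    expand i = trans (∑-cong λ u → *-congˡ (e-sym u i)) (∑-e i r)

  -- The cofactor at position (v, u), hence the entry (u, v) of the adjugate. Replacing a row by a
  -- unit row, instead of deleting a row and a column, avoids both minors and signs.
  adj : Mat n → Mat n
  adj M u v = det′ (M [ v ]≔ e u)

  set-swap : (M : Mat n) {i k : Fin n} (r s : Row n) → i ≢ k →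
    ((M [ i ]≔ r) [ k ]≔ s) ≋ ((M [ k ]≔ s) [ i ]≔ r)
  set-swap M {i} {k} r s i≢k l j with l ≟ i | l ≟ k
  ... | yes ≡.refl | yes l≡k    = contradiction l≡k i≢k
  ... | yes ≡.refl | no  l≢k    = reflexive (≡.cong-app (≡.trans (≡.trans (at-other (M [ i ]≔ r) l≢k) (at-same M l))
        (≡.sym (at-same (M [ k ]≔ s) l))) j)
  ... | no  l≢i    | yes ≡.refl = reflexive (≡.cong-app (≡.trans
        (≡.trans (at-same (M [ i ]≔ r) l) (≡.sym (at-same M l))) (≡.sym (at-other (M [ k ]≔ s) l≢i))) j)
  ... | no  l≢i    | no  l≢k    = reflexive (≡.cong-app
    (≡.trans (≡.trans (at-other (M [ i ]≔ r) l≢k) (at-other M l≢i))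
      (≡.sym (≡.trans (at-other (M [ k ]≔ s) l≢i) (at-other M l≢k)))) j)

  det-set-cong : (M : Mat n) (i : Fin n) {r s : Row n} → (∀ j → r j ≈ s j) → det′ (M [ i ]≔ r) ≈ det′ (M [ i ]≔ s)
  det-set-cong M i r≈s = det-cong (set-cong M M i (λ _ _ _ → refl) r≈s)

  det-set-expand : (M : Mat n) (v : Fin n) (r : Row n) → det′ (M [ v ]≔ r) ≈ ∑ λ u → r u * adj M u v
  det-set-expand M v = linear-expansion (λ r → det′ (M [ v ]≔ r)) (det-set-cong M v) (det-set-linear M v)

  det-set-other-row : (M : Mat n) {v w : Fin n} → w ≢ v → det′ (M [ v ]≔ M w) ≈ 0#
  det-set-other-row M {v} {w} w≢v = det-equal-rows _ v w (w≢v ∘ ≡.sym) λ l →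
    reflexive (≡.cong-app (≡.trans (at-same M v) (≡.sym (at-other M w≢v))) l)

  -- The sum expands the determinant of `M` with row `v` replaced by row `w`: this is `M` itself for
  -- w = v, and has two equal rows otherwise.
  *-adj : (M : Mat n) (w v : Fin n) → ∑ (λ u → M w u * adj M u v) ≈ det′ M * e w v
  *-adj M w v with w ≟ v
  ... | yes ≡.refl = trans (sym (det-set-expand M w (M w)))
                       (trans (det-cong (set-id M w λ _ → refl)) (sym (*-identityʳ _)))
  ... | no  w≢v    = trans (sym (det-set-expand M v (M w))) (trans (det-set-other-row M w≢v) (sym (zeroʳ _)))

  private
    -- Only the summand i = v of the expansion along column u survives: for the other i, the
    -- row v of the matrix vanishes.
    adj-clear-column : (M : Mat n) (u v : Fin n) → adj M u v ≈ det′ (((M [ v ]≔ e u) ᵀ) [ u ]≔ e v)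
    adj-clear-column M u v = begin
      det′ N                                             ≈⟨ det-transpose N ⟨
      det′ (N ᵀ)                                         ≈⟨ det-cong (set-id (N ᵀ) u λ _ → refl) ⟨
      det′ ((N ᵀ) [ u ]≔ (N ᵀ) u)                        ≈⟨ det-set-expand (N ᵀ) u _ ⟩
      ∑ (λ i → N i u * det′ ((N ᵀ) [ u ]≔ e i))          ≈⟨ ∑-single _ v other ⟩
      N v u * det′ ((N ᵀ) [ u ]≔ e v)                    ≈⟨ *-congʳ (trans (N-v u) (e-same u)) ⟩
      1# * det′ ((N ᵀ) [ u ]≔ e v)                       ≈⟨ *-identityˡ _ ⟩
      det′ ((N ᵀ) [ u ]≔ e v)                            ∎
      where
      N = M [ v ]≔ e u
      N-v : ∀ j → N v j ≈ e u j
      N-v j = row-same M v j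
      other : ∀ i → i ≢ v → N i u * det′ ((N ᵀ) [ u ]≔ e i) ≈ 0#
      other i i≢v = trans (*-congˡ (trans (sym (det-transpose ((N ᵀ) [ u ]≔ e i))) (det-zero-row _ v zero-row)))
            (zeroʳ _)
        where
        zero-row : ∀ k → ((N ᵀ) [ u ]≔ e i) k v ≈ 0#
        zero-row k with k ≟ u
        ... | yes ≡.refl = trans (row-same (N ᵀ) k v) (e-other i≢v)
        ... | no  k≢u    = trans (row-other (N ᵀ) k≢u v) (trans (N-v k) (e-other (k≢u ∘ ≡.sym)))

  -- Once row `v` is a unit row, the rest of column `u` can be cleared without effect. This
  -- description of a cofactor treats rows and columns alike, which gives `adj-transpose`; it also
  -- recognises the padded matrix of a graph with a deleted vertex as a cofactor.
  adj-clear : (M C : Mat n) (u v : Fin n) → (∀ j → C v j ≈ e u j) → (∀ i → C i u ≈ e v i) →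
    (∀ i j → i ≢ v → j ≢ u → C i j ≈ M i j) → adj M u v ≈ det′ C
  adj-clear M C u v C-row C-col C-rest = trans (adj-clear-column M u v) (trans (det-cong same) (det-transpose C))
    where
    same : (((M [ v ]≔ e u) ᵀ) [ u ]≔ e v) ≋ (C ᵀ)
    same j i with j ≟ u
    ... | yes ≡.refl = trans (row-same ((M [ v ]≔ e u) ᵀ) j i) (sym (C-col i))
    ... | no  j≢u    with i ≟ v
    ...   | yes ≡.refl = trans (row-other ((M [ v ]≔ e u) ᵀ) j≢u i)
                          (trans (row-same M i j) (sym (C-row j)))
    ...   | no  i≢v    = trans (row-other ((M [ v ]≔ e u) ᵀ) j≢u i)
                          (trans (row-other M i≢v j) (sym (C-rest i j i≢v j≢u)))

  adj-transpose : (M : Mat n) (u v : Fin n) → adj (M ᵀ) u v ≈ adj M v u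
  adj-transpose M u v = trans
    (adj-clear (M ᵀ) C u v C-row C-col C-rest)
    (trans (sym (det-transpose C)) (sym (adj-clear M (C ᵀ) v u C-col C-row λ i j i≢u j≢v → C-rest j i j≢v i≢u)))
    where
    C = λ i j → (((M ᵀ) [ v ]≔ e u) ᵀ [ u ]≔ e v) j i
    C-row : ∀ j → C v j ≈ e u j
    C-row j with j ≟ u
    ... | yes ≡.refl = trans (row-same (((M ᵀ) [ v ]≔ e u) ᵀ) j v) (trans (e-same v) (sym (e-same j)))
    ... | no  j≢u    = trans (row-other (((M ᵀ) [ v ]≔ e u) ᵀ) j≢u v)
                         (row-same (M ᵀ) v j)
    C-col : ∀ i → C i u ≈ e v i
    C-col i = row-same (((M ᵀ) [ v ]≔ e u) ᵀ) u i
    C-rest : ∀ i j → i ≢ v → j ≢ u → C i j ≈ M j i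
    C-rest i j i≢v j≢u = trans (row-other (((M ᵀ) [ v ]≔ e u) ᵀ) j≢u i)
      (row-other (M ᵀ) i≢v j)

  adj-symmetric : (M : Mat n) → (∀ i j → M i j ≈ M j i) → ∀ u v → adj M u v ≈ adj M v u
  adj-symmetric M M-sym u v = trans
    (det-cong (set-cong M (M ᵀ) v (λ k _ j → M-sym k j) λ _ → refl)) (adj-transpose M u v)

  adj-* : (M : Mat n) (u w : Fin n) → ∑ (λ v → adj M u v * M v w) ≈ det′ M * e u w
  adj-* M u w = begin
    ∑ (λ v → adj M u v * M v w)              ≈⟨ ∑-cong (λ v → trans (*-comm _ _)
          (*-congˡ (sym (adj-transpose M v u)))) ⟩
    ∑ (λ v → (M ᵀ) w v * adj (M ᵀ) v u)      ≈⟨ *-adj (M ᵀ) w u ⟩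
    det′ (M ᵀ) * e w u                        ≈⟨ *-cong (det-transpose M) (e-sym w u) ⟩
    det′ M * e u w                            ∎

  infixl 20 _[_,_]+=_
  _[_,_]+=_ : Mat n → Fin n → Fin n → A → Mat n
  (M [ u , v ]+= t) i j = M i j + t * (e u i * e v j)

  -- Only row `u` changes, by a multiple of the unit row `e v`, and the determinant with that unit
  -- row in place of row `u` is a cofactor.
  det-+= : (M : Mat n) (u v : Fin n) (t : A) → det′ (M [ u , v ]+= t) ≈ det′ M + t * adj M v u
  det-+= M u v t = begin
    det′ (M [ u , v ]+= t)                  ≈⟨ det-linear u _ (M [ u ]≔ e v) M t off off′ on ⟩
    t * adj M v u + det′ M                  ≈⟨ +-comm _ _ ⟩
    det′ M + t * adj M v u                  ∎
    where
    off′ : ∀ k → k ≢ u → ∀ j → (M [ u , v ]+= t) k j ≈ M k j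
    off′ k k≢u j = trans (+-congˡ (*-congˡ (*-congʳ (e-other (k≢u ∘ ≡.sym)))))
      (solve 3 (λ x t y → x :+ t :* (:0 :* y) := x) refl _ _ _)
    off : ∀ k → k ≢ u → ∀ j → (M [ u , v ]+= t) k j ≈ (M [ u ]≔ e v) k j
    off k k≢u j = trans (off′ k k≢u j) (sym (row-other M k≢u j))
    on : ∀ j → (M [ u , v ]+= t) u j ≈ t * (M [ u ]≔ e v) u j + M u j
    on j = trans (+-congˡ (*-congˡ (*-congʳ (e-same u))))
      (trans (solve 3 (λ x t y → x :+ t :* (:1 :* y) := t :* y :+ x) refl _ _ _)
        (+-congʳ (*-congˡ (sym (row-same M u j)))))

  -- Polarization: the determinant with r + s in both places vanishes, and so do the two diagonal
  -- terms of its expansion.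
  det-two-rows : (M : Mat n) {i k : Fin n} (r s : Row n) → i ≢ k →
    det′ ((M [ i ]≔ r) [ k ]≔ s) ≈ - det′ ((M [ i ]≔ s) [ k ]≔ r)
  det-two-rows M {i} {k} r s i≢k = begin
    D r s                                         ≈⟨ solve 2 (λ x y → x := ((:0 :+ x) :+ (y :+ :0)) :- y) refl (D r s)
          (D s r) ⟩
    ((0# + D r s) + (D s r + 0#)) - D s r         ≈⟨ +-congʳ (+-cong (+-congʳ (diagonal r)) (+-congˡ (diagonal s))) ⟨
    ((D r r + D r s) + (D s r + D s s)) - D s r   ≈⟨ +-congʳ (+-cong (D-+ʳ r r s) (D-+ʳ s r s)) ⟨
    (D r (r ⊕ s) + D s (r ⊕ s)) - D s r           ≈⟨ +-congʳ (D-+ˡ r s (r ⊕ s)) ⟨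
    D (r ⊕ s) (r ⊕ s) - D s r                     ≈⟨ +-congʳ (diagonal (r ⊕ s)) ⟩
    0# - D s r                                    ≈⟨ +-identityˡ _ ⟩
    - D s r                                       ∎
    where
    _⊕_ : Row _ → Row _ → Row _
    (r ⊕ s) l = r l + s l
    D : Row _ → Row _ → A
    D r s = det′ ((M [ i ]≔ r) [ k ]≔ s)
    diagonal : ∀ r → D r r ≈ 0#
    diagonal r = det-equal-rows _ i k i≢k λ l → reflexive (≡.cong-app
      (≡.trans (≡.trans (at-other (M [ i ]≔ r) i≢k) (at-same M i)) (≡.sym (at-same (M [ i ]≔ r) k))) l)
    D-+ʳ : ∀ x y z → D x (y ⊕ z) ≈ D x y + D x z
    D-+ʳ x y z = det-set-+ (M [ i ]≔ x) k y z
    D-+ˡ : ∀ x y z → D (x ⊕ y) z ≈ D x z + D y z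
    D-+ˡ x y z = trans (det-cong (set-swap M _ _ i≢k)) (trans (det-set-+ (M [ k ]≔ z) i x y)
      (+-cong (det-cong (set-swap M _ _ (i≢k ∘ ≡.sym))) (det-cong (set-swap M _ _ (i≢k ∘ ≡.sym)))))

  -- By `adj-*`, the row det M · e b is the combination of the rows of `M` with coefficients adj b
  -- k. In the linear functional `F` only two of them survive: row `a` restores the matrix with only
  -- row `u` replaced, and row `u` does the same for row `a` after an exchange of two rows, whence
  -- the minus sign.
  jacobi : (M : Mat n) {a u : Fin n} (b v : Fin n) → a ≢ u →
    det′ M * det′ ((M [ a ]≔ e b) [ u ]≔ e v) ≈ adj M b a * adj M v u - adj M b u * adj M v a
  jacobi M {a} {u} b v a≢u = begin
    det′ M * F (e b)
      ≈⟨ trans (*-congˡ (F-expand (e b))) (trans (∑-*ˡ _ _) (∑-cong λ w → sym (*-assoc _ _ _))) ⟩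
    ∑ (λ w → (det′ M * e b w) * F (e w))
      ≈⟨ F-expand _ ⟨
    F (λ w → det′ M * e b w)
      ≈⟨ F-cong (λ w → sym (adj-* M b w)) ⟩
    F (λ w → ∑ λ k → adj M b k * M k w)
      ≈⟨ F-expand _ ⟩
    ∑ (λ w → (∑ λ k → adj M b k * M k w) * F (e w))
      ≈⟨ ∑-cong (λ w → trans (*-comm _ _) (trans (∑-*ˡ _ _) (∑-cong λ k →
           solve 3 (λ x y z → z :* (x :* y) := x :* (y :* z)) refl (adj M b k) (M k w) (F (e w))))) ⟩
    ∑ (λ w → ∑ λ k → adj M b k * (M k w * F (e w)))
      ≈⟨ ∑-swap _ ⟩
    ∑ (λ k → ∑ λ w → adj M b k * (M k w * F (e w)))
      ≈⟨ ∑-cong (λ k → trans (sym (∑-*ˡ _ _)) (*-congˡ (sym (F-expand (M k))))) ⟩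
    ∑ (λ k → adj M b k * F (M k))
      ≈⟨ ∑-cong F-row ⟩
    ∑ (λ k → adj M b k * adj M v u * e a k + - (adj M b k * adj M v a) * e u k)
      ≈⟨ ∑-+ _ _ ⟩
    ∑ (λ k → adj M b k * adj M v u * e a k) + ∑ (λ k → - (adj M b k * adj M v a) * e u k)
      ≈⟨ +-cong (∑-e a _) (∑-e u _) ⟩
    adj M b a * adj M v u - adj M b u * adj M v a ∎
    where
    F : Row _ → A
    F r = det′ ((M [ a ]≔ r) [ u ]≔ e v)
    F′ : ∀ r → F r ≈ det′ ((M [ u ]≔ e v) [ a ]≔ r)
    F′ r = det-cong (set-swap M r (e v) a≢u)
    F-expand : ∀ r → F r ≈ ∑ λ w → r w * F (e w)
    F-expand r = trans (F′ r) (trans (det-set-expand (M [ u ]≔ e v) a r) (∑-cong λ w → *-congˡ (sym (F′ (e w)))))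
    F-cong : ∀ {r s} → (∀ j → r j ≈ s j) → F r ≈ F s
    F-cong {r} {s} r≈s = trans (F′ r) (trans (det-set-cong _ a r≈s) (sym (F′ s)))
    F-a : F (M a) ≈ adj M v u
    F-a = det-cong (set-cong (M [ a ]≔ M a) M u (λ k _ j → set-id M a (λ _ → refl) k j) λ _ → refl)
    F-u : F (M u) ≈ - adj M v a
    F-u = trans (det-two-rows M (M u) (e v) a≢u) (-‿cong (trans (det-cong (set-swap M _ _ a≢u))
      (det-cong (set-cong (M [ u ]≔ M u) M a (λ k _ j → set-id M u (λ _ → refl) k j) λ _ → refl))))
    F-other : ∀ k → k ≢ a → k ≢ u → F (M k) ≈ 0#
    F-other k k≢a k≢u = trans (F′ (M k)) (det-equal-rows _ a k (k≢a ∘ ≡.sym) λ l → reflexive (≡.cong-app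
      (≡.trans (at-same (M [ u ]≔ e v) a) (≡.sym (≡.trans (at-other (M [ u ]≔ e v) k≢a) (at-other M k≢u)))) l))
    F-row : ∀ k → adj M b k * F (M k) ≈ adj M b k * adj M v u * e a k + - (adj M b k * adj M v a) * e u k
    F-row k with a ≟ k | u ≟ k
    ... | yes ≡.refl | yes u≡a    = contradiction (≡.sym u≡a) a≢u
    ... | yes ≡.refl | no  _      = trans (*-congˡ F-a) (solve 3
          (λ x y z → x :* y := x :* y :* :1 :+ (:- (x :* z)) :* :0) refl _ _ (adj M v k))
    ... | no  _      | yes ≡.refl = trans (*-congˡ F-u) (solve 3
          (λ x y z → x :* (:- z) := x :* y :* :0 :+ (:- (x :* z)) :* :1) refl _ (adj M v k) _)
    ... | no  a≢k    | no  u≢k    = trans (*-congˡ (F-other k (a≢k ∘ ≡.sym) (u≢k ∘ ≡.sym)))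
      (solve 3 (λ x y z → x :* :0 := x :* y :* :0 :+ (:- (x :* z)) :* :0) refl _ (adj M v u) (adj M v a))

  -- Multiplied by det M, the result is a polynomial in det M and adjugate entries of `M`. If both
  -- changes lie in the same row they act additively, in accordance with the vanishing of the 2 × 2
  -- minor for a = u; otherwise that minor is supplied by `jacobi`.
  det-+=-+= : (M : Mat n) (a b u v : Fin n) (s t : A) →
    det′ M * det′ ((M [ a , b ]+= s) [ u , v ]+= t) ≈
      (det′ M * det′ M + det′ M * (s * adj M b a + t * adj M v u)) +
        (s * t) * (adj M b a * adj M v u - adj M b u * adj M v a)
  det-+=-+= M a b u v s t = trans (*-congˡ (trans (det-+= _ u v t) (+-congʳ (det-+= M a b s)))) (step (a ≟ u))
    where
    step : Dec (a ≡ u) → det′ M * ((det′ M + s * adj M b a) + t * adj (M [ a , b ]+= s) v u) ≈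
      (det′ M * det′ M + det′ M * (s * adj M b a + t * adj M v u)) +
        (s * t) * (adj M b a * adj M v u - adj M b u * adj M v a)
    step (yes ≡.refl) = trans (*-congˡ (+-congˡ (*-congˡ same)))
      (solve 5 (λ d s t x y → d :* ((d :+ s :* x) :+ t :* y) :=
          (d :* d :+ d :* (s :* x :+ t :* y)) :+ (s :* t) :* (x :* y :- x :* y)) refl
        (det′ M) s t (adj M b a) (adj M v a))
      where
      same : adj (M [ a , b ]+= s) v a ≈ adj M v a
      same = det-cong (set-cong (M [ a , b ]+= s) M a (λ k k≢a j → trans
            (+-congˡ (*-congˡ (*-congʳ (e-other (k≢a ∘ ≡.sym)))))
        (solve 3 (λ x t y → x :+ t :* (:0 :* y) := x) refl _ _ _)) λ _ → refl)
    step (no a≢u) = begin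
      det′ M * ((det′ M + s * adj M b a) + t * adj (M [ a , b ]+= s) v u)
        ≈⟨ *-congˡ (+-congˡ (*-congˡ update)) ⟩
      det′ M * ((det′ M + s * adj M b a) + t * (adj M v u + s * D))
        ≈⟨ solve 6 (λ d s t x y z → d :* ((d :+ s :* x) :+ t :* (y :+ s :* z)) :=
             (d :* d :+ d :* (s :* x :+ t :* y)) :+ (s :* t) :* (d :* z)) refl
             (det′ M) s t (adj M b a) (adj M v u) D ⟩
      (det′ M * det′ M + det′ M * (s * adj M b a + t * adj M v u)) + (s * t) * (det′ M * D)
        ≈⟨ +-congˡ (*-congˡ (jacobi M b v a≢u)) ⟩
      _ ∎
      where
      D = det′ ((M [ a ]≔ e b) [ u ]≔ e v)
      update : adj (M [ a , b ]+= s) v u ≈ adj M v u + s * D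
      update = begin
        adj (M [ a , b ]+= s) v u                          ≈⟨ det-cong pointwise ⟩
        det′ ((M [ u ]≔ e v) [ a , b ]+= s)                 ≈⟨ det-+= (M [ u ]≔ e v) a b s ⟩
        adj M v u + s * det′ ((M [ u ]≔ e v) [ a ]≔ e b)    ≈⟨ +-congˡ
              (*-congˡ (det-cong (set-swap M _ _ (a≢u ∘ ≡.sym)))) ⟩
        adj M v u + s * D                                  ∎
        where
        pointwise : ((M [ a , b ]+= s) [ u ]≔ e v) ≋ ((M [ u ]≔ e v) [ a , b ]+= s)
        pointwise k j with k ≟ u
        ... | yes ≡.refl = trans (row-same (M [ a , b ]+= s) k j)
          (trans (sym (trans (+-congˡ (*-congˡ (*-congʳ (e-other a≢u))))
                (solve 3 (λ x t y → x :+ t :* (:0 :* y) := x) refl _ _ _)))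
            (+-congʳ (sym (row-same M k j))))
        ... | no  k≢u    = trans (row-other (M [ a , b ]+= s) k≢u j)
          (+-congʳ (sym (row-other M k≢u j)))

-- Bordered matrices, Schur complements and principal submatrices.

module BorderedMatrices {c ℓ} (R : CommutativeRing c ℓ) where
  open CommutativeRing R hiding (zero) renaming (Carrier to A)
  open CommutativeRingSolver R
  open Determinants R
  open Adjugates R
  open SetoidReasoning setoid

  private
    variable
      m n : ℕ

  border : A → Row n → Row n → Mat n → Mat (suc n)
  border a p q X zero    zero    = a
  border a p q X zero    (suc j) = p j
  border a p q X (suc i) zero    = q i
  border a p q X (suc i) (suc j) = X i j

  border-cong : ∀ {a b} {p p′ q q′ : Row n} {X X′ : Mat n} → a ≈ b → (∀ j → p j ≈ p′ j) → (∀ i → q i ≈ q′ i) →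
    X ≋ X′ → border a p q X ≋ border b p′ q′ X′
  border-cong a≈ p≈ q≈ X≈ zero    zero    = a≈
  border-cong a≈ p≈ q≈ X≈ zero    (suc j) = p≈ j
  border-cong a≈ p≈ q≈ X≈ (suc i) zero    = q≈ i
  border-cong a≈ p≈ q≈ X≈ (suc i) (suc j) = X≈ i j

  det-linear-first-row : (b a a′ : A) (p p′ q : Row n) (X : Mat n) →
    det′ (border (b * a + a′) (λ j → b * p j + p′ j) q X) ≈ b * det′ (border a p q X) + det′ (border a′ p′ q X)
  det-linear-first-row b a a′ p p′ q X = det-linear zero _ (border a p q X) (border a′ p′ q X) b off off on
    where
    off : ∀ {a a′ p p′} k → k ≢ zero → ∀ j → border a p q X k j ≈ border a′ p′ q X k j
    off zero    k≢0 j       = contradiction ≡.refl k≢0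
    off (suc k) _   zero    = refl
    off (suc k) _   (suc j) = refl
    on : ∀ j → border (b * a + a′) (λ j → b * p j + p′ j) q X zero j ≈
               b * border a p q X zero j + border a′ p′ q X zero j
    on zero    = refl
    on (suc j) = refl

  det-border-unit-row : (q : Row n) (X : Mat n) → det′ (border 1# (λ _ → 0#) q X) ≈ det′ X
  det-border-unit-row q X = begin
    det′ (border 1# (λ _ → 0#) q X)
      ≈⟨ trans (det-first-row _) (∑-suc _) ⟩
    (1# * 1#) * det′ X + ∑ (λ j → (sign (suc j) * 0#) * det′ (minor zero (suc j) (border 1# (λ _ → 0#) q X)))
      ≈⟨ +-congˡ (∑-zero λ j → solve 2 (λ s d → (s :* :0) :* d := :0) refl _ _) ⟩
    (1# * 1#) * det′ X + 0#
      ≈⟨ solve 1 (λ d → (:1 :* :1) :* d :+ :0 := d) refl _ ⟩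
    det′ X ∎

  det-border-transpose : (a : A) (p q : Row n) (X : Mat n) → det′ (border a p q X) ≈ det′ (border a q p (X ᵀ))
  det-border-transpose a p q X = trans (sym (det-transpose (border a p q X))) (det-cong λ
    { zero    zero    → refl
    ; zero    (suc j) → refl
    ; (suc i) zero    → refl
    ; (suc i) (suc j) → refl })

  det-border-unit-column : (p : Row n) (X : Mat n) → det′ (border 1# p (λ _ → 0#) X) ≈ det′ X
  det-border-unit-column p X = trans (det-border-transpose 1# p _ X)
        (trans (det-border-unit-row p (X ᵀ)) (det-transpose X))

  -- `Φ` is an arbitrary function of the rows because the induction hides the row already treated
  -- inside a new function `Ψ` of the remaining ones.
  row-operations : (Φ : (Fin m → Row n) → A) → (∀ {Y Z} → (∀ i j → Y i j ≈ Z i j) → Φ Y ≈ Φ Z) → (w : Row n) →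
    (∀ Y i b → Φ (Y [ i ]≔ (λ j → Y i j + b * w j)) ≈ Φ Y) →
    ∀ (q : Row m) Y → Φ (λ i j → Y i j + q i * w j) ≈ Φ Y
  row-operations {zero}  Φ Φ-cong w inv q Y = Φ-cong λ ()
  row-operations {suc m} Φ Φ-cong w inv q Y = begin
    Φ (λ i j → Y i j + q i * w j)
      ≈⟨ Φ-cong (λ { zero _ → refl ; (suc _) _ → refl }) ⟩
    Ψ (λ i j → Y (suc i) j + q (suc i) * w j)
      ≈⟨ row-operations Ψ (λ Y≈Z → Φ-cong λ { zero _ → refl ; (suc i) → Y≈Z i }) w
           (λ Z i b → trans (Φ-cong λ { zero _ → refl ; (suc _) _ → refl }) (inv (cons Z) (suc i) b)) (q ∘ suc)
                 (Y ∘ suc) ⟩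
    Ψ (Y ∘ suc)
      ≈⟨ Φ-cong (λ { zero _ → refl ; (suc _) _ → refl }) ⟩
    Φ (Y [ zero ]≔ (λ j → Y zero j + q zero * w j))
      ≈⟨ inv Y zero (q zero) ⟩
    Φ Y ∎
    where
    cons : (Fin m → Row _) → Fin (suc m) → Row _
    cons Z zero    j = Y zero j + q zero * w j
    cons Z (suc i) j = Z i j
    Ψ : (Fin m → Row _) → A
    Ψ Z = Φ (cons Z)

  private
    -- The corner 1 clears the first column by row operations with the first row, leaving the Schur
    -- complement in the block.
    det-border-one : (p q : Row n) (X : Mat n) → det′ (border 1# p q X) ≈ det′ (λ i j → X i j - q i * p j)
    det-border-one {n} p q X = begin
      det′ (border 1# p q X)                        ≈⟨ det-cong
            (λ { zero _ → refl ; (suc i) zero → refl ; (suc i) (suc j) → refl }) ⟩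
      Φ (λ i → border 1# p q X (suc i))            ≈⟨ row-operations Φ Φ-cong w inv (λ i → - q i) _ ⟨
      Φ (λ i j → border 1# p q X (suc i) j + - q i * w j)
        ≈⟨ det-cong (λ { zero zero → refl ; zero (suc j) → refl
                       ; (suc i) zero → solve 1 (λ x → x :+ (:- x) :* :1 := :0) refl (q i)
                       ; (suc i) (suc j) → solve 3 (λ x y z → x :+ (:- y) :* z := x :- y :* z) refl (X i j) (q i)
                             (p j) }) ⟩
      det′ (border 1# p (λ _ → 0#) (λ i j → X i j - q i * p j)) ≈⟨ det-border-unit-column p _ ⟩
      det′ (λ i j → X i j - q i * p j)              ∎
      where
      w : Row (suc n)
      w = border 1# p q X zero
      cons : (Fin n → Row (suc n)) → Mat (suc n)
      cons Y zero    = w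
      cons Y (suc i) = Y i
      Φ : (Fin n → Row (suc n)) → A
      Φ Y = det′ (cons Y)
      Φ-cong : ∀ {Y Z} → (∀ i j → Y i j ≈ Z i j) → Φ Y ≈ Φ Z
      Φ-cong Y≈Z = det-cong λ { zero _ → refl ; (suc i) → Y≈Z i }
      inv : ∀ Y i b → Φ (Y [ i ]≔ (λ j → Y i j + b * w j)) ≈ Φ Y
      inv Y i b = begin
        Φ (Y [ i ]≔ (λ j → Y i j + b * w j))
          ≈⟨ det-cong (λ { zero j → refl ; (suc k) j → refl }) ⟩
        det′ (cons Y [ suc i ]≔ (λ j → Y i j + b * w j))
          ≈⟨ det-set-cong (cons Y) (suc i) (λ j → +-comm _ _) ⟩
        det′ (cons Y [ suc i ]≔ (λ j → b * w j + Y i j))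
          ≈⟨ det-set-linear (cons Y) (suc i) b w (Y i) ⟩
        b * det′ (cons Y [ suc i ]≔ cons Y zero) + det′ (cons Y [ suc i ]≔ cons Y (suc i))
          ≈⟨ +-cong (trans (*-congˡ (det-set-other-row (cons Y) {suc i} {zero} λ ())) (zeroʳ b))
               (det-cong (set-id (cons Y) (suc i) λ _ → refl)) ⟩
        0# + Φ Y
          ≈⟨ +-identityˡ _ ⟩
        Φ Y ∎

  -- A Schur complement that does not invert the corner: the first row is a - 1 times a unit row
  -- plus a row with corner 1.
  det-border : (a : A) (p q : Row n) (X : Mat n) →
    det′ (border a p q X) ≈ (a - 1#) * det′ X + det′ (λ i j → X i j - q i * p j)
  det-border a p q X = begin
    det′ (border a p q X)
      ≈⟨ det-cong (border-cong (solve 1 (λ a → a := (a :- :1) :* :1 :+ :1) refl a)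
           (λ j → solve 2 (λ b x → x := b :* :0 :+ x) refl (a - 1#) (p j)) (λ _ → refl) λ _ _ → refl) ⟩
    det′ (border ((a - 1#) * 1# + 1#) (λ j → (a - 1#) * 0# + p j) q X)
      ≈⟨ det-linear-first-row (a - 1#) 1# 1# (λ _ → 0#) p q X ⟩
    (a - 1#) * det′ (border 1# (λ _ → 0#) q X) + det′ (border 1# p q X)
      ≈⟨ +-cong (*-congˡ (det-border-unit-row q X)) (det-border-one p q X) ⟩
    (a - 1#) * det′ X + det′ (λ i j → X i j - q i * p j) ∎

  -- The part split off from the first row forms a border whose first row is repeated as row `u`
  -- below.
  det-border-subtract-row : (a : A) (p q : Row n) (X : Mat n) (u : Fin n) →
    det′ (border a p q X) ≈ det′ (border (a - q u) (λ j → p j - X u j) q X)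
  det-border-subtract-row a p q X u = begin
    det′ (border a p q X)
      ≈⟨ det-cong (border-cong (split _ _) (λ j → split _ _) (λ _ → refl) λ _ _ → refl) ⟩
    det′ (border (1# * (a - q u) + q u) (λ j → 1# * (p j - X u j) + X u j) q X)
      ≈⟨ det-linear-first-row 1# (a - q u) (q u) (λ j → p j - X u j) (X u) q X ⟩
    1# * det′ (border (a - q u) (λ j → p j - X u j) q X) + det′ (border (q u) (X u) q X)
      ≈⟨ +-cong (*-identityˡ _) (det-equal-rows _ zero (suc u) (λ ()) λ { zero → refl ; (suc j) → refl }) ⟩
    det′ (border (a - q u) (λ j → p j - X u j) q X) + 0#
      ≈⟨ +-identityʳ _ ⟩
    det′ (border (a - q u) (λ j → p j - X u j) q X) ∎
    where
    split : ∀ x y → x ≈ 1# * (x - y) + y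
    split = solve 2 (λ x y → x := :1 :* (x :- y) :+ y) refl

  det-border-subtract-column : (a : A) (p q : Row n) (X : Mat n) (u : Fin n) →
    det′ (border a p q X) ≈ det′ (border (a - p u) p (λ i → q i - X i u) X)
  det-border-subtract-column a p q X u = trans (det-border-transpose a p q X)
    (trans (det-border-subtract-row a q p (X ᵀ) u) (det-border-transpose _ _ _ (X ᵀ)))

  -- Rows and columns of the identity matrix at the absent labels leave the determinant of the
  -- principal submatrix unchanged, while the size stays that of the label type.
  padded : Subset n → Mat n → Mat n
  padded V M i j = if does (i ∈? V) ∧ does (j ∈? V) then M i j else e i j

  members : Subset n → List (Fin n)
  members V = List.filter (_∈? V) (List.allFin _)

  private
    opaque
      -- The size of the submatrix is the length of the list, so rewriting the list would change the
      -- type of the matrix; a determinant taken as a function of the list can be rewritten freely.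
      detOn : List (Fin n) → Mat n → A
      detOn xs M = det′ λ i j → M (List.lookup xs i) (List.lookup xs j)

      detOn-det : ∀ xs (M : Mat n) → detOn xs M ≈ det′ λ i j → M (List.lookup xs i) (List.lookup xs j)
      detOn-det xs M = refl

    detOn-cons : ∀ x xs (M : Mat n) →
      detOn (x ∷ xs) M ≈ (M x x - 1#) * detOn xs M + detOn xs (λ i j → M i j - M i x * M x j)
    detOn-cons x xs M = begin
      detOn (x ∷ xs) M
        ≈⟨ detOn-det (x ∷ xs) M ⟩
      _
        ≈⟨ det-cong {N = border (M x x) (λ j → M x (List.lookup xs j)) (λ i → M (List.lookup xs i) x)
             (λ i j → M (List.lookup xs i) (List.lookup xs j))}
             (λ { zero zero → refl ; zero (suc j) → refl ; (suc i) zero → refl ; (suc i) (suc j) → refl }) ⟩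
      _
        ≈⟨ det-border _ _ _ _ ⟩
      _
        ≈⟨ +-cong (*-congˡ (detOn-det xs M)) (detOn-det xs (λ i j → M i j - M i x * M x j)) ⟨
      (M x x - 1#) * detOn xs M + detOn xs (λ i j → M i j - M i x * M x j) ∎

    -- Peeling off the first label by its Schur complement avoids any comparison of positions in the
    -- two lists. It alters the matrix, so the induction is over all `M`.
    detOn-map : (f : Fin m → Fin n) → ∀ xs M → detOn (List.map f xs) M ≈ detOn xs λ i j → M (f i) (f j)
    detOn-map f []       M = trans (detOn-det _ M) (trans (trans (det-empty _) (sym (det-empty _)))
          (sym (detOn-det _ _)))
    detOn-map f (x ∷ xs) M = trans (detOn-cons (f x) (List.map f xs) M)
      (trans (+-cong (*-congˡ (detOn-map f xs M)) (detOn-map f xs _)) (sym (detOn-cons x xs _)))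

    filter-suc : ∀ s (V : Subset n) xs → List.filter (_∈? (s ∷ V)) (List.map suc xs) ≡ List.map suc
          (List.filter (_∈? V) xs)
    filter-suc s V []       = ≡.refl
    filter-suc s V (x ∷ xs) with does (x ∈? V)
    ... | true  = ≡.cong (suc x ∷_) (filter-suc s V xs)
    ... | false = filter-suc s V xs

    later-members : ∀ s (V : Subset n) → List.filter (_∈? (s ∷ V)) (List.tabulate suc) ≡ List.map suc (members V)
    later-members s V = ≡.trans (≡.cong (List.filter (_∈? (s ∷ V))) (≡.sym (map-tabulate id suc)))
          (filter-suc s V (List.allFin _))

    detOn-later-members : ∀ s (V : Subset n) M →
      detOn (List.filter (_∈? (s ∷ V)) (List.tabulate suc)) M ≈ detOn (members V) λ i j → M (suc i) (suc j)
    detOn-later-members s V M = trans (reflexive (≡.cong (λ xs → detOn xs M) (later-members s V)))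
          (detOn-map suc (members V) M)

    -- An absent first label contributes a unit row; for a present one, taking the Schur complement
    -- commutes with padding, since the padded first row and column vanish at absent labels.
    detOn-members : (V : Subset n) (M : Mat n) → detOn (members V) M ≈ det′ (padded V M)
    detOn-members {zero}  []            M = trans (detOn-det _ M) (trans (det-empty _) (sym (det-empty _)))
    detOn-members {suc n} (outside ∷ V) M = begin
      detOn (members (outside ∷ V)) M             ≈⟨ detOn-later-members outside V M ⟩
      detOn (members V) (λ i j → M (suc i) (suc j)) ≈⟨ detOn-members V _ ⟩
      det′ (padded V λ i j → M (suc i) (suc j))    ≈⟨ det-border-unit-row (λ _ → 0#) _ ⟨
      _                                           ≈⟨ det-cong same ⟩
      det′ (padded (outside ∷ V) M)                ∎
      where
      same : border 1# (λ _ → 0#) (λ _ → 0#) (padded V λ i j → M (suc i) (suc j)) ≋ padded (outside ∷ V) M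
      same zero    zero    = refl
      same zero    (suc j) = refl
      same (suc i) zero    with does (i ∈? V)
      ... | true  = refl
      ... | false = refl
      same (suc i) (suc j) = refl
    detOn-members {suc n} (inside ∷ V)  M = begin
      detOn (members (inside ∷ V)) M
        ≈⟨ trans (detOn-cons zero _ M) (+-cong (*-congˡ (detOn-later-members inside V M))
             (detOn-later-members inside V _)) ⟩
      (M zero zero - 1#) * detOn (members V) M° +
        detOn (members V) (λ i j → M° i j - M (suc i) zero * M zero (suc j))
        ≈⟨ +-cong (*-congˡ (detOn-members V M°)) (trans (detOn-members V _) (det-cong schur)) ⟩
      (M zero zero - 1#) * det′ (padded V M°) + det′ (λ i j → padded V M° i j - q i * p j)
        ≈⟨ det-border (M zero zero) p q (padded V M°) ⟨
      _
        ≈⟨ det-cong same ⟩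
      det′ (padded (inside ∷ V) M) ∎
      where
      M° : Mat n
      M° i j = M (suc i) (suc j)
      p q : Row n
      p j = if does (j ∈? V) then M zero (suc j) else 0#
      q i = if does (i ∈? V) then M (suc i) zero else 0#
      schur : padded V (λ i j → M° i j - M (suc i) zero * M zero (suc j)) ≋ (λ i j → padded V M° i j - q i * p j)
      schur i j with does (i ∈? V) | does (j ∈? V)
      ... | true  | true  = refl
      ... | true  | false = solve 2 (λ x y → x := x :- y :* :0) refl _ _
      ... | false | true  = solve 2 (λ x y → x := x :- :0 :* y) refl _ _
      ... | false | false = solve 1 (λ x → x := x :- :0 :* :0) refl _
      same : border (M zero zero) p q (padded V M°) ≋ padded (inside ∷ V) M
      same zero    zero    = refl
      same zero    (suc j) = refl
      same (suc i) zero    with does (i ∈? V)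
      ... | true  = refl
      ... | false = refl
      same (suc i) (suc j) = refl

  det-members : (V : Subset n) (M : Mat n) →
    det′ (λ i j → M (List.lookup (members V) i) (List.lookup (members V) j)) ≈ det′ (padded V M)
  det-members V M = trans (sym (detOn-det (members V) M)) (detOn-members V M)

-- Polynomial functions with a formal degree and a top coefficient.

module PolynomialFunctions {c ℓ} (R : CommutativeRing c ℓ) where
  open CommutativeRing R hiding (zero) renaming (Carrier to A)
  open CommutativeRingSolver R
  open RawSemiringOps (Semiring.rawSemiring semiring) using () renaming (_×_ to _⨯_)
  open Determinants R
  open SetoidReasoning setoid

  private
    variable
      m n : ℕ
      c′ d : A
      f g : A → A

  horner : A → Vec A n → A → A
  horner top []       x = top
  horner top (a ∷ as) x = a + x * horner top as x

  horner-cong : ∀ {top top′} (as : Vec A n) {x y} → top ≈ top′ → x ≈ y → horner top as x ≈ horner top′ as y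
  horner-cong []       top≈ x≈y = top≈
  horner-cong (a ∷ as) top≈ x≈y = +-congˡ (*-cong x≈y (horner-cong as top≈ x≈y))

  -- The degree n is formal: top may be zero.
  Poly : ℕ → A → (A → A) → Set _
  Poly n top f = ∃ λ (as : Vec A n) → ∀ x → f x ≈ horner top as x

  poly-cong : c′ ≈ d → (∀ x → f x ≈ g x) → Poly n c′ f → Poly n d g
  poly-cong c≈d f≈g (as , f≈) = as , λ x → trans (sym (f≈g x)) (trans (f≈ x) (horner-cong as c≈d refl))

  poly-resp : Poly n c′ f → ∀ {x y} → x ≈ y → f x ≈ f y
  poly-resp (as , f≈) x≈y = trans (f≈ _) (trans (horner-cong as refl x≈y) (sym (f≈ _)))

  poly-const : ∀ a → Poly 0 a (λ _ → a)
  poly-const a = [] , λ _ → refl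

  poly-raise : Poly n c′ f → Poly (suc n) 0# f
  poly-raise (as , f≈) = raise as , λ x → trans (f≈ x) (raise-≈ as x)
    where
    raise : Vec A n → Vec A (suc n)
    raise []       = _ ∷ []
    raise (a ∷ as) = a ∷ raise as
    raise-≈ : ∀ (as : Vec A n) x → horner _ as x ≈ horner 0# (raise as) x
    raise-≈ []       x = solve 2 (λ c x → c := c :+ x :* :0) refl _ x
    raise-≈ (a ∷ as) x = +-congˡ (*-congˡ (raise-≈ as x))

  poly-raise* : ∀ k → Poly n c′ f → Poly (suc (k ℕ.+ n)) 0# f
  poly-raise* zero    p = poly-raise p
  poly-raise* (suc k) p = poly-raise (poly-raise* k p)

  poly-lower : Poly (suc n) 0# f → ∃ λ top → Poly n top f
  poly-lower (as , f≈) = let top , bs , e = lower as in top , bs , λ x → trans (f≈ x) (e x)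
    where
    lower : ∀ {n} (as : Vec A (suc n)) → ∃ λ top → ∃ λ (bs : Vec A n) → ∀ x → horner 0# as x ≈ horner top bs x
    lower (a ∷ [])         = a , [] , λ x → solve 2 (λ a x → a :+ x :* :0 := a) refl a x
    lower (a ∷ as@(_ ∷ _)) = let top , bs , e = lower as in top , a ∷ bs , λ x → +-congˡ (*-congˡ (e x))

  poly-+ : Poly n c′ f → Poly n d g → Poly n (c′ + d) (λ x → f x + g x)
  poly-+ (as , f≈) (bs , g≈) = Vec.zipWith _+_ as bs , λ x → trans (+-cong (f≈ x) (g≈ x)) (add as bs x)
    where
    add : ∀ {n} (as bs : Vec A n) x → horner _ as x + horner _ bs x ≈ horner _ (Vec.zipWith _+_ as bs) x
    add []       []       x = refl
    add (a ∷ as) (b ∷ bs) x = trans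
      (solve 5 (λ a b x p q → (a :+ x :* p) :+ (b :+ x :* q) := (a :+ b) :+ x :* (p :+ q)) refl a b x _ _)
      (+-congˡ (*-congˡ (add as bs x)))

  poly-scale : ∀ a → Poly n c′ f → Poly n (a * c′) (λ x → a * f x)
  poly-scale a (as , f≈) = Vec.map (a *_) as , λ x → trans (*-congˡ (f≈ x)) (scale as x)
    where
    scale : ∀ {n} (as : Vec A n) x → a * horner _ as x ≈ horner _ (Vec.map (a *_) as) x
    scale []       x = refl
    scale (b ∷ as) x = trans (solve 4 (λ a b x p → a :* (b :+ x :* p) := a :* b :+ x :* (a :* p)) refl a b x _)
      (+-congˡ (*-congˡ (scale as x)))

  poly-x* : Poly n c′ f → Poly (suc n) c′ (λ x → x * f x)
  poly-x* (as , f≈) = 0# ∷ as , λ x → trans (*-congˡ (f≈ x)) (sym (+-identityˡ _))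

  poly-sub : Poly n c′ f → Poly n d g → Poly n (c′ - d) (λ x → f x - g x)
  poly-sub p q = poly-cong (+-congˡ (neg _)) (λ x → +-congˡ (neg _)) (poly-+ p (poly-scale (- 1#) q))
    where
    neg : ∀ x → - 1# * x ≈ - x
    neg = solve 1 (λ x → (:- :1) :* x := :- x) refl

  poly-* : Poly m c′ f → Poly n d g → Poly (m ℕ.+ n) (c′ * d) (λ x → f x * g x)
  poly-* ([] , f≈)     q = poly-cong refl (λ x → *-congʳ (sym (f≈ x))) (poly-scale _ q)
  poly-* (_∷_ {n = m} a as , f≈) q = poly-cong (+-identityˡ _)
    (λ x → trans (solve 4 (λ a g x h → a :* g :+ x :* (h :* g) := (a :+ x :* h) :* g) refl a _ x _)
          (*-congʳ (sym (f≈ x))))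
    (poly-+ (poly-raise* m (poly-scale a q)) (poly-x* (poly-* (as , λ _ → refl) q)))

  poly-∑ : {t : Fin m → A} {fs : Fin m → A → A} → (∀ i → Poly n (t i) (fs i)) →
    Poly n (∑ t) (λ x → ∑ λ i → fs i x)
  poly-∑ {zero}  {n} ps = poly-cong (sym (∑-empty _)) (λ x → sym (∑-empty _)) (zeros n)
    where
    zeros : ∀ n → Poly n 0# (λ _ → 0#)
    zeros zero    = poly-const 0#
    zeros (suc n) = poly-raise (zeros n)
  poly-∑ {suc m} ps = poly-cong (sym (∑-suc _)) (λ x → sym (∑-suc _)) (poly-+ (ps zero) (poly-∑ (ps ∘ suc)))

  -- Synthetic division: the partial values of Horner's scheme at `r` are the coefficients of the
  -- quotient by x - r.
  quotient : A → A → Vec A (suc n) → Vec A n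
  quotient top r (a ∷ [])         = []
  quotient top r (a ∷ as@(_ ∷ _)) = horner top as r ∷ quotient top r as

  horner-quotient : ∀ top r (as : Vec A (suc n)) x →
    horner top as x ≈ horner top as r + (x - r) * horner top (quotient top r as) x
  horner-quotient top r (a ∷ [])         x =
    solve 4 (λ a x r c → a :+ x :* c := (a :+ r :* c) :+ (x :- r) :* c) refl a x r top
  horner-quotient top r (a ∷ as@(_ ∷ _)) x = trans (+-congˡ (*-congˡ (horner-quotient top r as x)))
    (solve 5 (λ a x r p q → a :+ x :* (p :+ (x :- r) :* q) := (a :+ r :* p) :+ (x :- r) :* (p :+ x :* q)) refl
      a x r (horner top as r) (horner top (quotient top r as) x))

  -- The coefficient of x ^ n collects only the x-parts of the entries. With B the identity matrix
  -- this yields monic polynomials, and with a zero row in B the top coefficient vanishes.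
  poly-det : {B C : Mat n} {M : A → Mat n} → (∀ x i j → M x i j ≈ C i j + x * B i j) →
    Poly n (det′ B) (λ x → det′ (M x))
  poly-det {zero}  M≈ = poly-cong (sym (det-empty _)) (λ x → sym (det-empty _)) (poly-const 1#)
  poly-det {suc n} {B} {C} {M} M≈ = poly-cong (sym (det-first-row B)) (λ x → sym (det-first-row (M x)))
    (poly-∑ λ j → poly-* (poly-cong refl (λ x → *-congˡ (sym (M≈ x zero j)))
                           (poly-scale (sign j) (C zero j ∷ [] , λ x → refl)))
                         (poly-det λ x k l → M≈ x (suc k) (punchIn j l)))

  -- The form of characteristic zero that makes sense in a ring without division: positive integers
  -- are not zero divisors.
  Torsion-free : Set _
  Torsion-free = ∀ n y → (suc n ⨯ 1#) * y ≈ 0# → y ≈ 0#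

  module _ (torsion-free : Torsion-free) where

    open MonoidMult +-monoid using (×-homo-+)

    private
      difference : ∀ k m → (suc k ℕ.+ m) ⨯ 1# - m ⨯ 1# ≈ suc k ⨯ 1#
      difference k m = trans (+-congʳ (×-homo-+ 1# (suc k) m))
        (solve 2 (λ x y → (x :+ y) :- y := x) refl _ _)

      -- Division by x - m keeps the top coefficient. At m + k + 1 the factor x - m is the integer k
      -- + 1, which can be cancelled, so the quotient vanishes at all integers from m + 1 on.
      top-zero : Poly n c′ f → ∀ m → (∀ k → f ((k ℕ.+ m) ⨯ 1#) ≈ 0#) → c′ ≈ 0#
      top-zero {zero}  ([] , f≈) m zeros = trans (sym (f≈ _)) (zeros 0)
      top-zero {suc n} {top} {f} p@(as , f≈) m zeros = top-zero (quotient top r as , λ _ → refl) (suc m) λ k →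
        torsion-free k _ (begin
          (suc k ⨯ 1#) * h ((k ℕ.+ suc m) ⨯ 1#)
            ≈⟨ *-congʳ (difference k m) ⟨
          ((suc k ℕ.+ m) ⨯ 1# - r) * h ((k ℕ.+ suc m) ⨯ 1#)
            ≈⟨ *-congʳ (+-congʳ (reflexive (≡.cong (_⨯ 1#) (≡.sym (ℕ.+-suc k m))))) ⟩
          ((k ℕ.+ suc m) ⨯ 1# - r) * h ((k ℕ.+ suc m) ⨯ 1#)
            ≈⟨ +-identityˡ _ ⟨
          0# + ((k ℕ.+ suc m) ⨯ 1# - r) * h ((k ℕ.+ suc m) ⨯ 1#)
            ≈⟨ +-congʳ (trans (sym (f≈ r)) (zeros 0)) ⟨
          horner top as r + ((k ℕ.+ suc m) ⨯ 1# - r) * h ((k ℕ.+ suc m) ⨯ 1#)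
            ≈⟨ horner-quotient top r as _ ⟨
          horner top as ((k ℕ.+ suc m) ⨯ 1#)
            ≈⟨ f≈ _ ⟨
          f ((k ℕ.+ suc m) ⨯ 1#)
            ≈⟨ reflexive (≡.cong (λ z → f (z ⨯ 1#)) (ℕ.+-suc k m)) ⟩
          f ((suc k ℕ.+ m) ⨯ 1#)
            ≈⟨ zeros (suc k) ⟩
          0# ∎)
        where
        r = m ⨯ 1#
        h = horner top (quotient top r as)

    poly-top-zero : Poly n c′ f → (∀ k → f (k ⨯ 1#) ≈ 0#) → c′ ≈ 0#
    poly-top-zero {f = f} p zeros = top-zero p 0 λ k → trans (reflexive (≡.cong (λ z → f (z ⨯ 1#)) (ℕ.+-identityʳ k)))
          (zeros k)

    poly-top-unique : Poly n c′ f → Poly n d g → (∀ x → f x ≈ g x) → c′ ≈ d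
    poly-top-unique {c′ = c′} {d = d} p q f≈g = begin
      c′             ≈⟨ solve 2 (λ x y → x := (x :- y) :+ y) refl c′ d ⟩
      (c′ - d) + d   ≈⟨ +-congʳ (poly-top-zero (poly-sub p q) λ k → trans (+-congʳ (f≈g _)) (-‿inverseʳ _)) ⟩
      0# + d         ≈⟨ +-identityˡ d ⟩
      d              ∎

    poly-vanishes : Poly n c′ f → (∀ k → f (k ⨯ 1#) ≈ 0#) → ∀ x → f x ≈ 0#
    poly-vanishes {zero}  p@([] , f≈) zeros x = trans (f≈ x) (poly-top-zero p zeros)
    poly-vanishes {suc n} p zeros x =
      poly-vanishes (proj₂ (poly-lower (poly-cong (poly-top-zero p zeros) (λ _ → refl) p))) zeros x

    -- The top coefficient of the product is that of `g`, so it is zero; then the formal degree of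
    -- `g` can be lowered, and the argument repeats.
    poly-cancel-monic : Poly m 1# f → Poly n c′ g → (∀ x → f x * g x ≈ 0#) → ∀ x → g x ≈ 0#
    poly-cancel-monic {n = n} p q fg≈0 with trans (sym (*-identityˡ _)) (poly-top-zero (poly-* p q) λ k → fg≈0 _)
    poly-cancel-monic {n = zero}  p ([] , g≈) fg≈0 | c≈0 = λ x → trans (g≈ x) c≈0
    poly-cancel-monic {n = suc n} p q fg≈0 | c≈0 =
      poly-cancel-monic p (proj₂ (poly-lower (poly-cong c≈0 (λ _ → refl) q))) fg≈0

    -- The degrees of the g k are bounded, although multiplication by x raises the degree.
    poly-shift-zero : ∀ N (g : ℕ → A → A) → (∀ k → ∃ λ top → Poly N top (g k)) →
      (∀ k x → g (suc k) x ≈ x * g k x) → ∀ k x → g k x ≈ 0#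
    poly-shift-zero N g ps shift = go N ps
      where
      top≈0 : ∀ {N} (ps : ∀ k → ∃ λ top → Poly N top (g k)) k → proj₁ (ps k) ≈ 0#
      top≈0 ps k = poly-top-unique (poly-x* (proj₂ (ps k))) (poly-raise (proj₂ (ps (suc k)))) λ x → sym (shift k x)
      go : ∀ N → (∀ k → ∃ λ top → Poly N top (g k)) → ∀ k x → g k x ≈ 0#
      go zero    ps k x with ps k | top≈0 ps k
      ... | top , [] , g≈ | t≈0 = trans (g≈ x) t≈0
      go (suc N) ps     = go N λ k → poly-lower (poly-cong (top≈0 ps k) (λ _ → refl) (proj₂ (ps k)))


-- Walk counts, distance matrices and distance-regularity.

module WalkCounts {n} (G : Graph n) (conn : Connected G) where
  open Graph G
  open FiniteSums ℕ.+-*-commutativeSemiring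
  open ≡.≡-Reasoning

  private
    d : Fin n → Fin n → ℕ
    d = ∂ G conn

  walk-snoc : ∀ k {u w v} → Walk G k u w → w ~ v → Walk G (suc k) u v
  walk-snoc zero    ≡.refl         w~v = _ , w~v , ≡.refl
  walk-snoc (suc k) (x , u~x , wk) w~v = x , u~x , walk-snoc k wk w~v

  walk-reverse : ∀ k {u v} → Walk G k u v → Walk G k v u
  walk-reverse zero    ≡.refl         = ≡.refl
  walk-reverse (suc k) (x , u~x , wk) = walk-snoc k (walk-reverse k wk) (~-sym u~x)

  ∂-walk : ∀ u v → Walk G (d u v) u v
  ∂-walk u v = proj₁ (proj₂ (least (λ k → walk? G k u v) (conn u v)))

  ∂-least : ∀ k {u v} → Walk G k u v → d u v ℕ.≤ k
  ∂-least k {u} {v} = proj₂ (proj₂ (least (λ k → walk? G k u v) (conn u v))) k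

  ∂-sym : ∀ u v → d u v ≡ d v u
  ∂-sym u v = ℕ.≤-antisym (∂-least _ (walk-reverse _ (∂-walk v u))) (∂-least _ (walk-reverse _ (∂-walk u v)))

  ∂-refl : ∀ u → d u u ≡ 0
  ∂-refl u = ℕ.n≤0⇒n≡0 (∂-least 0 ≡.refl)

  ∂≡0⇒≡ : ∀ {u v} → d u v ≡ 0 → u ≡ v
  ∂≡0⇒≡ {u} {v} e = ≡.subst (λ k → Walk G k u v) e (∂-walk u v)

  ∂≡1⇒~ : ∀ {u v} → d u v ≡ 1 → u ~ v
  ∂≡1⇒~ {u} {v} e with ≡.subst (λ k → Walk G k u v) e (∂-walk u v)
  ... | _ , u~w , ≡.refl = u~w

  ~⇒∂≡1 : ∀ {u v} → u ~ v → d u v ≡ 1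
  ~⇒∂≡1 {u} {v} u~v with d u v in eq | ∂-least 1 (_ , u~v , ≡.refl)
  ... | zero        | _           = contradiction (≡.subst (u ~_) (≡.sym (∂≡0⇒≡ eq)) u~v) ~-irrefl
  ... | suc zero    | _           = ≡.refl
  ... | suc (suc _) | ℕ.s≤s ()

  edges : Fin n → Fin n → ℕ
  edges u v = if does (u ~? v) then 1 else 0

  walks : ℕ → Fin n → Fin n → ℕ
  walks zero    u v = δ u v
  walks (suc k) u v = ∑ λ w → walks k u w ℕ.* edges w v

  δ-same : (u : Fin n) → δ u u ≡ 1
  δ-same u with u ≟ u
  ... | yes _   = ≡.refl
  ... | no  u≢u = contradiction ≡.refl u≢u

  δ-other : {u v : Fin n} → u ≢ v → δ u v ≡ 0
  δ-other {u} {v} u≢v with u ≟ v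
  ... | yes u≡v = contradiction u≡v u≢v
  ... | no  _   = ≡.refl

  ∑-δˡ : ∀ u (f : Fin n → ℕ) → ∑ (λ w → δ u w ℕ.* f w) ≡ f u
  ∑-δˡ u f = ≡.trans (∑-single _ u λ j j≢u → ≡.cong (ℕ._* f j) (δ-other (j≢u ∘ ≡.sym)))
    (≡.trans (≡.cong (ℕ._* f u) (δ-same u)) (ℕ.+-identityʳ _))

  ∑-δʳ : ∀ v (f : Fin n → ℕ) → ∑ (λ w → f w ℕ.* δ w v) ≡ f v
  ∑-δʳ v f = ≡.trans (∑-single _ v λ j j≢v → ≡.trans (≡.cong (f j ℕ.*_) (δ-other j≢v)) (ℕ.*-zeroʳ (f j)))
    (≡.trans (≡.cong (f v ℕ.*_) (δ-same v)) (ℕ.*-identityʳ _))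

  walks-+ : ∀ l k u v → walks (l ℕ.+ k) u v ≡ ∑ λ w → walks l u w ℕ.* walks k w v
  walks-+ l zero    u v rewrite ℕ.+-identityʳ l = ≡.sym (∑-δʳ v (walks l u))
  walks-+ l (suc k) u v rewrite ℕ.+-suc l k = begin
    ∑ (λ x → walks (l ℕ.+ k) u x ℕ.* edges x v)
      ≡⟨ ∑-cong (λ x → ≡.trans (≡.cong (ℕ._* edges x v) (walks-+ l k u x))
           (≡.trans (ℕ.*-comm (∑ λ w → walks l u w ℕ.* walks k w x) (edges x v))
                 (∑-*ˡ (edges x v) (λ w → walks l u w ℕ.* walks k w x)))) ⟩
    ∑ (λ x → ∑ λ w → edges x v ℕ.* (walks l u w ℕ.* walks k w x))
      ≡⟨ ∑-swap _ ⟩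
    ∑ (λ w → ∑ λ x → edges x v ℕ.* (walks l u w ℕ.* walks k w x))
      ≡⟨ ∑-cong (λ w → ≡.trans (∑-cong λ x → ≡.trans (ℕ.*-comm (edges x v) (walks l u w ℕ.* walks k w x))
           (ℕ.*-assoc (walks l u w) (walks k w x) (edges x v)))
           (≡.sym (∑-*ˡ (walks l u w) (λ x → walks k w x ℕ.* edges x v)))) ⟩
    ∑ (λ w → walks l u w ℕ.* walks (suc k) w v) ∎

  δ-sym : ∀ u v → δ u v ≡ δ v u
  δ-sym u v with u ≟ v
  ... | yes ≡.refl = ≡.sym (δ-same u)
  ... | no  u≢v    = ≡.sym (δ-other (u≢v ∘ ≡.sym))

  edges-sym : ∀ u v → edges u v ≡ edges v u
  edges-sym u v with u ~? v | v ~? u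
  ... | yes _   | yes _   = ≡.refl
  ... | yes u~v | no v≁u  = contradiction (~-sym u~v) v≁u
  ... | no u≁v  | yes v~u = contradiction (~-sym v~u) u≁v
  ... | no _    | no _    = ≡.refl

  walks-sym : ∀ k u v → walks k u v ≡ walks k v u
  walks-sym zero    u v = δ-sym u v
  walks-sym (suc k) u v = begin
    ∑ (λ w → walks k u w ℕ.* edges w v)     ≡⟨ ∑-cong (λ w → ≡.trans (ℕ.*-comm (walks k u w) (edges w v))
                                                 (≡.cong₂ ℕ._*_ (≡.trans (edges-sym w v)
                                                       (≡.sym (∑-δˡ v (λ x → edges x w)))) (walks-sym k u w))) ⟩
    ∑ (λ w → walks 1 v w ℕ.* walks k w u)   ≡⟨ walks-+ 1 k v u ⟨
    walks (suc k) v u                        ∎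

  ∑≢0 : ∀ {m} (f : Fin m → ℕ) → ∑ f ≢ 0 → ∃ λ i → f i ≢ 0
  ∑≢0 {zero}  f ∑≢0′ = contradiction (∑-empty f) ∑≢0′
  ∑≢0 {suc m} f ∑≢0′ with f zero ℕ.≟ 0
  ... | no  f0≢0 = zero , f0≢0
  ... | yes f0≡0 = let i , fi≢0 = ∑≢0 (f ∘ suc) (λ e → ∑≢0′ (≡.trans (∑-suc f) (≡.cong₂ ℕ._+_ f0≡0 e)))
                   in suc i , fi≢0

  ∑≡0 : ∀ {m} (f : Fin m → ℕ) → ∑ f ≡ 0 → ∀ i → f i ≡ 0
  ∑≡0 f e zero    = ℕ.m+n≡0⇒m≡0 (f zero) (≡.trans (≡.sym (∑-suc f)) e)
  ∑≡0 f e (suc i) = ∑≡0 (f ∘ suc) (ℕ.m+n≡0⇒n≡0 (f zero) (≡.trans (≡.sym (∑-suc f)) e)) i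

  edges≢0 : ∀ {u v} → edges u v ≢ 0 → u ~ v
  edges≢0 {u} {v} e≢0 with u ~? v
  ... | yes u~v = u~v
  ... | no  _   = contradiction ≡.refl e≢0

  walks≢0⇒walk : ∀ k {u v} → walks k u v ≢ 0 → Walk G k u v
  walks≢0⇒walk zero {u} {v} w≢0 with u ≟ v
  ... | yes u≡v = u≡v
  ... | no  _   = contradiction ≡.refl w≢0
  walks≢0⇒walk (suc k) {u} {v} w≢0 = let x , x≢0 = ∑≢0 _ w≢0 in
    walk-snoc k (walks≢0⇒walk k λ e → x≢0 (≡.cong (ℕ._* edges x v) e))
      (edges≢0 λ e → x≢0 (≡.trans (≡.cong (walks k u x ℕ.*_) e) (ℕ.*-zeroʳ (walks k u x))))

  -- `Walk` grows at its start and `walks` at its end, so the induction naturally reverses the pair.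
  walk⇒walks≢0 : ∀ k {u v} → Walk G k u v → walks k v u ≢ 0
  walk⇒walks≢0 zero    {u} ≡.refl e with () ← ≡.trans (≡.sym (δ-same u)) e
  walk⇒walks≢0 (suc k) {u} {v} (x , u~x , wk) e with ℕ.m*n≡0⇒m≡0∨n≡0 (walks k v x) (∑≡0 _ e x)
  ... | inj₁ e₁ = walk⇒walks≢0 k wk e₁
  ... | inj₂ e₂ with x ~? u
  ...   | no x≁u = x≁u (~-sym u~x)

  DistanceDependent : (Fin n → Fin n → ℕ) → Set
  DistanceDependent M = ∀ {u v u′ v′} → d u v ≡ d u′ v′ → M u v ≡ M u′ v′

  private
    ∑≡sum : ∀ {m} (f : Fin m → ℕ) → ∑ f ≡ ListAction.sum (List.map f (List.allFin m))
    ∑≡sum f = ≡.trans (go f) (≡.cong ListAction.sum (≡.sym (map-tabulate id f)))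
      where
      go : ∀ {m} (f : Fin m → ℕ) → ∑ f ≡ ListAction.sum (List.tabulate f)
      go {zero}  f = ∑-empty f
      go {suc m} f = ≡.trans (∑-suc f) (≡.cong (f zero ℕ.+_) (go (f ∘ suc)))

  module _ {B : Set} where
    count : (p q : B → ℕ) (i j : ℕ) → List B → ℕ
    count p q i j xs = List.length (List.filter (λ w → (p w ℕ.≟ i) ×-dec (q w ℕ.≟ j)) xs)

    private
      count-cons-same : ∀ p q {i j} y ys → p y ≡ i → q y ≡ j → count p q i j (y ∷ ys) ≡ suc (count p q i j ys)
      count-cons-same p q y ys ≡.refl ≡.refl
        rewrite dec-true (p y ℕ.≟ p y) ≡.refl | dec-true (q y ℕ.≟ q y) ≡.refl = ≡.refl

      count-member : ∀ p q i j ys {k} → count p q i j ys ≡ suc k → ∃ λ y → y ∈ˡ ys × p y ≡ i × q y ≡ j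
      count-member p q i j ys e with List.filter (λ w → (p w ℕ.≟ i) ×-dec (q w ℕ.≟ j)) ys in eq
      ... | y ∷ _ = y , ∈-filter⁻ (λ w → (p w ℕ.≟ i) ×-dec (q w ℕ.≟ j)) (≡.subst (y ∈ˡ_) (≡.sym eq) (here ≡.refl))

      count-cons : ∀ p q p′ q′ i j x y xs ys → p x ≡ p′ y → q x ≡ q′ y →
        count p q i j (x ∷ xs) ≡ count p′ q′ i j (y ∷ ys) → count p q i j xs ≡ count p′ q′ i j ys
      count-cons p q p′ q′ i j x y xs ys px qx e rewrite px | qx with p′ y ℕ.≡ᵇ i | q′ y ℕ.≡ᵇ j
      ... | true  | true  = ℕ.suc-injective e
      ... | true  | false = e
      ... | false | true  = e
      ... | false | false = e

    -- The value of a term depends only on its class under the two labels. Equal counts provide, for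
    -- the head of the first list, a member of the same class in the second; removing both keeps all
    -- counts equal.
    sum-by-counts : (p q p′ q′ t t′ : B → ℕ) → (∀ {x y} → p x ≡ p′ y → q x ≡ q′ y → t x ≡ t′ y) →
      ∀ xs ys → (∀ i j → count p q i j xs ≡ count p′ q′ i j ys) →
      ListAction.sum (List.map t xs) ≡ ListAction.sum (List.map t′ ys)
    sum-by-counts p q p′ q′ t t′ t≡t′ []       []       counts = ≡.refl
    sum-by-counts p q p′ q′ t t′ t≡t′ []       (y ∷ ys) counts
      with () ← ≡.trans (counts _ _) (count-cons-same p′ q′ y ys ≡.refl ≡.refl)
    sum-by-counts p q p′ q′ t t′ t≡t′ (x ∷ xs) ys       counts
      with y , y∈ys , p′y , q′y ← count-member p′ q′ (p x) (q x) ys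
             (≡.trans (≡.sym (counts _ _)) (count-cons-same p q x xs ≡.refl ≡.refl))
      with ls , rs , ≡.refl ← ∈-∃++ y∈ys = begin
        t x ℕ.+ ListAction.sum (List.map t xs)
          ≡⟨ ≡.cong₂ ℕ._+_ (t≡t′ (≡.sym p′y) (≡.sym q′y)) (sum-by-counts p q p′ q′ t t′ t≡t′ xs (ls List.++ rs)
               λ i j →
               count-cons p q p′ q′ i j x y xs (ls List.++ rs) (≡.sym p′y) (≡.sym q′y)
                 (≡.trans (counts i j) (↭-length (filter-↭ _ (shift y ls rs))))) ⟩
        t′ y ℕ.+ ListAction.sum (List.map t′ (ls List.++ rs))
          ≡⟨ sum-↭ (map⁺ t′ (shift y ls rs)) ⟨
        ListAction.sum (List.map t′ (ls List.++ y ∷ rs)) ∎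

  -- In the recursion for `walks`, the summand at w depends only on the distances of w to the two
  -- ends, and distance-regularity says how often each pair of distances occurs.
  distanceRegular⇒walks : DistanceRegular G conn → ∀ k → DistanceDependent (walks k)
  distanceRegular⇒walks dr zero {u} {v} {u′} {v′} e with u ≟ v | u′ ≟ v′
  ... | yes _      | yes _      = ≡.refl
  ... | yes ≡.refl | no  u′≢v′  = contradiction (∂≡0⇒≡ (≡.trans (≡.sym e) (∂-refl u))) u′≢v′
  ... | no  u≢v    | yes ≡.refl = contradiction (∂≡0⇒≡ (≡.trans e (∂-refl u′))) u≢v
  ... | no  _      | no  _      = ≡.refl
  distanceRegular⇒walks dr (suc k) {u} {v} {u′} {v′} e = begin
    ∑ (λ w → walks k u w ℕ.* edges w v)     ≡⟨ ∑≡sum _ ⟩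
    _                                       ≡⟨ sum-by-counts (d u) (d v) (d u′) (d v′) _ _
                                                 (λ {x} {y} eu ev → ≡.cong₂ ℕ._*_ (distanceRegular⇒walks dr k eu)
                                                       (edges-∂ x y ev))
                                                 (List.allFin n) (List.allFin n) (λ i j → dr i j e) ⟩
    _                                       ≡⟨ ∑≡sum _ ⟨
    ∑ (λ w → walks k u′ w ℕ.* edges w v′)   ∎
    where
    edges-∂ : ∀ x y → d v x ≡ d v′ y → edges x v ≡ edges y v′
    edges-∂ x y e with x ~? v | y ~? v′
    ... | yes _   | yes _    = ≡.refl
    ... | yes x~v | no y≁v′  = contradiction (~-sym (∂≡1⇒~ (≡.trans (≡.sym e) (~⇒∂≡1 (~-sym x~v))))) y≁v′
    ... | no x≁v  | yes y~v′ = contradiction (~-sym (∂≡1⇒~ (≡.trans e (~⇒∂≡1 (~-sym y~v′))))) x≁v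
    ... | no _    | no _     = ≡.refl

  atDistance : ℕ → Fin n → Fin n → ℕ
  atDistance i u v = if does (d u v ℕ.≟ i) then 1 else 0

  infixl 7 _∙_
  _∙_ : (M N : Fin n → Fin n → ℕ) → Fin n → Fin n → ℕ
  (M ∙ N) u v = ∑ λ w → M u w ℕ.* N w v

  -- The distance matrices A i are linear combinations of the powers of A, since A ^ i is a
  -- combination of A 0, …, A i in which A i has a nonzero coefficient.
  module _ (walks-dependent : ∀ k → DistanceDependent (walks k)) (X : Fin n → Fin n → ℕ) where

    private
      -- Behaves like a linear space. Natural numbers have no subtraction or division, so linear
      -- combinations are solved for a term by `V-cancel` and `V-divide`. The right factor `X` will
      -- be a power of the adjacency matrix and later a distance matrix.
      V : (Fin n → Fin n → ℕ) → Set
      V M = DistanceDependent (M ∙ X)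

      V-cong : ∀ {M N} → (∀ u v → M u v ≡ N u v) → V M → V N
      V-cong M≡N vM {u} {v} {u′} {v′} e = ≡.trans (∑-cong λ w → ≡.cong (ℕ._* X w v) (≡.sym (M≡N u w)))
        (≡.trans (vM e) (∑-cong λ w → ≡.cong (ℕ._* X w v′) (M≡N u′ w)))

      ∙-distrib : ∀ M N u v → ((λ u v → M u v ℕ.+ N u v) ∙ X) u v ≡ (M ∙ X) u v ℕ.+ (N ∙ X) u v
      ∙-distrib M N u v = ≡.trans (∑-cong λ w → ℕ.*-distribʳ-+ (X w v) (M u w) (N u w)) (∑-+ _ _)

      ∙-scale : ∀ c M u v → ((λ u v → c ℕ.* M u v) ∙ X) u v ≡ c ℕ.* (M ∙ X) u v
      ∙-scale c M u v = ≡.trans (∑-cong λ w → ℕ.*-assoc c (M u w) (X w v)) (≡.sym (∑-*ˡ c (λ w → M u w ℕ.* X w v)))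

      V-cancel : ∀ M N → V N → V (λ u v → M u v ℕ.+ N u v) → V M
      V-cancel M N vN vM+N {u} {v} {u′} {v′} e = ℕ.+-cancelʳ-≡ ((N ∙ X) u v) _ _ (begin
        (M ∙ X) u v ℕ.+ (N ∙ X) u v      ≡⟨ ∙-distrib M N u v ⟨
        _                                ≡⟨ vM+N e ⟩
        _                                ≡⟨ ∙-distrib M N u′ v′ ⟩
        (M ∙ X) u′ v′ ℕ.+ (N ∙ X) u′ v′  ≡⟨ ≡.cong ((M ∙ X) u′ v′ ℕ.+_) (vN e) ⟨
        (M ∙ X) u′ v′ ℕ.+ (N ∙ X) u v    ∎)

      V-scale : ∀ c M → V M → V (λ u v → c ℕ.* M u v)
      V-scale c M vM e = ≡.trans (∙-scale c M _ _) (≡.trans (≡.cong (c ℕ.*_) (vM e)) (≡.sym (∙-scale c M _ _)))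

      V-divide : ∀ c M → c ≢ 0 → V (λ u v → c ℕ.* M u v) → V M
      V-divide c M c≢0 vcM e = ℕ.*-cancelˡ-≡ _ _ c {{ℕ.≢-nonZero c≢0}}
        (≡.trans (≡.sym (∙-scale c M _ _)) (≡.trans (vcM e) (∙-scale c M _ _)))

      -- As k runs from 0 to i, these lead from the whole i-th power to a multiple of the i-th
      -- distance matrix, losing a multiple of one smaller distance matrix at a time.
      beyond : ℕ → ℕ → Fin n → Fin n → ℕ
      beyond i k u v = if does (d u v ℕ.<? k) then 0 else walks i u v

      pair? : ∀ k → Dec (∃ λ u → ∃ λ v → d u v ≡ k)
      pair? k = any? λ u → any? λ v → d u v ℕ.≟ k

      beyond-step : ∀ i k a b → d a b ≡ k → ∀ u v →
        beyond i k u v ≡ beyond i (suc k) u v ℕ.+ walks i a b ℕ.* atDistance k u v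
      beyond-step i k a b ab u v with ℕ.<-cmp (d u v) k
      ... | tri< lt ne _ rewrite dec-true (d u v ℕ.<? k) lt | dec-true (d u v ℕ.<? suc k) (ℕ.m<n⇒m<1+n lt)
                               | dec-false (d u v ℕ.≟ k) ne = ≡.sym (ℕ.*-zeroʳ (walks i a b))
      ... | tri≈ nlt e _ rewrite dec-false (d u v ℕ.<? k) nlt | dec-true (d u v ℕ.<? suc k) (ℕ.s≤s (ℕ.≤-reflexive e))
                               | dec-true (d u v ℕ.≟ k) e =
        ≡.trans (walks-dependent i (≡.trans e (≡.sym ab))) (≡.sym (ℕ.*-identityʳ (walks i a b)))
      ... | tri> nlt ne gt rewrite dec-false (d u v ℕ.<? k) nlt | dec-false (d u v ℕ.<? suc k)
            (λ lt → ℕ.<⇒≱ gt (ℕ.≤-pred lt))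
                               | dec-false (d u v ℕ.≟ k) ne =
        ≡.sym (≡.trans (≡.cong (walks i u v ℕ.+_) (ℕ.*-zeroʳ (walks i a b))) (ℕ.+-identityʳ _))

      beyond-skip : ∀ i k → ¬ (∃ λ u → ∃ λ v → d u v ≡ k) → ∀ u v → beyond i k u v ≡ beyond i (suc k) u v
      beyond-skip i k none u v with ℕ.<-cmp (d u v) k
      ... | tri< lt ne _ rewrite dec-true (d u v ℕ.<? k) lt | dec-true (d u v ℕ.<? suc k) (ℕ.m<n⇒m<1+n lt) = ≡.refl
      ... | tri≈ nlt e _ = contradiction (u , v , e) none
      ... | tri> nlt ne gt rewrite dec-false (d u v ℕ.<? k) nlt | dec-false (d u v ℕ.<? suc k)
            (λ lt → ℕ.<⇒≱ gt (ℕ.≤-pred lt)) = ≡.refl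

      -- Beyond distance i the power has no entries, because a walk with i edges gets no further; at
      -- distance i all its entries are the same.
      beyond-last : ∀ i a b → d a b ≡ i → ∀ u v → beyond i i u v ≡ walks i a b ℕ.* atDistance i u v
      beyond-last i a b ab u v with ℕ.<-cmp (d u v) i
      ... | tri< lt ne _ rewrite dec-true (d u v ℕ.<? i) lt | dec-false (d u v ℕ.≟ i) ne = ≡.sym
            (ℕ.*-zeroʳ (walks i a b))
      ... | tri≈ nlt e _ rewrite dec-false (d u v ℕ.<? i) nlt | dec-true (d u v ℕ.≟ i) e =
        ≡.trans (walks-dependent i (≡.trans e (≡.sym ab))) (≡.sym (ℕ.*-identityʳ (walks i a b)))
      ... | tri> nlt ne gt rewrite dec-false (d u v ℕ.<? i) nlt | dec-false (d u v ℕ.≟ i) ne with walks i u v ℕ.≟ 0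
      ...   | yes w≡0 = ≡.trans w≡0 (≡.sym (ℕ.*-zeroʳ (walks i a b)))
      ...   | no  w≢0 = contradiction (∂-least i (walks≢0⇒walk i w≢0)) (ℕ.<⇒≱ gt)

    atDistance-product : (∀ k → DistanceDependent (walks k ∙ X)) → ∀ i → DistanceDependent (atDistance i ∙ X)
    atDistance-product powers = <-rec (λ i → V (atDistance i)) step
      where
      step : ∀ i → (∀ {k} → k ℕ.< i → V (atDistance k)) → V (atDistance i)
      step i below with pair? i
      -- The distance matrix is zero here. Zero lies in `V` by cancelling `walks 0` from the sum 0 +
      -- `walks 0`, which computes to `walks 0`.
      ... | no none = V-cong {M = λ _ _ → 0} zeros (V-cancel (λ _ _ → 0) (walks 0) (powers 0) (powers 0))
        where
        zeros : ∀ u v → 0 ≡ atDistance i u v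
        zeros u v with d u v ℕ.≟ i
        ... | yes e = contradiction (u , v , e) none
        ... | no ne rewrite dec-false (d u v ℕ.≟ i) ne = ≡.refl
      ... | yes (a , b , ab) = V-divide (walks i a b) (atDistance i)
          (walk⇒walks≢0 i (≡.subst (λ k → Walk G k b a) (≡.trans (∂-sym b a) ab) (∂-walk b a)))
          (V-cong (beyond-last i a b ab) (prefix i ℕ.≤-refl))
        where
        prefix : ∀ k → k ℕ.≤ i → V (beyond i k)
        prefix zero    _   = powers i
        prefix (suc k) k<i with pair? k
        ... | no none           = V-cong (beyond-skip i k none) (prefix k (ℕ.<⇒≤ k<i))
        ... | yes (x , y , xy)  = V-cancel (beyond i (suc k)) _ (V-scale (walks i x y) (atDistance k) (below k<i))
                                    (V-cong (beyond-step i k x y xy) (prefix k (ℕ.<⇒≤ k<i)))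

  private
    length-filter-tabulate : ∀ {m} {B : Set} {P : B → Set} (P? : ∀ x → Dec (P x)) (f : Fin m → B) →
      List.length (List.filter P? (List.tabulate f)) ≡ ∑ λ i → if does (P? (f i)) then 1 else 0
    length-filter-tabulate {zero}  P? f = ≡.sym (∑-empty _)
    length-filter-tabulate {suc m} P? f = ≡.trans head (≡.sym (∑-suc _))
      where
      head : List.length (List.filter P? (List.tabulate f)) ≡
             (if does (P? (f zero)) then 1 else 0) ℕ.+ ∑ λ i → if does (P? (f (suc i))) then 1 else 0
      head with does (P? (f zero))
      ... | true  = ≡.cong suc (length-filter-tabulate P? (f ∘ suc))
      ... | false = length-filter-tabulate P? (f ∘ suc)

    atDistance-sym : ∀ i u v → atDistance i u v ≡ atDistance i v u
    atDistance-sym i u v = ≡.cong (λ k → if does (k ℕ.≟ i) then 1 else 0) (∂-sym u v)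

    #atDistances≡ : ∀ i j u v → #atDistances G conn i j u v ≡ (atDistance i ∙ atDistance j) u v
    #atDistances≡ i j u v = ≡.trans (length-filter-tabulate _ id) (∑-cong λ w →
      ≡.trans (both w) (≡.cong (atDistance i u w ℕ.*_) (atDistance-sym j v w)))
      where
      both : ∀ w → (if does (d u w ℕ.≟ i) ∧ does (d v w ℕ.≟ j) then 1 else 0) ≡ atDistance i u w ℕ.* atDistance j v w
      both w with d u w ℕ.≡ᵇ i | d v w ℕ.≡ᵇ j
      ... | true  | true  = ≡.refl
      ... | true  | false = ≡.refl
      ... | false | true  = ≡.refl
      ... | false | false = ≡.refl

  -- Intersection numbers are entries of products of two distance matrices. `atDistance-product`
  -- exchanges a power for a distance matrix only on the left, so the product is transposed between
  -- its two uses; powers and distance matrices are symmetric.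
  walks⇒distanceRegular : (∀ k → DistanceDependent (walks k)) → DistanceRegular G conn
  walks⇒distanceRegular dep i j {u} {v} {u′} {v′} e =
    ≡.trans (#atDistances≡ i j u v) (≡.trans
      (atDistance-product dep (atDistance j) swapped i e) (≡.sym (#atDistances≡ i j u′ v′)))
    where
    products : ∀ i l → DistanceDependent (atDistance i ∙ walks l)
    products i l = atDistance-product dep (walks l)
      (λ k {u} {v} {u′} {v′} e → ≡.trans (≡.sym (walks-+ k l u v)) (≡.trans (dep (k ℕ.+ l) e) (walks-+ k l u′ v′))) i
    transposed : ∀ k u v → (walks k ∙ atDistance j) u v ≡ (atDistance j ∙ walks k) v u
    transposed k u v = ∑-cong λ w → ≡.trans (ℕ.*-comm (walks k u w) (atDistance j w v))
          (≡.cong₂ ℕ._*_ (atDistance-sym j w v) (walks-sym k u w))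
    swapped : ∀ k → DistanceDependent (walks k ∙ atDistance j)
    swapped k {u} {v} {u′} {v′} e = ≡.trans (transposed k u v)
      (≡.trans (products j k (≡.trans (∂-sym v u) (≡.trans e (∂-sym u′ v′)))) (≡.sym (transposed k u′ v′)))

-- Characteristic pencils: adjugates, walk counts and changes on S × S.

module Pencils {c ℓ} (R : CommutativeRing c ℓ) (torsion-free : PolynomialFunctions.Torsion-free R) where
  open CommutativeRing R hiding (zero) renaming (Carrier to A)
  open CommutativeRingSolver R
  open RawSemiringOps (Semiring.rawSemiring semiring) using () renaming (_×_ to _⨯_)
  open MonoidMult +-monoid using (×-homo-+)
  open SemiringMult semiring using (×1-homo-*)
  open Determinants R
  open Adjugates R
  open BorderedMatrices R
  open PolynomialFunctions R
  open SetoidReasoning setoid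

  private
    variable
      n : ℕ

  pencil : Mat n → A → Mat n
  pencil C x i j = C i j + x * e i j

  pencil-cong : {C D : Mat n} → C ≋ D → ∀ x → pencil C x ≋ pencil D x
  pencil-cong C≋D x i j = +-congʳ (C≋D i j)

  det-identity : ∀ n → det′ (e {n}) ≈ 1#
  det-identity zero    = det-empty _
  det-identity (suc n) = trans
    (det-cong {N = border 1# (λ _ → 0#) (λ _ → 0#) e}
      λ { zero zero → refl ; zero (suc _) → refl ; (suc _) zero → refl ; (suc _) (suc _) → refl })
    (trans (det-border-unit-row (λ _ → 0#) e) (det-identity n))

  pencil-poly : (C : Mat n) → Poly n 1# (λ x → det′ (pencil C x))
  pencil-poly C = poly-cong (det-identity _) (λ _ → refl) (poly-det {B = e} {C = C} λ x i j → refl)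

  -- The replaced row is free of x, so the coefficient of x ^ n is zero. Stating the degree as n
  -- rather than n - 1 makes the bound comparable with that of the monic determinant.
  adj-poly : (C : Mat n) (u v : Fin n) → Poly n 0# (λ x → adj (pencil C x) u v)
  adj-poly C u v = poly-cong (det-zero-row B v λ j → row-same e v j) (λ _ → refl)
    (poly-det {B = B} {C = C [ v ]≔ e u} affine)
    where
    B = e [ v ]≔ (λ _ → 0#)
    affine : ∀ x i j → (pencil C x [ v ]≔ e u) i j ≈ (C [ v ]≔ e u) i j + x * B i j
    affine x i j with i ≟ v
    ... | yes ≡.refl = trans (row-same (pencil C x) i j)
      (trans (solve 2 (λ a x → a := a :+ x :* :0) refl (e u j) x)
        (sym (+-cong (row-same C i j) (*-congˡ (row-same e i j)))))
    ... | no  i≢v    = trans (row-other (pencil C x) i≢v j)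
      (sym (+-cong (row-other C i≢v j) (*-congˡ (row-other e i≢v j))))

  ∑-⨯ : (f : Fin n → ℕ) → FiniteSums.∑ ℕ.+-*-commutativeSemiring f ⨯ 1# ≈ ∑ (λ i → f i ⨯ 1#)
  ∑-⨯ {zero}  f = trans (reflexive (≡.cong (_⨯ 1#) (FiniteSums.∑-empty ℕ.+-*-commutativeSemiring f)))
        (sym (∑-empty _))
  ∑-⨯ {suc n} f = trans (reflexive (≡.cong (_⨯ 1#) (FiniteSums.∑-suc ℕ.+-*-commutativeSemiring f)))
    (trans (×-homo-+ 1# (f zero) _) (trans (+-congˡ (∑-⨯ (f ∘ suc))) (sym (∑-suc _))))

  -- With M the matrix x I − A and φ its determinant, A M⁻¹ = x M⁻¹ − I gives the recursion below for
  -- the polynomials A ^ k · adj M, whose degrees stay below n.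
  module _ (G : Graph n) (conn : Connected G) where
    open WalkCounts G conn hiding (_∙_)

    -A : Mat n
    -A u v = - (edges u v ⨯ 1#)

    private
      W : ℕ → Mat n
      W k u v = walks k u v ⨯ 1#

      product : ℕ → A → Mat n
      product k x u v = ∑ λ w → W k u w * adj (pencil -A x) w v

      product-poly : ∀ k u v → Poly n 0# (λ x → product k x u v)
      product-poly k u v = poly-cong (∑-zero λ w → zeroʳ _) (λ _ → refl)
            (poly-∑ λ w → poly-scale (W k u w) (adj-poly -A w v))

      e≈δ : (u v : Fin n) → e u v ≈ δ u v ⨯ 1#
      e≈δ u v with does (u ≟ v)
      ... | true  = sym (+-identityʳ 1#)
      ... | false = refl

      product-zero : ∀ x u v → product 0 x u v ≈ adj (pencil -A x) u v
      product-zero x u v = trans (∑-cong λ w → trans (*-comm _ _) (*-congˡ (sym (e≈δ u w)))) (∑-e u _)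

      A-adj : ∀ x y v → ∑ (λ w → (edges y w ⨯ 1#) * adj (pencil -A x) w v) ≈
                        x * adj (pencil -A x) y v - det′ (pencil -A x) * e y v
      A-adj x y v = begin
        ∑ (λ w → E w * r w)
          ≈⟨ solve 2 (λ s t → s := t :- ((:- :1) :* s :+ t)) refl _ (x * r y) ⟩
        x * r y - (- 1# * ∑ (λ w → E w * r w) + x * r y)
          ≈⟨ +-congˡ (-‿cong (+-congˡ (*-congˡ (trans (sym (∑-e y r)) (∑-cong λ w → *-comm _ _))))) ⟩
        x * r y - (- 1# * ∑ (λ w → E w * r w) + x * ∑ (λ w → e y w * r w))
          ≈⟨ +-congˡ (-‿cong (+-congˡ (∑-*ˡ _ _))) ⟩
        x * r y - (- 1# * ∑ (λ w → E w * r w) + ∑ (λ w → x * (e y w * r w)))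
          ≈⟨ +-congˡ (-‿cong (∑-linear _ _ _)) ⟨
        x * r y - ∑ (λ w → - 1# * (E w * r w) + x * (e y w * r w))
          ≈⟨ +-congˡ (-‿cong (∑-cong λ w → solve 4 (λ a r x e → (:- :1) :* (a :* r) :+ x :* (e :* r) :=
               (:- a :+ x :* e) :* r) refl (E w) (r w) x (e y w))) ⟩
        x * r y - ∑ (λ w → pencil -A x y w * r w)
          ≈⟨ +-congˡ (-‿cong (*-adj (pencil -A x) y v)) ⟩
        x * r y - det′ (pencil -A x) * e y v ∎
        where
        E r : Row n
        E w = edges y w ⨯ 1#
        r w = adj (pencil -A x) w v

      product-suc : ∀ k x u v → product (suc k) x u v ≈ x * product k x u v - det′ (pencil -A x) * W k u v
      product-suc k x u v = begin
        ∑ (λ w → W (suc k) u w * r w)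
          ≈⟨ ∑-cong (λ w → trans (*-comm _ _) (trans (*-congˡ
               (trans (∑-⨯ _) (∑-cong λ y → ×1-homo-* (walks k u y) (edges y w)))) (∑-*ˡ _ _))) ⟩
        ∑ (λ w → ∑ λ y → r w * (W k u y * (edges y w ⨯ 1#)))
          ≈⟨ ∑-swap _ ⟩
        ∑ (λ y → ∑ λ w → r w * (W k u y * (edges y w ⨯ 1#)))
          ≈⟨ ∑-cong (λ y → trans (∑-cong λ w → solve 3 (λ r a b → r :* (a :* b) := a :* (b :* r)) refl (r w) (W k u y)
               (edges y w ⨯ 1#))
               (trans (sym (∑-*ˡ _ _)) (*-congˡ (A-adj x y v)))) ⟩
        ∑ (λ y → W k u y * (x * r y - φ * e y v))
          ≈⟨ ∑-cong (λ y → trans (solve 5 (λ a x r f e → a :* (x :* r :- f :* e) := x :* (a :* r) :+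
               (:- (f :* a)) :* e) refl (W k u y) x (r y) φ (e y v))
               (+-congˡ (*-congˡ (e-sym y v)))) ⟩
        ∑ (λ y → x * (W k u y * r y) + - (φ * W k u y) * e v y)
          ≈⟨ ∑-linear x _ _ ⟩
        x * product k x u v + ∑ (λ y → - (φ * W k u y) * e v y)
          ≈⟨ +-congˡ (∑-e v (λ y → - (φ * W k u y))) ⟩
        x * product k x u v - φ * W k u v ∎
        where
        φ = det′ (pencil -A x)
        r : Row n
        r w = adj (pencil -A x) w v

    -- The determinant term of `product-suc` is multiplied by the walk count, so it drops out of the
    -- difference for two pairs with the same counts; what is left is multiplication by x.
    adj-from-walks : ∀ {u v u′ v′} → (∀ k → walks k u v ≡ walks k u′ v′) →
      ∀ x → adj (pencil -A x) u v ≈ adj (pencil -A x) u′ v′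
    adj-from-walks {u} {v} {u′} {v′} same x = begin
      adj (pencil -A x) u v     ≈⟨ product-zero x u v ⟨
      product 0 x u v           ≈⟨ solve 2 (λ p q → p := (p :- q) :+ q) refl _ _ ⟩
      (product 0 x u v - product 0 x u′ v′) + product 0 x u′ v′
                                ≈⟨ +-congʳ (poly-shift-zero torsion-free n
                                     (λ k x → product k x u v - product k x u′ v′)
                                     (λ k → _ , poly-sub (product-poly k u v) (product-poly k u′ v′)) shift-law 0 x) ⟩
      0# + product 0 x u′ v′    ≈⟨ +-identityˡ _ ⟩
      product 0 x u′ v′         ≈⟨ product-zero x u′ v′ ⟩
      adj (pencil -A x) u′ v′   ∎
      where
      shift-law : ∀ k x → product (suc k) x u v - product (suc k) x u′ v′ ≈ x * (product k x u v - product k x u′ v′)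
      shift-law k x = trans (+-cong (product-suc k x u v) (-‿cong (trans (product-suc k x u′ v′)
          (+-congˡ (-‿cong (*-congˡ (reflexive (≡.cong (_⨯ 1#) (≡.sym (same k)))))))) ))
        (solve 4 (λ x p q t → (x :* p :- t) :- (x :* q :- t) := x :* (p :- q)) refl x _ _ _)

    -- If the two products agree at k, then at k + 1 they differ by the difference of the walk
    -- counts times a monic polynomial of degree n. Both products have coefficient 0 at x ^ n, so
    -- the counts agree, and with them the products at k + 1.
    walks-from-adj : ∀ {u v u′ v′} → (∀ x → adj (pencil -A x) u v ≈ adj (pencil -A x) u′ v′) →
      ∀ k → walks k u v ⨯ 1# ≈ walks k u′ v′ ⨯ 1#
    walks-from-adj {u} {v} {u′} {v′} same k = equal k (products k)
      where
      products : ∀ k x → product k x u v ≈ product k x u′ v′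
      equal : ∀ k → (∀ x → product k x u v ≈ product k x u′ v′) → W k u v ≈ W k u′ v′
      equal k prods = begin
        W k u v
          ≈⟨ solve 2 (λ a b → a := b :- (b :- a) :* :1) refl (W k u v) (W k u′ v′) ⟩
        W k u′ v′ - (W k u′ v′ - W k u v) * 1#
          ≈⟨ +-congˡ (-‿cong (poly-top-unique torsion-free
               (poly-scale (W k u′ v′ - W k u v) (pencil-poly -A))
               (poly-sub (product-poly (suc k) u v) (product-poly (suc k) u′ v′))
               (λ x → sym (trans (+-cong (product-suc k x u v) (-‿cong (product-suc k x u′ v′)))
                 (trans (+-congʳ (+-congʳ (*-congˡ (prods x))))
                   (solve 4 (λ p f a b → (p :- f :* a) :- (p :- f :* b) := (b :- a) :* f) refl _ (det′ (pencil -A x))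
                         (W k u v) (W k u′ v′))))))) ⟩
        W k u′ v′ - (0# - 0#)
          ≈⟨ solve 1 (λ a → a :- (:0 :- :0) := a) refl _ ⟩
        W k u′ v′ ∎
      products zero    x = trans (product-zero x u v) (trans (same x) (sym (product-zero x u′ v′)))
      products (suc k) x = trans (product-suc k x u v) (trans
        (+-cong (*-congˡ (products k x)) (-‿cong (*-congˡ (equal k (products k))))) (sym (product-suc k x u′ v′)))

  module _ (S : Fin n → Set) (f : Fin n → Fin n) (f-injective : ∀ {u v} → S u → S v → f u ≡ f v → u ≡ v) where

    -- Determinant and adjugate entries are carried together because a change of an entry mixes
    -- them.
    record Similar (C C′ : Mat n) : Set (c ⊔ ℓ) where
      field
        det-≈ : ∀ x → det′ (pencil C x) ≈ det′ (pencil C′ x)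
        adj-≈ : ∀ x {u v} → S u → S v → adj (pencil C x) u v ≈ adj (pencil C′ x) (f u) (f v)

    open Similar

    similar-cong : ∀ {C C′ D D′} → C ≋ D → C′ ≋ D′ → Similar C C′ → Similar D D′
    similar-cong {C} {C′} {D} {D′} C≋D C′≋D′ s = record
      { det-≈ = λ x → trans (sym (det-cong (pencil-cong C≋D x))) (trans (det-≈ s x) (det-cong (pencil-cong C′≋D′ x)))
      ; adj-≈ = λ x {u} {v} Su Sv → trans (sym (adj-cong C≋D x u v))
            (trans (adj-≈ s x Su Sv) (adj-cong C′≋D′ x (f u) (f v)))
      }
      where
      adj-cong : ∀ {C D} → C ≋ D → ∀ x u v → adj (pencil C x) u v ≈ adj (pencil D x) u v
      adj-cong C≋D x u v = det-cong (set-cong _ _ v (λ k _ j → pencil-cong C≋D x k j) λ _ → refl)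

    private
      pencil-+= : ∀ (C : Mat n) u v t x → pencil (C [ u , v ]+= t) x ≋ (pencil C x [ u , v ]+= t)
      pencil-+= C u v t x i j = solve 3 (λ a b c → (a :+ b) :+ c := (a :+ c) :+ b) refl _ _ _

    -- The Jacobi identity determines φ · adj after a change of one entry; φ can be cancelled because it
    -- is a monic polynomial in x.
    similar-+= : ∀ {C C′ u v} t → S u → S v → Similar C C′ → Similar (C [ u , v ]+= t) (C′ [ f u , f v ]+= t)
    similar-+= {C} {C′} {u} {v} t Su Sv s = record
      { det-≈ = dets
      -- An adjugate entry is the increase of the determinant when the transposed entry grows by 1;
      -- hence it suffices to compare determinants after two changes.
      ; adj-≈ = λ x {b} {a} Sb Sa → begin
          adj (pencil (C [ u , v ]+= t) x) b a
            ≈⟨ adj-from-dets (C [ u , v ]+= t) x a b ⟩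
          det′ (pencil ((C [ u , v ]+= t) [ a , b ]+= 1#) x) - det′ (pencil (C [ u , v ]+= t) x)
            ≈⟨ +-cong (twice Sa Sb x) (-‿cong (dets x)) ⟩
          det′ (pencil ((C′ [ f u , f v ]+= t) [ f a , f b ]+= 1#) x) - det′ (pencil (C′ [ f u , f v ]+= t) x)
            ≈⟨ adj-from-dets (C′ [ f u , f v ]+= t) x (f a) (f b) ⟨
          adj (pencil (C′ [ f u , f v ]+= t) x) (f b) (f a) ∎
      }
      where
      dets : ∀ x → det′ (pencil (C [ u , v ]+= t) x) ≈ det′ (pencil (C′ [ f u , f v ]+= t) x)
      dets x = begin
        det′ (pencil (C [ u , v ]+= t) x)                         ≈⟨ trans (det-cong (pencil-+= C u v t x))
              (det-+= _ u v t) ⟩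
        det′ (pencil C x) + t * adj (pencil C x) v u              ≈⟨ +-cong (det-≈ s x) (*-congˡ (adj-≈ s x Sv Su)) ⟩
        det′ (pencil C′ x) + t * adj (pencil C′ x) (f v) (f u)    ≈⟨ trans (det-cong (pencil-+= C′ (f u) (f v) t x))
              (det-+= _ (f u) (f v) t) ⟨
        det′ (pencil (C′ [ f u , f v ]+= t) x)                    ∎

      adj-from-dets : ∀ D x a b → adj (pencil D x) b a ≈ det′ (pencil (D [ a , b ]+= 1#) x) - det′ (pencil D x)
      adj-from-dets D x a b = sym (trans (+-congʳ (trans (det-cong (pencil-+= D a b 1# x)) (det-+= _ a b 1#)))
        (solve 2 (λ d r → (d :+ :1 :* r) :- d := r) refl _ _))

      expanded : ∀ C u v a b x →
        det′ (pencil C x) * det′ (pencil ((C [ u , v ]+= t) [ a , b ]+= 1#) x) ≈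
          (det′ (pencil C x) * det′ (pencil C x) +
            det′ (pencil C x) * (t * adj (pencil C x) v u + 1# * adj (pencil C x) b a)) +
          (t * 1#) * (adj (pencil C x) v u * adj (pencil C x) b a - adj (pencil C x) v a * adj (pencil C x) b u)
      expanded C u v a b x = trans
        (*-congˡ (det-cong λ i j → trans (pencil-+= (C [ u , v ]+= t) a b 1# x i j)
              (+-congʳ (pencil-+= C u v t x i j))))
        (det-+=-+= (pencil C x) u v a b t 1#)

      twice : ∀ {a b} → S a → S b → ∀ x →
        det′ (pencil ((C [ u , v ]+= t) [ a , b ]+= 1#) x) ≈ det′
              (pencil ((C′ [ f u , f v ]+= t) [ f a , f b ]+= 1#) x)
      twice {a} {b} Sa Sb x = begin
        D x               ≈⟨ solve 2 (λ p q → p := (p :- q) :+ q) refl (D x) (D′ x) ⟩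
        (D x - D′ x) + D′ x
          ≈⟨ +-congʳ (poly-cancel-monic torsion-free (pencil-poly C)
               (poly-sub (pencil-poly _) (pencil-poly _)) cancelled x) ⟩
        0# + D′ x         ≈⟨ +-identityˡ _ ⟩
        D′ x              ∎
        where
        D D′ : A → A
        D x = det′ (pencil ((C [ u , v ]+= t) [ a , b ]+= 1#) x)
        D′ x = det′ (pencil ((C′ [ f u , f v ]+= t) [ f a , f b ]+= 1#) x)
        cancelled : ∀ x → det′ (pencil C x) * (D x - D′ x) ≈ 0#
        cancelled x = begin
          det′ (pencil C x) * (D x - D′ x)
            ≈⟨ solve 3 (λ f p q → f :* (p :- q) := f :* p :- f :* q) refl _ _ _ ⟩
          det′ (pencil C x) * D x - det′ (pencil C x) * D′ x
            ≈⟨ +-cong (expanded C u v a b x) (-‿cong (trans (*-congʳ (det-≈ s x))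
                 (expanded C′ (f u) (f v) (f a) (f b) x))) ⟩
          _ - _
            ≈⟨ +-congˡ (-‿cong (+-cong
                 (+-cong (*-cong φ≈ φ≈) (*-cong φ≈ (+-cong (*-congˡ (r≈ Sv Su)) (*-congˡ (r≈ Sb Sa)))))
                 (*-congˡ (+-cong (*-cong (r≈ Sv Su) (r≈ Sb Sa)) (-‿cong (*-cong (r≈ Sv Sa) (r≈ Sb Su))))))) ⟨
          _ - _
            ≈⟨ -‿inverseʳ _ ⟩
          0# ∎
          where
          φ≈ = det-≈ s x
          r≈ : ∀ {a b} → S a → S b → adj (pencil C x) a b ≈ adj (pencil C′ x) (f a) (f b)
          r≈ = adj-≈ s x

    private
      e-f : ∀ {u a} → S u → S a → e (f u) (f a) ≈ e u a
      e-f {u} {a} Su Sa with u ≟ a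
      ... | yes ≡.refl = e-same (f u)
      ... | no  u≢a    = e-other λ e → u≢a (f-injective Su Sa e)

      on-entry : ∀ (C : Mat n) u v t → (C [ u , v ]+= t) u v ≈ C u v + t
      on-entry C u v t = +-congˡ (trans (*-congˡ (*-cong (e-same u) (e-same v)))
        (solve 1 (λ t → t :* (:1 :* :1) := t) refl t))

      off-entry : ∀ (C : Mat n) u v t {i j} → ¬ (u ≡ i × v ≡ j) → (C [ u , v ]+= t) i j ≈ C i j
      off-entry C u v t {i} {j} off with u ≟ i
      ... | no  u≢i = solve 3 (λ c t y → c :+ t :* (:0 :* y) := c) refl _ t _
      ... | yes u≡i with v ≟ j
      ...   | no  v≢j = solve 2 (λ c t → c :+ t :* (:1 :* :0) := c) refl _ t
      ...   | yes v≡j = contradiction (u≡i , v≡j) off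

    -- Induction on the positions that may differ. Resetting the first of them in `D` to its value
    -- in `C` leaves a matrix that differs only on the rest of the list; `similar-+=` then undoes
    -- the reset, by the same amount on both sides.
    similar-extend : ∀ {C C′} → Similar C C′ → (∀ {u v} → S u → S v → C u v ≈ C′ (f u) (f v)) →
      (L : List (Fin n × Fin n)) → All (λ (u , v) → S u × S v) L → ∀ D D′ →
      (∀ i j → ¬ (i , j) ∈ˡ L → D i j ≈ C i j) →
      (∀ i j → (∀ {u v} → (u , v) ∈ˡ L → ¬ (f u ≡ i × f v ≡ j)) → D′ i j ≈ C′ i j) →
      (∀ {u v} → (u , v) ∈ˡ L → S u → S v → D u v ≈ D′ (f u) (f v)) → Similar D D′
    similar-extend s C≈C′ []            []               D D′ off off′ on =
      similar-cong (λ i j → sym (off i j λ ())) (λ i j → sym (off′ i j λ ())) s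
    similar-extend {C} {C′} s C≈C′ ((u , v) ∷ L) ((Su , Sv) ∷ SL) D D′ off off′ on =
      similar-cong restore restore′ (similar-+= (- t) Su Sv
        (similar-extend s C≈C′ L SL (D [ u , v ]+= t) (D′ [ f u , f v ]+= t) off₁ off₁′ on₁))
      where
      t = C u v - D u v
      D-uv : D u v ≈ D′ (f u) (f v)
      D-uv = on (here ≡.refl) Su Sv
      restore : ((D [ u , v ]+= t) [ u , v ]+= (- t)) ≋ D
      restore i j = solve 3 (λ d t y → (d :+ t :* y) :+ (:- t) :* y := d) refl (D i j) t _
      restore′ : ((D′ [ f u , f v ]+= t) [ f u , f v ]+= (- t)) ≋ D′
      restore′ i j = solve 3 (λ d t y → (d :+ t :* y) :+ (:- t) :* y := d) refl (D′ i j) t _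
      back : ∀ c d → d + (c - d) ≈ c
      back = solve 2 (λ c d → d :+ (c :- d) := c) refl
      pair? : ∀ (u v i j : Fin n) → Dec (u ≡ i × v ≡ j)
      pair? u v i j = (u ≟ i) ×-dec (v ≟ j)
      off₁ : ∀ i j → ¬ (i , j) ∈ˡ L → (D [ u , v ]+= t) i j ≈ C i j
      off₁ i j ij∉L with pair? u v i j
      ... | yes (≡.refl , ≡.refl) = trans (on-entry D u v t) (back _ _)
      ... | no  ne                = trans (off-entry D u v t ne) (off i j λ
        { (here ≡.refl) → ne (≡.refl , ≡.refl) ; (there ij∈L) → ij∉L ij∈L })
      off₁′ : ∀ i j → (∀ {u v} → (u , v) ∈ˡ L → ¬ (f u ≡ i × f v ≡ j)) → (D′ [ f u , f v ]+= t) i j ≈ C′ i j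
      off₁′ i j ij∉L with pair? (f u) (f v) i j
      ... | yes (≡.refl , ≡.refl) = trans (on-entry D′ (f u) (f v) t)
        (trans (+-cong (sym D-uv) refl) (trans (back _ _) (C≈C′ Su Sv)))
      ... | no  ne                = trans (off-entry D′ (f u) (f v) t ne) (off′ i j λ
        { (here ≡.refl) → ne ; (there ab∈L) → ij∉L ab∈L })
      on₁ : ∀ {a b} → (a , b) ∈ˡ L → S a → S b → (D [ u , v ]+= t) a b ≈ (D′ [ f u , f v ]+= t) (f a) (f b)
      on₁ ab∈L Sa Sb = +-cong (on (there ab∈L) Sa Sb) (*-congˡ (sym (*-cong (e-f Su Sa) (e-f Sv Sb))))

-- Matched pseudographs and single perturbations, for a fixed value of x.

x∉p-x : ∀ {n} (p : Subset n) (x : Fin n) → x ∉ p ∖ x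
x∉p-x (_ ∷ p) zero    ()
x∉p-x (_ ∷ p) (suc x) (there x∈) = x∉p-x p x x∈

module MatchedPseudographs {c ℓ} (R : CommutativeRing c ℓ) (x : CommutativeRing.Carrier R) where
  open CommutativeRing R hiding (zero) renaming (Carrier to A)
  open CommutativeRingSolver R
  open RawSemiringOps (Semiring.rawSemiring semiring) using () renaming (_×_ to _⨯_)
  open Determinants R
  open Adjugates R hiding (adj)
  open BorderedMatrices R
  open SetoidReasoning setoid

  private
    variable
      k m m′ : ℕ

  charEntry : ℕ → Fin m → Fin m → A
  charEntry a i j = (if does (i ≟ j) then x else 0#) - a ⨯ 1#

  Z : Pseudograph m → Mat m
  Z H = padded vertices λ i j → charEntry (adj i j) i j
    where open Pseudograph H

  module _ (H : Pseudograph m) where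
    open Pseudograph H

    Z-in : ∀ {i j} → i ∈ vertices → j ∈ vertices → Z H i j ≈ charEntry (adj i j) i j
    Z-in {i} {j} i∈V j∈V rewrite dec-true (i ∈? vertices) i∈V | dec-true (j ∈? vertices) j∈V = refl

    Z-outˡ : ∀ {i} → i ∉ vertices → ∀ j → Z H i j ≈ e i j
    Z-outˡ {i} i∉V j rewrite dec-false (i ∈? vertices) i∉V = refl

    Z-outʳ : ∀ i {j} → j ∉ vertices → Z H i j ≈ e i j
    Z-outʳ i {j} j∉V rewrite dec-false (j ∈? vertices) j∉V with does (i ∈? vertices)
    ... | true  = refl
    ... | false = refl

  charEntry-off : ∀ a {i j : Fin m} → i ≢ j → charEntry a i j ≈ 0# - a ⨯ 1#
  charEntry-off a {i} {j} i≢j rewrite dec-false (i ≟ j) i≢j = refl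

  Image : Subset k → (Fin k → Fin m) → Fin m → Set
  Image S h i = ∃ λ u → u ∈ S × h u ≡ i

  image? : (S : Subset k) (h : Fin k → Fin m) → ∀ i → Dec (Image S h i)
  image? S h i = any? λ u → (u ∈? S) ×-dec (h u ≟ i)

  record Placed (S : Subset k) (H : Pseudograph m) (h : Fin k → Fin m) : Set where
    open Pseudograph H
    field
      injective : ∀ {u v} → u ∈ S → v ∈ S → h u ≡ h v → u ≡ v
      present   : ∀ {u} → u ∈ S → h u ∈ vertices
      symmetric : ∀ i j → adj i j ≡ adj j i

  infix 4 _≋_off_
  _≋_off_ : Mat m → Mat m → (Fin m → Set) → Set ℓ
  X ≋ Y off P = ∀ i j → ¬ (P i × P j) → X i j ≈ Y i j

  -- The entries between vertices of S are left free in det-≈: this strengthening of cospectrality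
  -- survives every perturbation.
  record Matched (S : Subset k) (H : Pseudograph m) (h : Fin k → Fin m)
                 (H′ : Pseudograph m′) (h′ : Fin k → Fin m′) : Set (c ⊔ ℓ) where
    private
      module H  = Pseudograph H
      module H′ = Pseudograph H′
    field
      placed  : Placed S H h
      placed′ : Placed S H′ h′
      adj-≡   : ∀ {u v} → u ∈ S → v ∈ S → H.adj (h u) (h v) ≡ H′.adj (h′ u) (h′ v)
      det-≈   : ∀ X X′ → X ≋ Z H off Image S h → X′ ≋ Z H′ off Image S h′ →
                (∀ {u v} → u ∈ S → v ∈ S → X (h u) (h v) ≈ X′ (h′ u) (h′ v)) → det′ X ≈ det′ X′

  open Placed
  open Matched

  does-injective : {S : Subset k} {H : Pseudograph m} {h : Fin k → Fin m} → Placed S H h →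
    ∀ {u v} → u ∈ S → v ∈ S → does (h u ≟ h v) ≡ does (u ≟ v)
  does-injective {h = h} pl {u} {v} u∈S v∈S with u ≟ v
  ... | yes ≡.refl = dec-true (h u ≟ h u) ≡.refl
  ... | no  u≢v    = dec-false (h u ≟ h v) (u≢v ∘ injective pl u∈S v∈S)

  does-≡ : {S : Subset k} {H : Pseudograph m} {h : Fin k → Fin m} {H′ : Pseudograph m′} {h′ : Fin k → Fin m′} →
    Matched S H h H′ h′ → ∀ {u v} → u ∈ S → v ∈ S → does (h u ≟ h v) ≡ does (h′ u ≟ h′ v)
  does-≡ M u∈S v∈S = ≡.trans (does-injective (placed M) u∈S v∈S) (≡.sym (does-injective (placed′ M) u∈S v∈S))

  matched-det : {S : Subset k} {H : Pseudograph m} {h : Fin k → Fin m} {H′ : Pseudograph m′} {h′ : Fin k → Fin m′} →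
    Matched S H h H′ h′ → det′ (Z H) ≈ det′ (Z H′)
  matched-det {H = H} {H′ = H′} M = det-≈ M (Z H) (Z H′) (λ _ _ _ → refl) (λ _ _ _ → refl) λ u∈S v∈S →
    trans (Z-in H (present (placed M) u∈S) (present (placed M) v∈S)) (trans
      (reflexive (≡.cong₂ (λ b a → (if b then x else 0#) - a ⨯ 1#) (does-≡ M u∈S v∈S) (adj-≡ M u∈S v∈S)))
      (sym (Z-in H′ (present (placed′ M) u∈S) (present (placed′ M) v∈S))))

  -- Adjacencies inside S × S are free in `det-≈`, so changing them leaves the determinant condition
  -- as it was. Loops and flipped edges are of this kind.
  matched-change : {S : Subset k} {V : Subset m} {a b : Fin m → Fin m → ℕ} {h : Fin k → Fin m}
    {V′ : Subset m′} {a′ b′ : Fin m′ → Fin m′ → ℕ} {h′ : Fin k → Fin m′} →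
    (∀ i j → b i j ≡ b j i) → (∀ i j → b′ i j ≡ b′ j i) →
    (∀ i j → ¬ (Image S h i × Image S h j) → a i j ≡ b i j) →
    (∀ i j → ¬ (Image S h′ i × Image S h′ j) → a′ i j ≡ b′ i j) →
    (∀ {u v} → u ∈ S → v ∈ S → a (h u) (h v) ≡ a′ (h′ u) (h′ v) → b (h u) (h v) ≡ b′ (h′ u) (h′ v)) →
    Matched S (pseudograph V a) h (pseudograph V′ a′) h′ → Matched S (pseudograph V b) h (pseudograph V′ b′) h′
  matched-change {S = S} {V} {a} {b} {h} {V′} {a′} {b′} {h′} b-sym b′-sym off off′ on M = record
    { placed  = record { injective = injective (placed M)  ; present = present (placed M)  ; symmetric = b-sym }
    ; placed′ = record { injective = injective (placed′ M) ; present = present (placed′ M) ; symmetric = b′-sym }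
    ; adj-≡   = λ u∈S v∈S → on u∈S v∈S (adj-≡ M u∈S v∈S)
    ; det-≈   = λ X X′ X≋ X′≋ → det-≈ M X X′ (λ i j ij∉ → trans (X≋ i j ij∉) (same V off i j ij∉))
                                             (λ i j ij∉ → trans (X′≋ i j ij∉) (same V′ off′ i j ij∉))
    }
    where
    same : ∀ {m} (V : Subset m) {P : Fin m → Set} {a b : Fin m → Fin m → ℕ} →
          (∀ i j → ¬ (P i × P j) → a i j ≡ b i j) →
           ∀ i j → ¬ (P i × P j) → Z (pseudograph V b) i j ≈ Z (pseudograph V a) i j
    same V off i j ij∉ = reflexive (≡.cong (λ z → if does (i ∈? V) ∧ does (j ∈? V) then charEntry z i j else e i j)
      (≡.sym (off i j ij∉)))

  private
    not-both : {S : Subset k} {h : Fin k → Fin m} {u v : Fin k} → u ∈ S → v ∈ S → ∀ {i j} →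
      ¬ (Image S h i × Image S h j) → does (i ≟ h u) ∧ does (j ≟ h v) ≡ false
    not-both {h = h} {u} {v} u∈S v∈S {i} {j} ij∉ with i ≟ h u | j ≟ h v
    ... | yes i≡ | yes j≡ = contradiction ((u , u∈S , ≡.sym i≡) , (v , v∈S , ≡.sym j≡)) ij∉
    ... | yes _  | no _   = ≡.refl
    ... | no _   | _      = ≡.refl

    does-sym : (u v : Fin m) → does (u ≟ v) ≡ does (v ≟ u)
    does-sym u v with u ≟ v
    ... | yes ≡.refl = ≡.sym (dec-true (u ≟ u) ≡.refl)
    ... | no  u≢v    = ≡.sym (dec-false (v ≟ u) (u≢v ∘ ≡.sym))

    δδ : (u v i j : Fin m) → δ u i ℕ.* δ v j ≡ (if does (i ≟ u) ∧ does (j ≟ v) then 1 else 0)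
    δδ u v i j rewrite does-sym i u | does-sym j v with does (u ≟ i) | does (v ≟ j)
    ... | true  | true  = ≡.refl
    ... | true  | false = ≡.refl
    ... | false | _     = ≡.refl

  module _ {S : Subset k} {V : Subset m} {a : Fin m → Fin m → ℕ} {h : Fin k → Fin m}
           {V′ : Subset m′} {a′ : Fin m′ → Fin m′ → ℕ} {h′ : Fin k → Fin m′}
           (M : Matched S (pseudograph V a) h (pseudograph V′ a′) h′) where

    private
      H  = pseudograph V a
      H′ = pseudograph V′ a′

    matched-addLoop : ∀ {u} → u ∈ S → Matched S (addLoop (h u) H) h (addLoop (h′ u) H′) h′
    matched-addLoop {u} u∈S = matched-change (sy (placed M) (h u)) (sy (placed′ M) (h′ u)) (off h a) (off h′ a′)
      (λ {v} {w} v∈S w∈S a≡a′ → ≡.cong₂ ℕ._+_ a≡a′ (≡.cong₂ ℕ._*_ (δ-h v∈S) (δ-h w∈S))) M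
      where
      sy : ∀ {m} {V : Subset m} {a} {h : Fin k → Fin m} → Placed S (pseudograph V a) h → ∀ u i j →
           a i j ℕ.+ δ u i ℕ.* δ u j ≡ a j i ℕ.+ δ u j ℕ.* δ u i
      sy pl u i j = ≡.cong₂ ℕ._+_ (symmetric pl i j) (ℕ.*-comm (δ u i) (δ u j))
      off : ∀ {m} (h : Fin k → Fin m) (a : Fin m → Fin m → ℕ) i j → ¬ (Image S h i × Image S h j) →
            a i j ≡ a i j ℕ.+ δ (h u) i ℕ.* δ (h u) j
      off h a i j ij∉ = ≡.sym (≡.trans (≡.cong (a i j ℕ.+_) (≡.trans (δδ (h u) (h u) i j)
        (≡.cong (if_then 1 else 0) (not-both {h = h} u∈S u∈S ij∉)))) (ℕ.+-identityʳ _))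
      δ-h : ∀ {v} → v ∈ S → δ (h u) (h v) ≡ δ (h′ u) (h′ v)
      δ-h v∈S = ≡.cong (if_then 1 else 0) (does-≡ M u∈S v∈S)

    matched-flipEdge : ∀ {u v} → u ∈ S → v ∈ S → Matched S (flipEdge (h u) (h v) H) h (flipEdge (h′ u) (h′ v) H′) h′
    matched-flipEdge {u} {v} u∈S v∈S = matched-change (sy (placed M) (h u) (h v)) (sy (placed′ M) (h′ u) (h′ v))
      (off h a) (off h′ a′) on M
      where
      flip : ∀ {m} (u v i j : Fin m) → ℕ → ℕ
      flip u v i j a = if (does (i ≟ u) ∧ does (j ≟ v)) ∨ (does (i ≟ v) ∧ does (j ≟ u)) then flipEntry a else a
      sy : ∀ {m} {V : Subset m} {a} {h : Fin k → Fin m} → Placed S (pseudograph V a) h → ∀ u v i j →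
           flip u v i j (a i j) ≡ flip u v j i (a j i)
      sy pl u v i j rewrite symmetric pl i j = ≡.cong (λ b → if b then flipEntry _ else _)
        (≡.trans (∨-comm (does (i ≟ u) ∧ does (j ≟ v)) _)
          (≡.cong₂ _∨_ (∧-comm (does (i ≟ v)) _) (∧-comm (does (i ≟ u)) _)))
      off : ∀ {m} (h : Fin k → Fin m) (a : Fin m → Fin m → ℕ) i j → ¬ (Image S h i × Image S h j) →
            a i j ≡ flip (h u) (h v) i j (a i j)
      off h a i j ij∉ = ≡.sym (≡.cong₂ (λ b c → if b ∨ c then flipEntry (a i j) else a i j)
        (not-both {h = h} u∈S v∈S ij∉) (not-both {h = h} v∈S u∈S ij∉))
      on : ∀ {w y} → w ∈ S → y ∈ S → a (h w) (h y) ≡ a′ (h′ w) (h′ y) →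
           flip (h u) (h v) (h w) (h y) (a (h w) (h y)) ≡ flip (h′ u) (h′ v) (h′ w) (h′ y) (a′ (h′ w) (h′ y))
      on w∈S y∈S a≡a′ rewrite does-≡ M w∈S u∈S | does-≡ M y∈S v∈S | does-≡ M w∈S v∈S | does-≡ M y∈S u∈S | a≡a′ =
            ≡.refl

  record Bordering (S : Subset k) (H : Pseudograph m) (h : Fin k → Fin m) : Set (c ⊔ ℓ) where
    field
      corner       : A
      top left     : Row m
      core         : Mat m
      top-support  : ∀ j → ¬ Image S h j → top j ≈ 0#
      left-support : ∀ i → ¬ Image S h i → left i ≈ 0#
      core-≋       : core ≋ Z H off Image S h
    matrix : Mat (suc m)
    matrix = border corner top left core

  module _ {S : Subset k} {H : Pseudograph m} {h : Fin k → Fin m} {H′ : Pseudograph m′} {h′ : Fin k → Fin m′}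
           (M : Matched S H h H′ h′) where
    open Bordering

    -- The Schur complement subtracts left i * top j, which vanishes unless both labels come from
    -- `S`; so both determinants in `det-border` are again of the form that `det-≈` compares.
    matched-border : (B : Bordering S H h) (B′ : Bordering S H′ h′) → corner B ≈ corner B′ →
      (∀ {u} → u ∈ S → top B (h u) ≈ top B′ (h′ u)) → (∀ {u} → u ∈ S → left B (h u) ≈ left B′ (h′ u)) →
      (∀ {u v} → u ∈ S → v ∈ S → core B (h u) (h v) ≈ core B′ (h′ u) (h′ v)) → det′ (matrix B) ≈ det′ (matrix B′)
    matched-border B B′ corner≈ top≈ left≈ core≈ = begin
      det′ (matrix B)                                           ≈⟨ det-border (corner B) (top B) (left B) (core B) ⟩
      (corner B - 1#) * det′ (core B) + det′ (schur B)          ≈⟨ +-cong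
        (*-cong (+-congʳ corner≈) (det-≈ M _ _ (core-≋ B) (core-≋ B′) core≈))
        (det-≈ M _ _ (schur-≋ B) (schur-≋ B′) λ u∈S v∈S → +-cong (core≈ u∈S v∈S)
              (-‿cong (*-cong (left≈ u∈S) (top≈ v∈S)))) ⟩
      (corner B′ - 1#) * det′ (core B′) + det′ (schur B′)       ≈⟨ det-border (corner B′) (top B′) (left B′)
            (core B′) ⟨
      det′ (matrix B′)                                          ∎
      where
      schur : ∀ {m} {H : Pseudograph m} {h : Fin k → Fin m} → Bordering S H h → Mat m
      schur B i j = core B i j - left B i * top B j
      schur-≋ : ∀ {m} {H : Pseudograph m} {h : Fin k → Fin m} (B : Bordering S H h) → schur B ≋ Z H off Image S h
      schur-≋ {h = h} B i j ij∉ = trans (trans (+-congˡ (-‿cong zero-product)) (solve 1 (λ c → c :- :0 := c) refl _))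
            (core-≋ B i j ij∉)
        where
        zero-product : left B i * top B j ≈ 0#
        zero-product with image? S h i
        ... | no  i∉ = trans (*-congʳ (left-support B i i∉)) (zeroˡ _)
        ... | yes i∈ = trans (*-congˡ (top-support B j λ j∈ → ij∉ (i∈ , j∈))) (zeroʳ _)

  border-split : (X : Mat (suc m)) →
    X ≋ border (X zero zero) (λ j → X zero (suc j)) (λ i → X (suc i) zero) (λ i j → X (suc i) (suc j))
  border-split X zero    zero    = refl
  border-split X zero    (suc j) = refl
  border-split X (suc i) zero    = refl
  border-split X (suc i) (suc j) = refl

  module _ {S : Subset k} {H : Pseudograph m} {h : Fin k → Fin m} where
    open Pseudograph H

    image-suc : ∀ {i} → Image (inside ∷ S) (lift 1 h) (suc i) → Image S h i
    image-suc (suc u , there u∈S , e) = u , u∈S , suc-injective e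

    module _ (a : Fin m → ℕ) (d : ℕ) {X : Mat (suc m)} (X≋ : X ≋ Z (extend a d H) off Image (inside ∷ S)
          (lift 1 h)) where

      extended-top : ∀ j → ¬ Image S h j → X zero (suc j) ≈ (if does (j ∈? vertices) then 0# - a j ⨯ 1# else 0#)
      extended-top j j∉ = X≋ zero (suc j) (j∉ ∘ image-suc ∘ proj₂)

      extended-left : ∀ i → ¬ Image S h i → X (suc i) zero ≈ (if does (i ∈? vertices) then 0# - a i ⨯ 1# else 0#)
      extended-left i i∉ = trans (X≋ (suc i) zero (i∉ ∘ image-suc ∘ proj₁)) (entry (does (i ∈? vertices)))
        where
        entry : ∀ b → (if b ∧ true then 0# - a i ⨯ 1# else 0#) ≈ (if b then 0# - a i ⨯ 1# else 0#)
        entry true  = refl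
        entry false = refl

      extended-core : (λ i j → X (suc i) (suc j)) ≋ Z H off Image S h
      extended-core i j ij∉ = X≋ (suc i) (suc j) λ (i∈ , j∈) → ij∉ (image-suc i∈ , image-suc j∈)

    placed-extend : ∀ a d → Placed S H h → Placed (inside ∷ S) (extend a d H) (lift 1 h)
    placed-extend a d pl = record { injective = inj ; present = pres ; symmetric = sy }
      where
      inj : ∀ {u v} → u ∈ inside ∷ S → v ∈ inside ∷ S → lift 1 h u ≡ lift 1 h v → u ≡ v
      inj here        here        e = ≡.refl
      inj (there u∈S) (there v∈S) e = ≡.cong suc (injective pl u∈S v∈S (suc-injective e))
      pres : ∀ {u} → u ∈ inside ∷ S → lift 1 h u ∈ inside ∷ vertices
      pres here        = here
      pres (there u∈S) = there (present pl u∈S)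
      sy : ∀ i j → Pseudograph.adj (extend a d H) i j ≡ Pseudograph.adj (extend a d H) j i
      sy zero    zero    = ≡.refl
      sy zero    (suc j) = ≡.refl
      sy (suc i) zero    = ≡.refl
      sy (suc i) (suc j) = symmetric pl i j

  module _ {S : Subset k} {H : Pseudograph m} {h : Fin k → Fin m} {H′ : Pseudograph m′} {h′ : Fin k → Fin m′}
           (M : Matched S H h H′ h′) (a : Fin m → ℕ) (a′ : Fin m′ → ℕ)
           (a≡a′ : ∀ {u} → u ∈ S → a (h u) ≡ a′ (h′ u)) where
    private
      module H  = Pseudograph H
      module H′ = Pseudograph H′

      extend-adj : ∀ {d d′} → d ≡ d′ → ∀ {u v} → u ∈ inside ∷ S → v ∈ inside ∷ S →
        Pseudograph.adj (extend a d H) (lift 1 h u) (lift 1 h v) ≡ Pseudograph.adj (extend a′ d′ H′) (lift 1 h′ u)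
              (lift 1 h′ v)
      extend-adj d≡d′ here        here        = d≡d′
      extend-adj d≡d′ here        (there v∈S) = a≡a′ v∈S
      extend-adj d≡d′ (there u∈S) here        = a≡a′ u∈S
      extend-adj d≡d′ (there u∈S) (there v∈S) = adj-≡ M u∈S v∈S

    matched-extend : ∀ {d d′} → d ≡ d′ → (∀ i → ¬ Image S h i → a i ≡ 0) → (∀ i → ¬ Image S h′ i → a′ i ≡ 0) →
      Matched (inside ∷ S) (extend a d H) (lift 1 h) (extend a′ d′ H′) (lift 1 h′)
    matched-extend {d} {d′} d≡d′ supp supp′ = record
      { placed  = placed-extend a d (placed M)
      ; placed′ = placed-extend a′ d′ (placed′ M)
      ; adj-≡   = extend-adj d≡d′
      ; det-≈   = λ X X′ X≋ X′≋ on → trans (det-cong (border-split X)) (trans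
          (matched-border M (bordering a d supp X≋) (bordering a′ d′ supp′ X′≋) (on here here)
            (λ u∈S → on here (there u∈S)) (λ u∈S → on (there u∈S) here) (λ u∈S v∈S → on (there u∈S) (there v∈S)))
          (sym (det-cong (border-split X′))))
      }
      where
      bordering : ∀ {m} {H : Pseudograph m} {h : Fin k → Fin m} a d → (∀ i → ¬ Image S h i → a i ≡ 0) → ∀ {X} →
        X ≋ Z (extend a d H) off Image (inside ∷ S) (lift 1 h) → Bordering S H h
      bordering {H = H} {h} a d supp {X} X≋ = record
        { corner = X zero zero ; top = λ j → X zero (suc j) ; left = λ i → X (suc i) zero
        ; core = λ i j → X (suc i) (suc j)
        ; top-support  = λ j j∉ → trans (extended-top {H = H} {h} a d X≋ j j∉) (vanish (does (j ∈? _)) (supp j j∉))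
        ; left-support = λ i i∉ → trans (extended-left {H = H} {h} a d X≋ i i∉) (vanish (does (i ∈? _)) (supp i i∉))
        ; core-≋ = extended-core {H = H} {h} a d X≋
        }
        where
        vanish : ∀ b {z} → z ≡ 0 → (if b then 0# - z ⨯ 1# else 0#) ≈ 0#
        vanish true  ≡.refl = -‿inverseʳ 0#
        vanish false _      = refl

    -- Subtracting the rows and columns of u and v from those of the new vertex clears
    -- all entries outside S.
    matched-extend-sum : ∀ {d d′} → d ≡ d′ → ∀ {u v} → u ∈ S → v ∈ S →
      (∀ i → a i ≡ H.adj (h u) i ℕ.+ H.adj (h v) i) → (∀ i → a′ i ≡ H′.adj (h′ u) i ℕ.+ H′.adj (h′ v) i) →
      Matched (inside ∷ S) (extend a d H) (lift 1 h) (extend a′ d′ H′) (lift 1 h′)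
    matched-extend-sum {d} {d′} d≡d′ {u} {v} u∈S v∈S a-sum a′-sum = record
      { placed  = placed-extend a d (placed M)
      ; placed′ = placed-extend a′ d′ (placed′ M)
      ; adj-≡   = extend-adj d≡d′
      ; det-≈   = λ X X′ X≋ X′≋ on → trans (det-bordering (placed M) a d a-sum X≋) (trans
          (matched-border M (bordering (placed M) a d a-sum X≋) (bordering (placed′ M) a′ d′ a′-sum X′≋)
            (corner-≈ X X′ on) (top-≈ X X′ on) (left-≈ X X′ on) (λ u∈S v∈S → on (there u∈S) (there v∈S)))
          (sym (det-bordering (placed′ M) a′ d′ a′-sum X′≋)))
      }
      where
      module _ {m} (h : Fin k → Fin m) (X : Mat (suc m)) where
        core₀ : Mat m
        core₀ i j = X (suc i) (suc j)
        top₀ left₀ : Row m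
        top₀ j = (X zero (suc j) - core₀ (h u) j) - core₀ (h v) j
        left₀ i = (X (suc i) zero - core₀ i (h u)) - core₀ i (h v)
        corner₀ : A
        -- The rows are subtracted before the columns, so the column operations meet the corner
        -- together with the new top row.
        corner₀ = (((X zero zero - X (suc (h u)) zero) - X (suc (h v)) zero) - top₀ (h u)) - top₀ (h v)

      bordering : ∀ {m} {H : Pseudograph m} {h : Fin k → Fin m} → Placed S H h → ∀ a d →
        (∀ i → a i ≡ Pseudograph.adj H (h u) i ℕ.+ Pseudograph.adj H (h v) i) → ∀ {X} →
        X ≋ Z (extend a d H) off Image (inside ∷ S) (lift 1 h) → Bordering S H h
      bordering {H = H} {h} pl a d a-sum {X} X≋ = record
        { corner = corner₀ h X ; top = top₀ h X ; left = left₀ h X ; core = core₀ h X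
        ; top-support  = λ j j∉ → trans
            (+-cong (+-cong (extended-top {H = H} {h} a d X≋ j j∉) (-‿cong (row u∈S j∉))) (-‿cong (row v∈S j∉)))
            (vanish j)
        ; left-support = λ i i∉ → trans
            (+-cong (+-cong (extended-left {H = H} {h} a d X≋ i i∉) (-‿cong (column u∈S i∉)))
                  (-‿cong (column v∈S i∉)))
            (vanish i)
        ; core-≋ = extended-core {H = H} {h} a d X≋
        }
        where
        open Pseudograph H
        row : ∀ {w j} → w ∈ S → ¬ Image S h j →
              X (suc (h w)) (suc j) ≈ (if does (j ∈? vertices) then 0# - adj (h w) j ⨯ 1# else 0#)
        row {w} {j} w∈S j∉ = trans (extended-core {H = H} {h} a d X≋ (h w) j (j∉ ∘ proj₂)) (entry (j ∈? vertices))
          where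
          hw≢j : h w ≢ j
          hw≢j e = j∉ (w , w∈S , e)
          entry : (p : Dec (j ∈ vertices)) → Z H (h w) j ≈ (if does p then 0# - adj (h w) j ⨯ 1# else 0#)
          entry (yes j∈V) = trans (Z-in H (present pl w∈S) j∈V) (charEntry-off (adj (h w) j) hw≢j)
          entry (no  j∉V) = trans (Z-outʳ H (h w) j∉V) (e-other hw≢j)
        column : ∀ {w i} → w ∈ S → ¬ Image S h i →
                 X (suc i) (suc (h w)) ≈ (if does (i ∈? vertices) then 0# - adj (h w) i ⨯ 1# else 0#)
        column {w} {i} w∈S i∉ = trans (extended-core {H = H} {h} a d X≋ i (h w) (i∉ ∘ proj₁)) (entry (i ∈? vertices))
          where
          i≢hw : i ≢ h w
          i≢hw e = i∉ (w , w∈S , ≡.sym e)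
          entry : (p : Dec (i ∈ vertices)) → Z H i (h w) ≈ (if does p then 0# - adj (h w) i ⨯ 1# else 0#)
          entry (yes i∈V) = trans (Z-in H i∈V (present pl w∈S)) (trans (charEntry-off (adj i (h w)) i≢hw)
            (reflexive (≡.cong (λ z → 0# - z ⨯ 1#) (symmetric pl i (h w)))))
          entry (no  i∉V) = trans (Z-outˡ H i∉V (h w)) (e-other i≢hw)
        vanish : ∀ j → ((if does (j ∈? vertices) then 0# - a j ⨯ 1# else 0#)
                          - (if does (j ∈? vertices) then 0# - adj (h u) j ⨯ 1# else 0#))
                          - (if does (j ∈? vertices) then 0# - adj (h v) j ⨯ 1# else 0#) ≈ 0#
        vanish j with does (j ∈? vertices)
        ... | false = solve 0 ((:0 :- :0) :- :0 := :0) refl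
        ... | true  = trans (+-congʳ (+-congʳ (+-congˡ (-‿cong (trans (reflexive (≡.cong (_⨯ 1#) (a-sum j)))
                        (MonoidMult.×-homo-+ +-monoid 1# (adj (h u) j) (adj (h v) j)))))))
                        (solve 2 (λ p q → ((:0 :- (p :+ q)) :- (:0 :- p)) :- (:0 :- q) := :0) refl _ _)

      det-bordering : ∀ {m} {H : Pseudograph m} {h : Fin k → Fin m} (pl : Placed S H h) a d a-sum {X} X≋ →
        det′ X ≈ det′ (Bordering.matrix (bordering {H = H} {h} pl a d a-sum {X} X≋))
      det-bordering {h = h} pl a d a-sum {X} X≋ = trans (det-cong (border-split X)) (trans
        (det-border-subtract-row _ _ _ _ (h u)) (trans (det-border-subtract-row _ _ _ _ (h v)) (trans
        (det-border-subtract-column _ _ _ _ (h u)) (det-border-subtract-column _ _ _ _ (h v)))))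

      module _ (X : Mat (suc m)) (X′ : Mat (suc m′))
               (on : ∀ {u v} → u ∈ inside ∷ S → v ∈ inside ∷ S → X (lift 1 h u) (lift 1 h v) ≈ X′ (lift 1 h′ u)
                     (lift 1 h′ v)) where
        sub-cong : ∀ {p q r s} → p ≈ q → r ≈ s → p - r ≈ q - s
        sub-cong p≈q r≈s = +-cong p≈q (-‿cong r≈s)
        top-≈ : ∀ {w} → w ∈ S → top₀ h X (h w) ≈ top₀ h′ X′ (h′ w)
        top-≈ w∈S = sub-cong (sub-cong (on here (there w∈S)) (on (there u∈S) (there w∈S)))
              (on (there v∈S) (there w∈S))
        left-≈ : ∀ {w} → w ∈ S → left₀ h X (h w) ≈ left₀ h′ X′ (h′ w)
        left-≈ w∈S = sub-cong (sub-cong (on (there w∈S) here) (on (there w∈S) (there u∈S)))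
              (on (there w∈S) (there v∈S))
        corner-≈ : corner₀ h X ≈ corner₀ h′ X′
        corner-≈ = sub-cong (sub-cong (sub-cong (sub-cong (on here here) (on (there u∈S) here)) (on (there v∈S) here))
          (top-≈ u∈S)) (top-≈ v∈S)

  module _ {S : Subset k} {u : Fin k} (u∈S : u ∈ S) where

    private
      keep : ∀ {w} → w ∈ S ∖ u → w ∈ S
      keep = p─q⊆p S _

      ≢u : ∀ {w} → w ∈ S ∖ u → w ≢ u
      ≢u w∈ ≡.refl = x∉p-x S _ w∈

    module Restore {m} {H : Pseudograph m} {h : Fin k → Fin m} (pl : Placed S H h) where
      open Pseudograph H

      placed-remove : Placed (S ∖ u) (remove (h u) H) h
      placed-remove = record
        { injective = λ v∈ w∈ → injective pl (keep v∈) (keep w∈)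
        ; present   = λ v∈ → x∈p∧x≢y⇒x∈p-y (present pl (keep v∈)) λ e → ≢u v∈ (injective pl (keep v∈) u∈S e)
        ; symmetric = symmetric pl
        }

      -- Reinstate the entries of u in a matrix for H − u; those inside S are free and set to 0.
      restored : Mat m → Mat m
      restored X i j with i ≟ h u | j ≟ h u
      ... | no _ | no _ = X i j
      ... | _    | _    = if does (image? S h i) ∧ does (image? S h j) then 0# else Z H i j

      restored-at : ∀ X {i j} → i ≡ h u ⊎ j ≡ h u → restored X i j ≡
            (if does (image? S h i) ∧ does (image? S h j) then 0# else Z H i j)
      restored-at X {i} {j} (inj₁ i≡) with i ≟ h u | j ≟ h u
      ... | yes _ | yes _ = ≡.refl
      ... | yes _ | no _  = ≡.refl
      ... | no i≢ | _     = contradiction i≡ i≢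
      restored-at X {i} {j} (inj₂ j≡) with i ≟ h u | j ≟ h u
      ... | yes _ | yes _ = ≡.refl
      ... | no _  | yes _ = ≡.refl
      ... | yes _ | no j≢ = contradiction j≡ j≢
      ... | no _  | no j≢ = contradiction j≡ j≢

      restored-off : ∀ X {i j} → i ≢ h u → j ≢ h u → restored X i j ≡ X i j
      restored-off X {i} {j} i≢ j≢ with i ≟ h u | j ≟ h u
      ... | no _  | no _  = ≡.refl
      ... | yes i≡ | _    = contradiction i≡ i≢
      ... | no _  | yes j≡ = contradiction j≡ j≢

      image-keep : ∀ {i} → Image (S ∖ u) h i → Image S h i
      image-keep (w , w∈ , e) = w , keep w∈ , e

      hu-not-kept : ¬ Image (S ∖ u) h (h u)
      hu-not-kept (w , w∈ , e) = ≢u w∈ (injective pl (keep w∈) u∈S e)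

      does-remove : ∀ {i} → i ≢ h u → does (i ∈? vertices ∖ h u) ≡ does (i ∈? vertices)
      does-remove {i} i≢ with i ∈? vertices
      ... | yes i∈V = dec-true (i ∈? vertices ∖ h u) (x∈p∧x≢y⇒x∈p-y i∈V i≢)
      ... | no  i∉V = dec-false (i ∈? vertices ∖ h u) (i∉V ∘ p─q⊆p vertices _)

      module _ {X : Mat m} (X≋ : X ≋ Z (remove (h u) H) off Image (S ∖ u) h) where

        restored-≋ : restored X ≋ Z H off Image S h
        restored-≋ i j ij∉ = cases (i ≟ h u) (j ≟ h u)
          where
          at : i ≡ h u ⊎ j ≡ h u → restored X i j ≈ Z H i j
          at e = trans (reflexive (restored-at X e)) (unfold (image? S h i) (image? S h j))
            where
            unfold : (p : Dec (Image S h i)) (q : Dec (Image S h j)) →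
                  (if does p ∧ does q then 0# else Z H i j) ≈ Z H i j
            unfold (yes i∈) (yes j∈) = contradiction (i∈ , j∈) ij∉
            unfold (yes _)  (no _)   = refl
            unfold (no _)   _        = refl
          cases : Dec (i ≡ h u) → Dec (j ≡ h u) → restored X i j ≈ Z H i j
          cases (yes i≡) _        = at (inj₁ i≡)
          cases (no _)   (yes j≡) = at (inj₂ j≡)
          cases (no i≢)  (no j≢)  = trans (reflexive (restored-off X i≢ j≢))
            (trans (X≋ i j λ (i∈ , j∈) → ij∉ (image-keep i∈ , image-keep j∈))
              (reflexive (≡.cong₂ (λ p q → if p ∧ q then charEntry (adj i j) i j else e i j) (does-remove i≢)
                    (does-remove j≢))))

        -- In `X` the row and column of the deleted vertex are those of the identity, so det X is
        -- the diagonal cofactor of the restored matrix at this vertex, that is, the growth of the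
        -- determinant when the diagonal entry grows by 1. Both resulting matrices fall under
        -- `det-≈` for `H`.
        det-restored : det′ X ≈ det′ (restored X [ h u , h u ]+= 1#) - det′ (restored X)
        det-restored = begin
          det′ X
            ≈⟨ adj-clear (restored X) X (h u) (h u)
                 (λ j → trans (X≋ (h u) j (hu-not-kept ∘ proj₁)) (Z-outˡ (remove (h u) H) (x∉p-x vertices (h u)) j))
                 (λ i → trans (X≋ i (h u) (hu-not-kept ∘ proj₂))
                       (trans (Z-outʳ (remove (h u) H) i (x∉p-x vertices (h u))) (e-sym i (h u))))
                 (λ i j i≢ j≢ → sym (reflexive (restored-off X i≢ j≢))) ⟨
          Adjugates.adj R (restored X) (h u) (h u)
            ≈⟨ solve 2 (λ d r → r := (d :+ :1 :* r) :- d) refl (det′ (restored X)) _ ⟩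
          (det′ (restored X) + 1# * Adjugates.adj R (restored X) (h u) (h u)) - det′ (restored X)
            ≈⟨ +-congʳ (det-+= (restored X) (h u) (h u) 1#) ⟨
          det′ (restored X [ h u , h u ]+= 1#) - det′ (restored X) ∎

        updated-≋ : (restored X [ h u , h u ]+= 1#) ≋ Z H off Image S h
        updated-≋ i j ij∉ = trans (trans (+-congˡ (trans (*-identityˡ _) zero-product)) (+-identityʳ _))
              (restored-≋ i j ij∉)
          where
          zero-product : e (h u) i * e (h u) j ≈ 0#
          zero-product with h u ≟ i
          ... | no  _  = zeroˡ _
          ... | yes hu≡i = trans (*-congˡ (e-other λ hu≡j → ij∉ ((u , u∈S , hu≡i) , (u , u∈S , hu≡j)))) (zeroʳ _)

      restored-u : ∀ X {v w} → v ∈ S → w ∈ S → v ≡ u ⊎ w ≡ u → restored X (h v) (h w) ≈ 0#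
      restored-u X {v} {w} v∈S w∈S vw = trans
        (reflexive (restored-at X (Sum.map (≡.cong h) (≡.cong h) vw)))
        (reflexive (≡.cong₂ (λ p q → if p ∧ q then 0# else Z H (h v) (h w))
          (dec-true (image? S h (h v)) (v , v∈S , ≡.refl)) (dec-true (image? S h (h w)) (w , w∈S , ≡.refl))))

      restored-kept : ∀ X {v w} → v ∈ S → w ∈ S → v ≢ u → w ≢ u → restored X (h v) (h w) ≈ X (h v) (h w)
      restored-kept X v∈S w∈S v≢u w≢u = reflexive (restored-off X (v≢u ∘ injective pl v∈S u∈S)
            (w≢u ∘ injective pl w∈S u∈S))

      e-h : ∀ {v} → v ∈ S → e (h u) (h v) ≈ e u v
      e-h v∈S = reflexive (≡.cong (if_then 1# else 0#) (does-injective pl u∈S v∈S))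

    matched-remove : {H : Pseudograph m} {h : Fin k → Fin m} {H′ : Pseudograph m′} {h′ : Fin k → Fin m′} →
      Matched S H h H′ h′ → Matched (S ∖ u) (remove (h u) H) h (remove (h′ u) H′) h′
    matched-remove {H = H} {h} {H′} {h′} M = record
      { placed  = P.placed-remove
      ; placed′ = P′.placed-remove
      ; adj-≡   = λ v∈ w∈ → adj-≡ M (keep v∈) (keep w∈)
      ; det-≈   = λ X X′ X≋ X′≋ on → trans (P.det-restored X≋) (trans
          (+-cong (det-≈ M _ _ (P.updated-≋ X≋) (P′.updated-≋ X′≋) (λ v∈S w∈S → +-cong (correspond X X′ on v∈S w∈S)
                    (*-congˡ (*-cong (trans (P.e-h v∈S) (sym (P′.e-h v∈S))) (trans (P.e-h w∈S) (sym (P′.e-h w∈S)))))))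
            (-‿cong (det-≈ M _ _ (P.restored-≋ X≋) (P′.restored-≋ X′≋) (correspond X X′ on))))
          (sym (P′.det-restored X′≋)))
      }
      where
      module P  = Restore (placed M)
      module P′ = Restore (placed′ M)
      correspond : ∀ X X′ → (∀ {v w} → v ∈ S ∖ u → w ∈ S ∖ u → X (h v) (h w) ≈ X′ (h′ v) (h′ w)) →
        ∀ {v w} → v ∈ S → w ∈ S → P.restored X (h v) (h w) ≈ P′.restored X′ (h′ v) (h′ w)
      correspond X X′ on {v} {w} v∈S w∈S = cases (v ≟ u) (w ≟ u)
        where
        at-u : v ≡ u ⊎ w ≡ u → P.restored X (h v) (h w) ≈ P′.restored X′ (h′ v) (h′ w)
        at-u vw = trans (P.restored-u X v∈S w∈S vw) (sym (P′.restored-u X′ v∈S w∈S vw))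
        cases : Dec (v ≡ u) → Dec (w ≡ u) → P.restored X (h v) (h w) ≈ P′.restored X′ (h′ v) (h′ w)
        cases (yes v≡u) _         = at-u (inj₁ v≡u)
        cases (no _)    (yes w≡u) = at-u (inj₂ w≡u)
        cases (no v≢u)  (no w≢u)  = trans (P.restored-kept X v∈S w∈S v≢u w≢u) (trans
          (on (x∈p∧x≢y⇒x∈p-y v∈S v≢u) (x∈p∧x≢y⇒x∈p-y w∈S w≢u)) (sym (P′.restored-kept X′ v∈S w∈S v≢u w≢u)))

-- From characteristic polynomials in a field to padded determinants.

lookup-injective : {A : Set} {xs : List A} → Unique xs → ∀ i j → List.lookup xs i ≡ List.lookup xs j → i ≡ j
lookup-injective (x∉xs ∷ u) zero    zero    e = ≡.refl
lookup-injective (x∉xs ∷ u) zero    (suc j) e = contradiction e (All.lookup x∉xs (∈-lookup j))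
lookup-injective (x∉xs ∷ u) (suc i) zero    e = contradiction (≡.sym e) (All.lookup x∉xs (∈-lookup i))
lookup-injective (x∉xs ∷ u) (suc i) (suc j) e = ≡.cong suc (lookup-injective u i j e)

fieldRing : HeytingField 0ℓ 0ℓ 0ℓ → CommutativeRing 0ℓ 0ℓ
fieldRing K = HeytingCommutativeRing.commutativeRing (HeytingField.heytingCommutativeRing K)

charZero⇒torsionFree : (K : HeytingField 0ℓ 0ℓ 0ℓ) → CharZero K → PolynomialFunctions.Torsion-free (fieldRing K)
charZero⇒torsionFree K char0 n y ny≈0 with inverse , inverse-* , _ ← HeytingField.#⇒invertible K (char0 n) = begin
  y                                       ≈⟨ *-identityˡ y ⟨
  1# * y                                  ≈⟨ *-congʳ inverse-* ⟨
  (inverse * ((suc n ⨯ 1#) - 0#)) * y     ≈⟨ solve 3 (λ i m y → (i :* (m :- :0)) :* y := i :* (m :* y)) refl inverse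
        (suc n ⨯ 1#) y ⟩
  inverse * ((suc n ⨯ 1#) * y)            ≈⟨ *-congˡ ny≈0 ⟩
  inverse * 0#                            ≈⟨ zeroʳ _ ⟩
  0#                                      ∎
  where
  open CommutativeRing (fieldRing K) using (_*_; _-_; 0#; 1#; *-identityˡ; *-congˡ; *-congʳ; zeroʳ;
        refl; setoid; semiring)
  open RawSemiringOps (Semiring.rawSemiring semiring) using () renaming (_×_ to _⨯_)
  open CommutativeRingSolver (fieldRing K)
  open SetoidReasoning setoid

module CharacteristicDeterminants (K : HeytingField 0ℓ 0ℓ 0ℓ) where
  open CommutativeRing (fieldRing K) hiding (zero)
  open RawSemiringOps (Semiring.rawSemiring semiring) using () renaming (_×_ to _⨯_)
  open FiniteSums commutativeSemiring using (∑-sum)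
  open Determinants (fieldRing K) using (det′; sign; det-empty; det-first-row; det-cong)
  open BorderedMatrices (fieldRing K) using (det-members)
  open MatchedPseudographs (fieldRing K) using (Z)

  det≈det′ : ∀ {n} (M : Matrix Carrier n) → det K M ≈ det′ M
  det≈det′ {zero}  M = sym (det-empty M)
  det≈det′ {suc n} M = trans
    (MonoidSum.sum-cong-≋ +-monoid λ j → *-congˡ {x = sign j * M zero j} (det≈det′ λ i l → M (suc i) (punchIn j l)))
    (trans (sym (∑-sum _)) (sym (det-first-row M)))

  -- The vertex list has no repetitions, so x stands on the diagonal of positions exactly where it
  -- stands on the diagonal of labels.
  det-charMatrix : ∀ {m} (H : Pseudograph m) x → det K (charMatrix K (adjacencyMatrix H) x) ≈ det′ (Z x H)
  det-charMatrix {m} H x = trans (det≈det′ _) (trans (det-cong λ i j →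
    reflexive (≡.cong (λ b → (if b then x else 0#) - adjacencyMatrix H i j ⨯ 1#) (labels i j)))
    (det-members vertices λ i j → MatchedPseudographs.charEntry (fieldRing K) x (adj i j) i j))
    where
    open Pseudograph H
    unique : Unique (vertexList H)
    unique = Unique.filter⁺ (_∈? vertices) (Unique.allFin⁺ m)
    labels : ∀ i j → does (i ≟ j) ≡ does (List.lookup (vertexList H) i ≟ List.lookup (vertexList H) j)
    labels i j with i ≟ j
    ... | yes ≡.refl = ≡.sym (dec-true (List.lookup (vertexList H) i ≟ List.lookup (vertexList H) i) ≡.refl)
    ... | no  i≢j    = ≡.sym (dec-false (List.lookup (vertexList H) i ≟ List.lookup (vertexList H) j)
                         (i≢j ∘ lookup-injective unique i j))

-- Sequences of perturbations.

module PerturbedPseudographs {c ℓ} (R : CommutativeRing c ℓ) (x : CommutativeRing.Carrier R) where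
  open CommutativeRing R using (_≈_)
  open Determinants R using (det′)
  open MatchedPseudographs R x
  open Matched

  private
    variable
      k m m′ : ℕ

  δ-off : {S : Subset k} {h : Fin k → Fin m} {u : Fin k} → u ∈ S → ∀ i → ¬ Image S h i → δ (h u) i ≡ 0
  δ-off {h = h} {u} u∈S i i∉ rewrite dec-false (h u ≟ i) (λ e → i∉ (u , u∈S , e)) = ≡.refl

  -- The new vertex is created while `u` and `v` are still present, since their rows and columns are
  -- needed to clear its own; they are deleted afterwards. Deletion leaves the adjacency function
  -- alone, so this order agrees with that of `amalgamate`.
  matched-amalgamate : {S : Subset k} {H : Pseudograph m} {h : Fin k → Fin m} {H′ : Pseudograph m′} {h′ : Fin k →
        Fin m′} →
    Matched S H h H′ h′ → ∀ {u v} → u ∈ S → v ∈ S → u ≢ v →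
    Matched (inside ∷ (S ∖ u ∖ v)) (amalgamate (h u) (h v) H) (lift 1 h) (amalgamate (h′ u) (h′ v) H′) (lift 1 h′)
  matched-amalgamate {S = S} {H} {h} {H′} {h′} M {u} {v} u∈S v∈S u≢v =
    matched-change (Placed.symmetric (placed-extend _ _ (placed-copy (placed M))))
      (Placed.symmetric (placed-extend _ _ (placed-copy (placed′ M))))
      (λ i j _ → same H h i j) (λ i j _ → same H′ h′ i j) (λ {w} {y} _ _ e → ≡.trans
            (≡.sym (same H h (lift 1 h w) (lift 1 h y))) (≡.trans e (same H′ h′ (lift 1 h′ w) (lift 1 h′ y))))
      (matched-remove (there v∈S-u) (matched-remove (there u∈S) extended))
    where
    module H  = Pseudograph H
    module H′ = Pseudograph H′
    v∈S-u : v ∈ S ∖ u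
    v∈S-u = x∈p∧x≢y⇒x∈p-y v∈S (u≢v ∘ ≡.sym)
    extended : Matched (inside ∷ S) (extend (λ i → H.adj (h u) i ℕ.+ H.adj (h v) i) _ H) (lift 1 h)
                                    (extend (λ i → H′.adj (h′ u) i ℕ.+ H′.adj (h′ v) i) _ H′) (lift 1 h′)
    extended = matched-extend-sum M _ _ (λ w∈S → ≡.cong₂ ℕ._+_ (adj-≡ M u∈S w∈S) (adj-≡ M v∈S w∈S))
      {d = H.adj (h u) (h u) ℕ.+ H.adj (h v) (h v) ℕ.+ H.adj (h u) (h v)}
      (≡.cong₂ ℕ._+_ (≡.cong₂ ℕ._+_ (adj-≡ M u∈S u∈S) (adj-≡ M v∈S v∈S)) (adj-≡ M u∈S v∈S))
      u∈S v∈S (λ _ → ≡.refl) (λ _ → ≡.refl)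
    placed-copy : ∀ {m} {H : Pseudograph m} {h : Fin _ → Fin m} → Placed S H h → Placed (S ∖ u ∖ v)
          (remove (h v) (remove (h u) H)) h
    placed-copy pl = Restore.placed-remove v∈S-u (Restore.placed-remove u∈S pl)
    same : ∀ {m} {a : Fin m → ℕ} {d} (H : Pseudograph m) (h : Fin _ → Fin m) i j →
      Pseudograph.adj (extend a d H) i j ≡ Pseudograph.adj (extend a d (remove (h v) (remove (h u) H))) i j
    same H h zero    zero    = ≡.refl
    same H h zero    (suc j) = ≡.refl
    same H h (suc i) zero    = ≡.refl
    same H h (suc i) (suc j) = ≡.refl

  perturbed-det : {S : Subset k} (π : Perturbations S)
    {H : Pseudograph m} {h : Fin k → Fin m} {H′ : Pseudograph m′} {h′ : Fin k → Fin m′} →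
    Matched S H h H′ h′ → det′ (Z (proj₂ (perturb π h H))) ≈ det′ (Z (proj₂ (perturb π h′ H′)))
  perturbed-det done                             M = matched-det M
  perturbed-det (removing u u∈S π)               M = perturbed-det π (matched-remove u∈S M)
  perturbed-det (looping u u∈S π)                M = perturbed-det π (matched-addLoop M u∈S)
  perturbed-det (hanging u u∈S π)                {h = h} {h′ = h′} M = perturbed-det π
    (matched-extend M _ _ (λ w∈S → ≡.cong (if_then 1 else 0) (does-≡ M u∈S w∈S)) ≡.refl (δ-off {h = h} u∈S)
          (δ-off {h = h′} u∈S))
  perturbed-det (flipping u v u∈S v∈S u≢v π)     M = perturbed-det π (matched-flipEdge M u∈S v∈S)
  perturbed-det (amalgamating u v u∈S v∈S u≢v π) M = perturbed-det π (matched-amalgamate M u∈S v∈S u≢v)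
  perturbed-det (bridging u v u∈S v∈S u≢v π)     {h = h} {h′ = h′} M = perturbed-det π
    (matched-extend M _ _
      (λ w∈S → ≡.cong₂ ℕ._+_ (≡.cong (if_then 1 else 0) (does-≡ M u∈S w∈S))
            (≡.cong (if_then 1 else 0) (does-≡ M v∈S w∈S)))
      ≡.refl
      (λ i i∉ → ≡.cong₂ ℕ._+_ (δ-off {h = h} u∈S i i∉) (δ-off {h = h} v∈S i i∉))
      (λ i i∉ → ≡.cong₂ ℕ._+_ (δ-off {h = h′} u∈S i i∉) (δ-off {h = h′} v∈S i i∉)))

-- Isometric sets in a distance-regular graph.

module DistanceRegularGraphs {c ℓ} (R : CommutativeRing c ℓ) (torsion-free : PolynomialFunctions.Torsion-free R)
  {n} (G : Graph n) (conn : Connected G) (distanceRegular : DistanceRegular G conn)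
  {S : Subset n} {f : Fin n → Fin n} (f-injective : ∀ {u v} → u ∈ S → v ∈ S → f u ≡ f v → u ≡ v)
  (isometry : ∀ {u v} → u ∈ S → v ∈ S → ∂ G conn u v ≡ ∂ G conn (f u) (f v))
  (x : CommutativeRing.Carrier R) where

  open CommutativeRing R hiding (zero) renaming (Carrier to A)
  open CommutativeRingSolver R
  open Determinants R
  open RawSemiringOps (Semiring.rawSemiring semiring) using () renaming (_×_ to _⨯_)
  open Adjugates R using (e)
  open Pencils R torsion-free
  open MatchedPseudographs R x
  open WalkCounts G conn hiding (_∙_)

  private
    edges-f : ∀ {u v} → u ∈ S → v ∈ S → edges u v ≡ edges (f u) (f v)
    edges-f {u} {v} u∈S v∈S with Graph._~?_ G u v | Graph._~?_ G (f u) (f v)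
    ... | yes _   | yes _   = ≡.refl
    ... | no  _   | no  _   = ≡.refl
    ... | yes u~v | no  ≁   = contradiction (∂≡1⇒~ (≡.trans (≡.sym (isometry u∈S v∈S)) (~⇒∂≡1 u~v))) ≁
    ... | no  u≁v | yes ~   = contradiction (∂≡1⇒~ (≡.trans (isometry u∈S v∈S) (~⇒∂≡1 ~))) u≁v

    similar : Similar (_∈ S) f f-injective (-A G conn) (-A G conn)
    similar = record
      { det-≈ = λ _ → refl
      ; adj-≈ = λ y u∈S v∈S → adj-from-walks G conn (λ k → distanceRegular⇒walks distanceRegular k
            (isometry u∈S v∈S)) y
      }

    inS? : (p : Fin n × Fin n) → Dec (proj₁ p ∈ S × proj₂ p ∈ S)
    inS? (u , v) = (u ∈? S) ×-dec (v ∈? S)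

    pairs : List (Fin n × Fin n)
    pairs = List.filter inS? (List.cartesianProduct (List.allFin n) (List.allFin n))

    ∈-pairs : ∀ {u v} → u ∈ S → v ∈ S → (u , v) ∈ˡ pairs
    ∈-pairs u∈S v∈S = ∈-filter⁺ inS? (∈-cartesianProduct⁺ (∈-allFin _) (∈-allFin _)) (u∈S , v∈S)

    -- Presents a given matrix as the value of a pencil at the fixed `x`, so that results about
    -- pencils at all values apply to it.
    coefficients : Mat n → Mat n
    coefficients X i j = X i j + - (x * e i j)

    pencil-coefficients : ∀ X → pencil (coefficients X) x ≋ X
    pencil-coefficients X i j = solve 2 (λ a b → (a :- b) :+ b := a) refl (X i j) (x * e i j)

    coefficients-Z : ∀ {X i j} → X i j ≈ Z (toPseudograph G) i j → coefficients X i j ≈ -A G conn i j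
    coefficients-Z {X} {i} {j} X≈Z = trans (+-congʳ (trans X≈Z (Z-in (toPseudograph G) ∈⊤ ∈⊤))) (entry (i ≟ j))
      where
      entry : (d : Dec (i ≡ j)) →
        ((if does d then x else 0#) + - (edges i j ⨯ 1#)) + - (x * (if does d then 1# else 0#)) ≈ - (edges i j ⨯ 1#)
      entry (yes _) = solve 2 (λ x a → (x :- a) :- x :* :1 := :- a) refl x _
      entry (no  _) = solve 2 (λ x a → (:0 :- a) :- x :* :0 := :- a) refl x _

  -- The base case of the perturbation sequences: equal walk counts make the graph `Similar` to
  -- itself along `f`, and `similar-extend`, over all pairs from `S`, allows every choice of the
  -- free entries.
  matched-copies : Matched S (toPseudograph G) id (toPseudograph G) f
  matched-copies = record
    { placed  = record { injective = λ _ _ u≡v → u≡v ; present = λ _ → ∈⊤ ; symmetric = edges-sym }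
    ; placed′ = record { injective = f-injective      ; present = λ _ → ∈⊤ ; symmetric = edges-sym }
    ; adj-≡   = edges-f
    ; det-≈   = λ X X′ X≋ X′≋ on → trans (sym (det-cong (pencil-coefficients X))) (trans
        (Similar.det-≈ (similar-extend (_∈ S) f f-injective similar
          (λ u∈S v∈S → -‿cong (reflexive (≡.cong (_⨯ 1#) (edges-f u∈S v∈S))))
          pairs (all-filter inS? (List.cartesianProduct (List.allFin n) (List.allFin n))) (coefficients X)
                (coefficients X′)
          (λ i j ij∉ → coefficients-Z {X} (X≋ i j λ { ((_ , u∈S , ≡.refl) , (_ , v∈S , ≡.refl)) → ij∉
                (∈-pairs u∈S v∈S) }))
          (λ i j ij∉ → coefficients-Z {X′} (X′≋ i j λ { ((_ , u∈S , fu) , (_ , v∈S , fv)) → ij∉ (∈-pairs u∈S v∈S)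
                (fu , fv) }))
          (λ _ u∈S v∈S → +-cong (on u∈S v∈S) (-‿cong (*-congˡ (e-f u∈S v∈S))))) x)
        (det-cong (pencil-coefficients X′)))
    }
    where
    e-f : ∀ {u v} → u ∈ S → v ∈ S → e u v ≈ e (f u) (f v)
    e-f {u} {v} u∈S v∈S with u ≟ v
    ... | yes ≡.refl = sym (reflexive (≡.cong (if_then 1# else 0#) (dec-true (f u ≟ f u) ≡.refl)))
    ... | no  u≢v    = sym (reflexive (≡.cong (if_then 1# else 0#)
          (dec-false (f u ≟ f v) (u≢v ∘ f-injective u∈S v∈S))))

distanceRegular⇒perturbCospectral : ∀ {n} (G : Graph n) (conn : Connected G) → DistanceRegular G conn →
  (U U′ : Subset n) → Isometric G conn U U′ → PerturbCospectral G U U′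
distanceRegular⇒perturbCospectral G conn dr U U′ (f , U≅U′ , isometry) = f , U≅U′ , cospectral
  where
  cospectral : ∀ {S} → S ⊆ U → (π : Perturbations S) →
    Cospectral (proj₂ (perturb π id (toPseudograph G))) (proj₂ (perturb π f (toPseudograph G)))
  cospectral {S} S⊆U π K char0 λs = mk⇔ (λ spectrum x → trans (sym (dets x)) (spectrum x))
        (λ spectrum x → trans (dets x) (spectrum x))
    where
    open CommutativeRing (fieldRing K) using (_≈_; sym; trans)
    open CharacteristicDeterminants K
    dets : ∀ x → det K (charMatrix K (adjacencyMatrix (proj₂ (perturb π id (toPseudograph G)))) x) ≈
                 det K (charMatrix K (adjacencyMatrix (proj₂ (perturb π f (toPseudograph G)))) x)
    dets x = trans (det-charMatrix (proj₂ (perturb π id (toPseudograph G))) x) (trans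
      (PerturbedPseudographs.perturbed-det (fieldRing K) x π
        (DistanceRegularGraphs.matched-copies (fieldRing K) (charZero⇒torsionFree K char0) G conn dr
          (λ u∈S v∈S → _≅_via_.injective U≅U′ (S⊆U u∈S) (S⊆U v∈S)) (λ u∈S v∈S → isometry (S⊆U u∈S) (S⊆U v∈S)) x))
      (sym (det-charMatrix (proj₂ (perturb π f (toPseudograph G))) x)))

-- Discrete fields, division of polynomials and simple extensions.

-- Decidable equality makes exact degrees and remainders computable; in the Heyting field derived
-- below, inequality serves as apartness.
record DiscreteField : Set₁ where
  field
    commutativeRing : CommutativeRing 0ℓ 0ℓ
  open CommutativeRing commutativeRing public hiding (zero)
  open RawSemiringOps (Semiring.rawSemiring semiring) using () renaming (_×_ to _⨯_) public
  field
    _≈?_     : Decidable _≈_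
    inverse  : ∀ x → ¬ x ≈ 0# → ∃ λ y → x * y ≈ 1#
    charZero : ∀ n → ¬ suc n ⨯ 1# ≈ 0#

  1≉0 : ¬ 1# ≈ 0#
  1≉0 1≈0 = charZero 0 (trans (+-identityʳ 1#) 1≈0)

  heytingField : HeytingField 0ℓ 0ℓ 0ℓ
  heytingField = record
    { _#_ = λ x y → ¬ x ≈ y
    ; isHeytingField = record
      { isHeytingCommutativeRing = record
        { isCommutativeRing   = isCommutativeRing
        ; isApartnessRelation = record
          { irrefl  = λ x≈y x≉y → x≉y x≈y
          ; sym     = λ x≉y y≈x → x≉y (sym y≈x)
          ; cotrans = cotransitive
          }
        ; #⇒invertible = λ {x} {y} x≉y → let z , e = inverse (x - y) (x≉y ∘ difference-zero x y) in
            z , trans (*-comm z _) e , e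
        ; invertible⇒# = λ {x} {y} (z , e , _) x≈y → 1≉0 (begin
            1#           ≈⟨ e ⟨
            z * (x - y)  ≈⟨ *-congˡ (trans (+-congʳ x≈y) (-‿inverseʳ y)) ⟩
            z * 0#       ≈⟨ zeroʳ z ⟩
            0#           ∎)
        }
      ; tight = λ x y → decidable-stable (x ≈? y) , λ x≈y x≉y → x≉y x≈y
      }
    }
    where
    open SetoidReasoning setoid
    open CommutativeRingSolver commutativeRing
    difference-zero : ∀ x y → x - y ≈ 0# → x ≈ y
    difference-zero x y e = begin
      x            ≈⟨ solve 2 (λ x y → x := (x :- y) :+ y) refl x y ⟩
      (x - y) + y  ≈⟨ +-congʳ e ⟩
      0# + y       ≈⟨ +-identityˡ y ⟩
      y            ∎
    cotransitive : ∀ {x y} → ¬ x ≈ y → ∀ z → ¬ x ≈ z ⊎ ¬ z ≈ y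
    cotransitive {x} {y} x≉y z with x ≈? z
    ... | yes x≈z = inj₂ λ z≈y → x≉y (trans x≈z z≈y)
    ... | no  x≉z = inj₁ x≉z

  torsion-free : PolynomialFunctions.Torsion-free commutativeRing
  torsion-free = charZero⇒torsionFree heytingField charZero

rawRing : CommutativeRing 0ℓ 0ℓ → RawRing 0ℓ 0ℓ
rawRing R = Ring.rawRing (CommutativeRing.ring R)

IsHomomorphism : (R S : CommutativeRing 0ℓ 0ℓ) → (CommutativeRing.Carrier R → CommutativeRing.Carrier S) → Set
IsHomomorphism R S = RingMorphisms.IsRingHomomorphism (rawRing R) (rawRing S)

module FieldPolynomials (F : DiscreteField) where
  open DiscreteField F
  open CommutativeRingSolver commutativeRing
  open PolynomialFunctions commutativeRing hiding (Torsion-free)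
  open SetoidReasoning setoid

  infix 4 _≗_
  _≗_ : (f g : Carrier → Carrier) → Set
  f ≗ g = ∀ x → f x ≈ g x

  IsPoly : (Carrier → Carrier) → Set
  IsPoly f = ∃ λ n → ∃ λ top → Poly n top f

  isPoly-cong : ∀ {f g} → f ≗ g → IsPoly f → IsPoly g
  isPoly-cong f≗g (n , top , p) = n , top , poly-cong refl f≗g p

  isPoly-const : ∀ a → IsPoly (λ _ → a)
  isPoly-const a = 0 , a , poly-const a

  isPoly-x : IsPoly (λ x → x)
  isPoly-x = isPoly-cong (λ x → *-identityʳ x) (1 , 1# , poly-x* (poly-const 1#))

  isPoly-+ : ∀ {f g} → IsPoly f → IsPoly g → IsPoly (λ x → f x + g x)
  isPoly-+ {f} {g} (m , _ , p) (n , _ , q) = suc (n ℕ.+ m) , _ , poly-+ (poly-raise* n p)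
    (≡.subst (λ k → Poly (suc k) 0# g) (ℕ.+-comm m n) (poly-raise* m q))

  isPoly-* : ∀ {f g} → IsPoly f → IsPoly g → IsPoly (λ x → f x * g x)
  isPoly-* (m , _ , p) (n , _ , q) = m ℕ.+ n , _ , poly-* p q

  isPoly-neg : ∀ {f} → IsPoly f → IsPoly (λ x → - f x)
  isPoly-neg (n , _ , p) = n , _ , poly-cong refl (λ x → solve 1 (λ y → (:- :1) :* y := :- y) refl _)
        (poly-scale (- 1#) p)

  isPoly-sub : ∀ {f g} → IsPoly f → IsPoly g → IsPoly (λ x → f x - g x)
  isPoly-sub p q = isPoly-+ p (isPoly-neg q)

  Polynomial : Set
  Polynomial = ∃ IsPoly

  infix 4 _∣_
  _∣_ : (g f : Carrier → Carrier) → Set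
  g ∣ f = ∃ λ ((q , _) : Polynomial) → ∀ x → f x ≈ q x * g x

  degree : ∀ {n top f} → Poly n top f → f ≗ (λ _ → 0#) ⊎ ∃ λ e → e ℕ.≤ n × ∃ λ lead → ¬ lead ≈ 0# × Poly e lead f
  degree {n} {top} p with top ≈? 0#
  degree {n}     {top} p           | no  top≉0 = inj₂ (n , ℕ.≤-refl , top , top≉0 , p)
  degree {zero}  {top} ([] , f≈)   | yes top≈0 = inj₁ λ x → trans (f≈ x) top≈0
  degree {suc n} {top} p           | yes top≈0 with degree (proj₂ (poly-lower (poly-cong top≈0 (λ _ → refl) p)))
  ... | inj₁ f≗0              = inj₁ f≗0
  ... | inj₂ (e , e≤n , rest) = inj₂ (e , ℕ.m≤n⇒m≤1+n e≤n , rest)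

  zero? : ∀ {f} → IsPoly f → Dec (f ≗ λ _ → 0#)
  zero? (_ , _ , p) with degree p
  ... | inj₁ f≗0                        = yes f≗0
  ... | inj₂ (_ , _ , lead , lead≉0 , q) = no λ f≗0 → lead≉0 (poly-top-zero torsion-free q λ k → f≗0 _)

  -- Recursion along Horner's scheme: if f = a + x f₁ and f₁ leaves the remainder r, then a + x r
  -- has at most the degree of `g`, and a constant multiple of `g` clears its top coefficient.
  -- Formal degree e with top coefficient 0 expresses that the remainder has degree below e.
  divide : ∀ {e g n top f} → Poly e 1# g → Poly n top f →
    ∃ λ ((q , _) : Polynomial) → ∃ λ r → Poly e 0# r × (∀ x → f x ≈ q x * g x + r x)
  divide {zero} {g} {n} {top} {f} ([] , g≈) p = (f , n , top , p) , (λ _ → 0#) , poly-const 0# , λ x →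
    trans (solve 1 (λ f → f := f :* :1 :+ :0) refl (f x)) (+-congʳ (*-congˡ (sym (g≈ x))))
  divide {suc e} pg ([] , f≈) = ((λ _ → 0#) , isPoly-const 0#) , _ , low , λ x →
    sym (trans (+-congʳ (zeroˡ _)) (+-identityˡ _))
    where
    low : Poly (suc e) 0# _
    low = ≡.subst (λ k → Poly (suc k) 0# _) (ℕ.+-identityʳ e) (poly-raise* e ([] , f≈))
  divide {suc e} {g} {suc n} {top} {f} pg (a ∷ as , f≈) with divide pg (as , λ _ → refl)
  ... | (q , isPoly-q) , r , pr , eq =
    ((λ x → x * q x + lead) , isPoly-+ (isPoly-* isPoly-x isPoly-q) (isPoly-const lead)) ,
    (λ x → (a + x * r x) - lead * g x) ,
    poly-cong (solve 1 (λ l → l :- l :* :1 := :0) refl lead) (λ _ → refl)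
          (poly-sub {c′ = lead} shifted (poly-scale lead pg)) ,
    λ x → trans (f≈ x) (trans (+-congˡ (*-congˡ (eq x)))
      (solve 6 (λ a x q g r l → a :+ x :* (q :* g :+ r) := (x :* q :+ l) :* g :+ ((a :+ x :* r) :- l :* g)) refl
        a x (q x) (g x) (r x) lead))
    where
    lower = poly-lower pr
    lead = proj₁ lower
    shifted : Poly (suc e) lead (λ x → a + x * r x)
    shifted = a ∷ proj₁ (proj₂ lower) , λ x → +-congˡ (*-congˡ (proj₂ (proj₂ lower) x))

  poly-raise-zero : ∀ k {n f} → Poly n 0# f → Poly (k ℕ.+ n) 0# f
  poly-raise-zero zero    p = p
  poly-raise-zero (suc k) p = poly-raise* k p

  -- A nonzero quotient would put its leading coefficient at a degree where `r` has coefficient 0.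
  small-multiple-zero : ∀ {d p r} → Poly d 1# p → Poly d 0# r → p ∣ r → r ≗ λ _ → 0#
  small-multiple-zero {d} {p} {r} monic pr ((q , _ , _ , pq) , r≈) with degree pq
  ... | inj₁ q≗0 = λ x → trans (r≈ x) (trans (*-congʳ (q≗0 x)) (zeroˡ _))
  ... | inj₂ (e , _ , lead , lead≉0 , pq′) = contradiction
    (trans (sym (*-identityʳ lead)) (poly-top-unique torsion-free (poly-* pq′ monic) (poly-raise-zero e pr) λ x → sym
          (r≈ x)))
    lead≉0

-- The field F[x]/(p).  As F is infinite, polynomials can be represented by functions, so that the
-- ring laws hold pointwise.
module SimpleExtension (F : DiscreteField) (d : ℕ) (p : DiscreteField.Carrier F → DiscreteField.Carrier F)
  (monic : PolynomialFunctions.Poly (DiscreteField.commutativeRing F) (suc d) (DiscreteField.1# F) p)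
  (irreducible : ∀ e g → PolynomialFunctions.Poly (DiscreteField.commutativeRing F) (suc e) (DiscreteField.1# F) g →
    FieldPolynomials._∣_ F g p → d ℕ.≤ e) where
  open DiscreteField F
  open CommutativeRingSolver commutativeRing
  open PolynomialFunctions commutativeRing hiding (Torsion-free)
  open FieldPolynomials F
  open SetoidReasoning setoid

  infix 4 _≈ₚ_
  _≈ₚ_ : Polynomial → Polynomial → Set
  (f , _) ≈ₚ (g , _) = p ∣ λ x → f x - g x

  pointwise : ∀ {f g : Polynomial} → proj₁ f ≗ proj₁ g → f ≈ₚ g
  pointwise {f , _} {g , _} f≗g = ((λ _ → 0#) , isPoly-const 0#) , λ x →
    trans (+-congʳ (f≗g x)) (trans (-‿inverseʳ _) (sym (zeroˡ _)))

  private
    _⊕_ _⊗_ : Polynomial → Polynomial → Polynomial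
    (f , pf) ⊕ (g , pg) = (λ x → f x + g x) , isPoly-+ pf pg
    (f , pf) ⊗ (g , pg) = (λ x → f x * g x) , isPoly-* pf pg
    ⊝_ : Polynomial → Polynomial
    ⊝ (f , pf) = (λ x → - f x) , isPoly-neg pf

  constant : Carrier → Polynomial
  constant a = (λ _ → a) , isPoly-const a

  quotientRing : CommutativeRing 0ℓ 0ℓ
  quotientRing = record
    { Carrier = Polynomial ; _≈_ = _≈ₚ_ ; _+_ = _⊕_ ; _*_ = _⊗_ ; -_ = ⊝_ ; 0# = constant 0# ; 1# = constant 1#
    ; isCommutativeRing = record
      { isRing = record
        { +-isAbelianGroup = record
          { isGroup = record
            { isMonoid = record
              { isSemigroup = record
                { isMagma = record
                  { isEquivalence = record
                    { refl  = λ {f} → pointwise {f} {f} λ _ → refl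
                    ; sym   = λ {f} {g} (q , e) → ⊝ q , λ x → begin
                        proj₁ g x - proj₁ f x      ≈⟨ solve 2 (λ a b → b :- a := :- (a :- b)) refl (proj₁ f x)
                              (proj₁ g x) ⟩
                        - (proj₁ f x - proj₁ g x)  ≈⟨ -‿cong (e x) ⟩
                        - (proj₁ q x * p x)        ≈⟨ solve 2 (λ a b → :- (a :* b) := (:- a) :* b) refl _ _ ⟩
                        - proj₁ q x * p x          ∎
                    ; trans = λ {f} {g} {h} (q , e) (q′ , e′) → q ⊕ q′ , λ x → begin
                        proj₁ f x - proj₁ h x
                          ≈⟨ solve 3 (λ a b c → a :- c := (a :- b) :+ (b :- c)) refl (proj₁ f x) (proj₁ g x)
                               (proj₁ h x) ⟩
                        (proj₁ f x - proj₁ g x) + (proj₁ g x - proj₁ h x)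
                          ≈⟨ +-cong (e x) (e′ x) ⟩
                        proj₁ q x * p x + proj₁ q′ x * p x
                          ≈⟨ distribʳ _ _ _ ⟨
                        (proj₁ q x + proj₁ q′ x) * p x ∎
                    }
                  ; ∙-cong = λ {f} {f′} {g} {g′} (q , e) (q′ , e′) → q ⊕ q′ , λ x → begin
                      (proj₁ f x + proj₁ g x) - (proj₁ f′ x + proj₁ g′ x)
                        ≈⟨ solve 4 (λ a b c d → (a :+ c) :- (b :+ d) := (a :- b) :+ (c :- d)) refl _ _ _ _ ⟩
                      (proj₁ f x - proj₁ f′ x) + (proj₁ g x - proj₁ g′ x)
                        ≈⟨ +-cong (e x) (e′ x) ⟩
                      proj₁ q x * p x + proj₁ q′ x * p x
                        ≈⟨ distribʳ _ _ _ ⟨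
                      (proj₁ q x + proj₁ q′ x) * p x ∎
                  }
                ; assoc = λ f g h → pointwise {(f ⊕ g) ⊕ h} {f ⊕ (g ⊕ h)} λ x → +-assoc _ _ _
                }
              ; identity = (λ f → pointwise {constant 0# ⊕ f} {f} λ x → +-identityˡ _) ,
                           (λ f → pointwise {f ⊕ constant 0#} {f} λ x → +-identityʳ _)
              }
            ; inverse = (λ f → pointwise {(⊝ f) ⊕ f} {constant 0#} λ x → -‿inverseˡ _) ,
                        (λ f → pointwise {f ⊕ (⊝ f)} {constant 0#} λ x → -‿inverseʳ _)
            ; ⁻¹-cong = λ {f} {g} (q , e) → ⊝ q , λ x → begin
                - proj₁ f x - - proj₁ g x  ≈⟨ solve 2 (λ a b → (:- a) :- (:- b) := :- (a :- b)) refl _ _ ⟩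
                - (proj₁ f x - proj₁ g x)  ≈⟨ -‿cong (e x) ⟩
                - (proj₁ q x * p x)        ≈⟨ solve 2 (λ a b → :- (a :* b) := (:- a) :* b) refl _ _ ⟩
                - proj₁ q x * p x          ∎
            }
          ; comm = λ f g → pointwise {f ⊕ g} {g ⊕ f} λ x → +-comm _ _
          }
        ; *-cong = λ {f} {f′} {g} {g′} (q , e) (q′ , e′) → (q ⊗ g) ⊕ (f′ ⊗ q′) , λ x → begin
            proj₁ f x * proj₁ g x - proj₁ f′ x * proj₁ g′ x
              ≈⟨ solve 4 (λ a b c d → a :* c :- b :* d := (a :- b) :* c :+ b :* (c :- d)) refl _ _ _ _ ⟩
            (proj₁ f x - proj₁ f′ x) * proj₁ g x + proj₁ f′ x * (proj₁ g x - proj₁ g′ x)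
              ≈⟨ +-cong (*-congʳ (e x)) (*-congˡ (e′ x)) ⟩
            (proj₁ q x * p x) * proj₁ g x + proj₁ f′ x * (proj₁ q′ x * p x)
              ≈⟨ solve 5 (λ q p g f q′ → (q :* p) :* g :+ f :* (q′ :* p) := (q :* g :+ f :* q′) :* p) refl _ _ _ _ _ ⟩
            (proj₁ q x * proj₁ g x + proj₁ f′ x * proj₁ q′ x) * p x ∎
        ; *-assoc = λ f g h → pointwise {(f ⊗ g) ⊗ h} {f ⊗ (g ⊗ h)} λ x → *-assoc _ _ _
        ; *-identity = (λ f → pointwise {constant 1# ⊗ f} {f} λ x → *-identityˡ _) ,
                       (λ f → pointwise {f ⊗ constant 1#} {f} λ x → *-identityʳ _)
        ; distrib = (λ f g h → pointwise {f ⊗ (g ⊕ h)} {(f ⊗ g) ⊕ (f ⊗ h)} λ x → distribˡ _ _ _) ,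
                    (λ f g h → pointwise {(g ⊕ h) ⊗ f} {(g ⊗ f) ⊕ (h ⊗ f)} λ x → distribʳ _ _ _)
        }
      ; *-comm = λ f g → pointwise {f ⊗ g} {g ⊗ f} λ x → *-comm _ _
      }
    }

  private
    module Q = CommutativeRing quotientRing

    _mod-p : (f : Polynomial) → ∃ λ ((q , _) : Polynomial) → ∃ λ r → Poly (suc d) 0# r ×
          (∀ x → proj₁ f x ≈ q x * p x + r x)
    (f , _ , _ , pf) mod-p = divide monic pf

    remainder-zero⇒∣ : ∀ f → proj₁ (proj₂ (f mod-p)) ≗ (λ _ → 0#) → p ∣ proj₁ f
    remainder-zero⇒∣ f r≗0 = let (q , pq) , r , _ , eq = f mod-p in
      (q , pq) , λ x → trans (eq x) (trans (+-congˡ (r≗0 x)) (+-identityʳ _))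

    ∣⇒remainder-zero : ∀ f → p ∣ proj₁ f → proj₁ (proj₂ (f mod-p)) ≗ (λ _ → 0#)
    ∣⇒remainder-zero f ((q′ , pq′) , e) with f mod-p
    ... | (q , pq) , r , pr , eq = small-multiple-zero monic pr
      (((λ x → q′ x - q x) , isPoly-sub pq′ pq) , λ x → begin
        r x                              ≈⟨ solve 2 (λ r y → r := (y :+ r) :- y) refl (r x) (q x * p x) ⟩
        (q x * p x + r x) - q x * p x    ≈⟨ +-congʳ (trans (sym (eq x)) (e x)) ⟩
        q′ x * p x - q x * p x           ≈⟨ solve 3 (λ a b c → a :* c :- b :* c := (a :- b) :* c) refl _ _ _ ⟩
        (q′ x - q x) * p x               ∎)

    _≈ₚ?_ : Decidable _≈ₚ_
    f ≈ₚ? g = decide (zero? (_ , _ , proj₁ (proj₂ (proj₂ (h mod-p)))))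
      where
      h : Polynomial
      h = f ⊕ (⊝ g)
      decide : Dec (proj₁ (proj₂ (h mod-p)) ≗ λ _ → 0#) → Dec (f ≈ₚ g)
      decide (yes r≗0) = yes (remainder-zero⇒∣ h r≗0)
      decide (no  r≉0) = no (r≉0 ∘ ∣⇒remainder-zero h)

    Inverse : (Carrier → Carrier) → Set
    Inverse g = ∃ λ (s : Polynomial) → p ∣ λ x → g x * proj₁ s x - 1#

    -- Dividing p by g leaves a nonzero remainder of smaller degree, whose inverse yields one of g.
    inverse-below : ∀ e → e ℕ.< suc d → ∀ {g lead} → ¬ lead ≈ 0# → Poly e lead g → Inverse g
    inverse-below = <-rec (λ e → e ℕ.< suc d → ∀ {g lead} → ¬ lead ≈ 0# → Poly e lead g → Inverse g) step
      where
      step : ∀ e → (∀ {e′} → e′ ℕ.< e → e′ ℕ.< suc d → ∀ {g lead} → ¬ lead ≈ 0# → Poly e′ lead g → Inverse g) →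
        e ℕ.< suc d → ∀ {g lead} → ¬ lead ≈ 0# → Poly e lead g → Inverse g
      step zero rec e<d {g} {lead} lead≉0 ([] , g≈) with y , ly≈1 ← inverse lead lead≉0 =
        constant y , (constant 0#) , λ x → trans (+-congʳ (trans (*-congʳ (g≈ x)) ly≈1))
          (solve 1 (λ z → :1 :- :1 := :0 :* z) refl (p x))
      step (suc e) rec (ℕ.s≤s e<d) {g} {lead} lead≉0 pg with inverse lead lead≉0
      ... | y , ly≈1 with divide {g = λ x → y * g x} (poly-cong (trans (*-comm y lead) ly≈1) (λ _ → refl) (poly-scale y pg)) monic
      ...   | (q , pq) , r , pr , eq with degree (proj₂ (poly-lower pr))
      -- A zero remainder would make y g a monic divisor of `p` of degree e + 1, below the degree d
      -- + 1 of `p`.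
      ...     | inj₁ r≗0 = contradiction (irreducible e (λ x → y * g x)
                (poly-cong (trans (*-comm y lead) ly≈1) (λ _ → refl) (poly-scale y pg))
                ((q , pq) , λ x → trans (eq x) (trans (+-congˡ (r≗0 x)) (+-identityʳ _)))) (ℕ.<⇒≱ e<d)
      ...     | inj₂ (e′ , e′≤e , lead′ , lead′≉0 , pr′)
                with (s , ps) , (t , pt) , rs≈ ← rec (ℕ.s≤s e′≤e) (ℕ.≤-trans (ℕ.s≤s e′≤e) (ℕ.m≤n⇒m≤1+n e<d)) lead′≉0 pr′ =
        -- Modulo p, the equation p = q (y g) + r gives r ≡ - y q g; with r s ≡ 1 this makes - y q s
        -- an inverse of g.
        ((λ x → - (y * (q x * s x))) , isPoly-neg (isPoly-* (isPoly-const y) (isPoly-* pq ps))) ,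
        ((λ x → t x - s x) , isPoly-sub pt ps) , λ x → begin
          g x * - (y * (q x * s x)) - 1#
            ≈⟨ solve 5 (λ g y q s r → g :* (:- (y :* (q :* s))) :- :1 := (r :* s :- :1) :- s :* (q :* (y :* g) :+ r))
                 refl
                 (g x) y (q x) (s x) (r x) ⟩
          (r x * s x - 1#) - s x * (q x * (y * g x) + r x)
            ≈⟨ +-cong (rs≈ x) (-‿cong (*-congˡ (sym (eq x)))) ⟩
          t x * p x - s x * p x
            ≈⟨ solve 3 (λ a b c → a :* c :- b :* c := (a :- b) :* c) refl _ _ _ ⟩
          (t x - s x) * p x ∎

    inverseₚ : ∀ f → ¬ f ≈ₚ constant 0# → ∃ λ g → f ⊗ g ≈ₚ constant 1#
    inverseₚ f f≉0 with f mod-p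
    ... | (q , pq) , r , pr , eq with degree (proj₂ (poly-lower pr))
    ...   | inj₁ r≗0 = contradiction ((q , pq) , λ x → begin
              proj₁ f x - 0#       ≈⟨ solve 1 (λ a → a :- :0 := a) refl _ ⟩
              proj₁ f x            ≈⟨ trans (eq x) (trans (+-congˡ (r≗0 x)) (+-identityʳ _)) ⟩
              q x * p x            ∎) f≉0
    ...   | inj₂ (e , e≤d , lead , lead≉0 , pr′) with (s , ps) , (t , pt) , rs≈ ← inverse-below e (ℕ.s≤s e≤d) lead≉0 pr′ =
      (s , ps) , ((λ x → q x * s x + t x) , isPoly-+ (isPoly-* pq ps) pt) , λ x → begin
        proj₁ f x * s x - 1#                   ≈⟨ +-congʳ (*-congʳ (eq x)) ⟩
        (q x * p x + r x) * s x - 1#           ≈⟨ solve 4 (λ q p r s → (q :* p :+ r) :* s :- :1 := (q :* s) :* p :+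
              (r :* s :- :1)) refl _ _ _ _ ⟩
        (q x * s x) * p x + (r x * s x - 1#)   ≈⟨ +-congˡ (rs≈ x) ⟩
        (q x * s x) * p x + t x * p x          ≈⟨ distribʳ _ _ _ ⟨
        (q x * s x + t x) * p x                ∎

    constant-zero : ∀ {a} → constant a ≈ₚ constant 0# → a ≈ 0#
    constant-zero {a} (q , e) = small-multiple-zero monic
      (≡.subst (λ k → Poly (suc k) 0# (λ _ → a)) (ℕ.+-identityʳ d) (poly-raise* d (poly-const a)))
      (q , λ x → trans (solve 1 (λ a → a := a :- :0) refl a) (e x)) 0#

    multiple-constant : ∀ n x → proj₁ (RawSemiringOps._×_ (Semiring.rawSemiring Q.semiring) n Q.1#) x ≈ n ⨯ 1#
    multiple-constant zero    x = refl
    multiple-constant (suc n) x = +-congˡ (multiple-constant n x)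

  extension : DiscreteField
  extension = record
    { commutativeRing = quotientRing
    ; _≈?_     = _≈ₚ?_
    ; inverse  = inverseₚ
    ; charZero = λ n e → charZero n (constant-zero {suc n ⨯ 1#} (Q.trans
        {constant (suc n ⨯ 1#)} {RawSemiringOps._×_ (Semiring.rawSemiring Q.semiring) (suc n) Q.1#} {constant 0#}
        (pointwise {constant (suc n ⨯ 1#)} {RawSemiringOps._×_ (Semiring.rawSemiring Q.semiring) (suc n) Q.1#} λ x →
              sym (multiple-constant (suc n) x)) e))
    }

  constant-homomorphism : IsHomomorphism commutativeRing quotientRing constant
  constant-homomorphism = record
    { isSemiringHomomorphism = record
      { isNearSemiringHomomorphism = record
        { +-isMonoidHomomorphism = record
          { isMagmaHomomorphism = record
            { isRelHomomorphism = record { cong = λ {a} {b} a≈b → pointwise {constant a} {constant b} λ _ → a≈b }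
            ; homo = λ a b → pointwise {constant (a + b)} {constant a ⊕ constant b} λ _ → refl
            }
          ; ε-homo = pointwise {constant 0#} {constant 0#} λ _ → refl
          }
        ; *-homo = λ a b → pointwise {constant (a * b)} {constant a ⊗ constant b} λ _ → refl
        }
      ; 1#-homo = pointwise {constant 1#} {constant 1#} λ _ → refl
      }
    ; -‿homo = λ a → pointwise {constant (- a)} {⊝ constant a} λ _ → refl
    }

  indeterminate : Polynomial
  indeterminate = (λ x → x) , isPoly-x

  horner-indeterminate : ∀ {n} (as : Vec Carrier n) x →
    proj₁ (PolynomialFunctions.horner quotientRing Q.1# (Vec.map constant as) indeterminate) x ≈ horner 1# as x
  horner-indeterminate []       x = refl
  horner-indeterminate (a ∷ as) x = +-congˡ (*-congˡ (horner-indeterminate as x))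

  root : ∀ {n} (as : Vec Carrier n) → p ∣ horner 1# as →
    PolynomialFunctions.horner quotientRing Q.1# (Vec.map constant as) indeterminate Q.≈ Q.0#
  root as (q , e) = q , λ x → trans (+-congʳ (horner-indeterminate as x))
        (trans (solve 1 (λ a → a :- :0 := a) refl _) (e x))

-- Ring homomorphisms and splitting fields.

module Homomorphisms (R S : CommutativeRing 0ℓ 0ℓ) (ι : CommutativeRing.Carrier R → CommutativeRing.Carrier S)
  (isHom : IsHomomorphism R S ι) where
  private
    module R = CommutativeRing R
  open CommutativeRing S hiding (zero)
  open RingMorphisms.IsRingHomomorphism isHom
  open RawSemiringOps (Semiring.rawSemiring R.semiring) using () renaming (_×_ to _⨯ᴿ_; _^_ to _^ᴿ_)
  open RawSemiringOps (Semiring.rawSemiring semiring) using (_^_) renaming (_×_ to _⨯_)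
  open PolynomialFunctions
  open Determinants using (Mat; det′; det-empty; det-first-row)
  open FiniteSums using (∑; ∑-empty; ∑-suc; ∑-cong)

  private
    variable
      n : ℕ

  ⨯-homo : ∀ k → ι (k ⨯ᴿ R.1#) ≈ k ⨯ 1#
  ⨯-homo zero    = 0#-homo
  ⨯-homo (suc k) = trans (+-homo _ _) (+-cong 1#-homo (⨯-homo k))

  horner-homo : (as : Vec R.Carrier n) → ∀ x → ι (horner R R.1# as x) ≈ horner S 1# (Vec.map ι as) (ι x)
  horner-homo []       x = 1#-homo
  horner-homo (a ∷ as) x = trans (+-homo _ _) (+-congˡ (trans (*-homo _ _) (*-congˡ (horner-homo as x))))

  quotient-homo : ∀ r (as : Vec R.Carrier (suc n)) y →
    horner S 1# (quotient S 1# (ι r) (Vec.map ι as)) y ≈ horner S 1# (Vec.map ι (quotient R R.1# r as)) y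
  quotient-homo r (a ∷ [])         y = refl
  quotient-homo r (a ∷ as@(_ ∷ _)) y = +-cong (sym (horner-homo as r)) (*-congˡ (quotient-homo r as y))

  ∑-homo : (f : Fin n → R.Carrier) → ι (∑ R.commutativeSemiring f) ≈ ∑ commutativeSemiring (λ i → ι (f i))
  ∑-homo {zero}  f = trans (⟦⟧-cong (∑-empty R.commutativeSemiring f))
        (trans 0#-homo (sym (∑-empty commutativeSemiring _)))
  ∑-homo {suc n} f = trans (⟦⟧-cong (∑-suc R.commutativeSemiring f)) (trans (+-homo _ _)
    (trans (+-congˡ (∑-homo (f ∘ suc))) (sym (∑-suc commutativeSemiring _))))

  ^-homo : ∀ k → ι ((R.- R.1#) ^ᴿ k) ≈ (- 1#) ^ k
  ^-homo zero    = 1#-homo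
  ^-homo (suc k) = trans (*-homo _ _) (*-cong (trans (-‿homo _) (-‿cong 1#-homo)) (^-homo k))

  det-homo : (M : Mat R n) → ι (det′ R M) ≈ det′ S λ i j → ι (M i j)
  det-homo {zero}  M = trans (⟦⟧-cong (det-empty R M)) (trans 1#-homo (sym (det-empty S _)))
  det-homo {suc n} M = trans (⟦⟧-cong (det-first-row R M)) (trans (∑-homo _) (trans
    (∑-cong commutativeSemiring λ j → trans (*-homo _ _) (*-cong (trans (*-homo _ _) (*-congʳ (^-homo (toℕ j))))
          (det-homo _)))
    (sym (det-first-row S _))))

  charEntry-homo : ∀ x a (i j : Fin n) →
    ι (MatchedPseudographs.charEntry R x a i j) ≈ MatchedPseudographs.charEntry S (ι x) a i j
  charEntry-homo x a i j = trans (+-homo _ _) (+-cong (entry (does (i ≟ j))) (trans (-‿homo _) (-‿cong (⨯-homo a))))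
    where
    entry : ∀ b → ι (if b then x else R.0#) ≈ (if b then ι x else 0#)
    entry true  = refl
    entry false = 0#-homo

open DiscreteField using (Carrier; commutativeRing; heytingField)

-- A nonzero difference is invertible, and so is its image, which therefore cannot be 0.
hom-injective : (F L : DiscreteField) {ι : Carrier F → Carrier L} → IsHomomorphism (commutativeRing F)
      (commutativeRing L) ι →
  ∀ {a b} → DiscreteField._≈_ L (ι a) (ι b) → DiscreteField._≈_ F a b
hom-injective F L {ι} isHom {a} {b} ιa≈ιb = decidable-stable (a F.≈? b) λ a≉b →
  let y , e = F.inverse (a F.- b) (λ d → a≉b (begin
        a                  ≈⟨ solve 2 (λ a b → a := (a :- b) :+ b) F.refl a b ⟩
        (a F.- b) F.+ b    ≈⟨ F.trans (F.+-congʳ d) (F.+-identityˡ b) ⟩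
        b                  ∎))
  in L.1≉0 (L.trans (L.sym 1#-homo) (L.trans (⟦⟧-cong (F.sym e)) (L.trans (*-homo _ _) (L.trans
       (L.*-congʳ (L.trans (+-homo _ _) (L.trans (L.+-cong ιa≈ιb (-‿homo b)) (L.-‿inverseʳ _)))) (L.zeroˡ _)))))
  where
  module F = DiscreteField F
  module L = DiscreteField L
  open RingMorphisms.IsRingHomomorphism isHom
  open CommutativeRingSolver F.commutativeRing
  open SetoidReasoning F.setoid

hornerᴹ : (F : DiscreteField) {n : ℕ} → Vec (Carrier F) n → Carrier F → Carrier F
hornerᴹ F = PolynomialFunctions.horner (commutativeRing F) (DiscreteField.1# F)

-- `P` will be the existence of a divisor of a given degree, for which no decision procedure is at
-- hand; hence the double negation, in contrast to `least`.
least-classical : (P : ℕ → Set) → ∃ P → ¬ ¬ (∃ λ d → P d × ∀ e → P e → d ℕ.≤ e)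
least-classical P (d , Pd) none = <-rec (λ d → ¬ P d)
  (λ d below Pd → none (d , Pd , λ e Pe → ℕ.≮⇒≥ λ e<d → below e<d Pe)) d Pd

-- A monic divisor of least positive degree is irreducible, because its divisors divide the given
-- polynomial as well. In the extension by this divisor the indeterminate is a root.
root-exists : (F : DiscreteField) {n : ℕ} (as : Vec (Carrier F) (suc n)) →
  ¬ ¬ (∃ λ L → ∃ λ ι → IsHomomorphism (commutativeRing F) (commutativeRing L) ι ×
       ∃ λ r → DiscreteField._≈_ L (hornerᴹ L (Vec.map ι as) r) (DiscreteField.0# L))
root-exists F {n} as none = least-classical Divisor (n , horner 1# as , (as , λ _ → refl) , divides-itself)
  λ (d , (p , monic , p∣f) , least) →
    let irreducible = λ e g monic′ g∣p → least e (g , monic′ , ∣-trans g∣p p∣f)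
        module E = SimpleExtension F d p monic irreducible
    in none (E.extension , E.constant , E.constant-homomorphism , E.indeterminate , E.root as p∣f)
  where
  open DiscreteField F using (_≈_; _*_; 1#; refl; sym; trans; *-identityˡ; *-congˡ; *-assoc)
  open PolynomialFunctions (commutativeRing F)
  open FieldPolynomials F using (_∣_; isPoly-const; isPoly-*)
  Divisor : ℕ → Set
  Divisor d = ∃ λ p → Poly (suc d) 1# p × p ∣ horner 1# as
  divides-itself : horner 1# as ∣ horner 1# as
  divides-itself = ((λ _ → 1#) , isPoly-const 1#) , λ x → sym (*-identityˡ _)
  ∣-trans : ∀ {f g h} → f ∣ g → g ∣ h → f ∣ h
  ∣-trans ((q , pq) , e) ((q′ , pq′) , e′) = ((λ x → q′ x * q x) , isPoly-* pq′ pq) , λ x →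
    trans (e′ x) (trans (*-congˡ (e x)) (sym (*-assoc _ _ _)))

productOfRoots : (L : DiscreteField) → Carrier L → List (Carrier L) → Carrier L
productOfRoots L y λs = List.foldr L._*_ L.1# (List.map (λ l → y L.- l) λs)
  where module L = DiscreteField L

-- Induction on the degree, with the linear factor of a root divided out over the extended field.
-- All goals are negative, so each extension can be used as if it had been constructed.
splitting-exists : (F : DiscreteField) {n : ℕ} (as : Vec (Carrier F) n) →
  ¬ ¬ (∃ λ L → ∃ λ ι → IsHomomorphism (commutativeRing F) (commutativeRing L) ι ×
       ∃ λ λs → ∀ y → DiscreteField._≈_ L (hornerᴹ L (Vec.map ι as) y) (productOfRoots L y λs))
splitting-exists F {zero}  []   none =
  none (F , id , Identity.isRingHomomorphism _ (DiscreteField.refl F) , [] , λ y → DiscreteField.refl F)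
splitting-exists F {suc n} as none = root-exists F as λ (L₁ , ι₁ , hom₁ , r , r-root) →
  splitting-exists L₁ (PolynomialFunctions.quotient (commutativeRing L₁) (DiscreteField.1# L₁) r (Vec.map ι₁ as))
    λ (L , ι , hom , λs , splits) →
      let module L₁ = DiscreteField L₁
          module L  = DiscreteField L
          open PolynomialFunctions L.commutativeRing using (horner; quotient; horner-quotient)
          open Homomorphisms L₁.commutativeRing L.commutativeRing ι hom
          open SetoidReasoning L.setoid
          bs : Vec L₁.Carrier (suc n)
          bs = Vec.map ι₁ as
      in none (L , ι ∘ ι₁ , Composition.isRingHomomorphism L.trans hom₁ hom , ι r ∷ λs , λ y → begin
        hornerᴹ L (Vec.map (ι ∘ ι₁) as) y
          ≡⟨ ≡.cong (λ cs → hornerᴹ L cs y) (map-∘ ι ι₁ as) ⟩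
        hornerᴹ L (Vec.map ι bs) y
          ≈⟨ horner-quotient L.1# (ι r) (Vec.map ι bs) y ⟩
        horner L.1# (Vec.map ι bs) (ι r) L.+ (y L.- ι r) L.* horner L.1# (quotient L.1# (ι r) (Vec.map ι bs)) y
          ≈⟨ L.+-cong (L.trans (L.sym (horner-homo bs r)) (L.trans
               (RingMorphisms.IsRingHomomorphism.⟦⟧-cong hom r-root)
               (RingMorphisms.IsRingHomomorphism.0#-homo hom)))
               (L.*-congˡ (L.trans (quotient-homo r bs y) (splits y))) ⟩
        L.0# L.+ productOfRoots L y (ι r ∷ λs)
          ≈⟨ L.+-identityˡ _ ⟩
        productOfRoots L y (ι r ∷ λs) ∎)

-- Cospectrality as equality of determinants over a discrete field.

module _ (F : DiscreteField) where
  open DiscreteField F hiding (Carrier; commutativeRing; heytingField)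
  open Determinants (commutativeRing F)
  open Adjugates (commutativeRing F) using (e)
  open PolynomialFunctions (commutativeRing F) hiding (Torsion-free)
  open Pencils (commutativeRing F) torsion-free
  open CommutativeRingSolver (commutativeRing F)

  charDet : ∀ {n} → Matrix ℕ n → Carrier F → Carrier F
  charDet M x = det′ λ i j → MatchedPseudographs.charEntry (commutativeRing F) x (M i j) i j

  charEntry-pencil : ∀ {n} x a (i j : Fin n) → - (a ⨯ 1#) + x * e i j ≈ MatchedPseudographs.charEntry
        (commutativeRing F) x a i j
  charEntry-pencil x a i j = entry (does (i ≟ j))
    where
    entry : ∀ b → - (a ⨯ 1#) + x * (if b then 1# else 0#) ≈ (if b then x else 0#) - a ⨯ 1#
    entry true  = solve 2 (λ x a → :- a :+ x :* :1 := x :- a) refl x _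
    entry false = solve 2 (λ x a → :- a :+ x :* :0 := :0 :- a) refl x _

  charDet-poly : ∀ {n} (M : Matrix ℕ n) → Poly n 1# (charDet M)
  charDet-poly M = poly-cong refl (λ x → det-cong λ i j → charEntry-pencil x (M i j) i j)
    (pencil-poly λ i j → - (M i j ⨯ 1#))

-- A splitting field of the characteristic polynomial of H exists up to a double negation, which is
-- harmless because equality in F is decidable.
cospectral⇒charDet : (F : DiscreteField) {m k : ℕ} (H : Pseudograph m) (H′ : Pseudograph k) → Cospectral H H′ →
  ∀ q → DiscreteField._≈_ F (charDet F (adjacencyMatrix H) q) (charDet F (adjacencyMatrix H′) q)
cospectral⇒charDet F H H′ cosp q = decidable-stable (_ F.≈? _) λ different →
  splitting-exists F as λ (L , ι , hom , λs , splits) →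
    let module L = DiscreteField L
        open Homomorphisms (commutativeRing F) L.commutativeRing ι hom
        open RingMorphisms.IsRingHomomorphism hom using (⟦⟧-cong)
        open PolynomialFunctions L.commutativeRing using (poly-sub; poly-vanishes)
        open CharacteristicDeterminants L.heytingField using (det≈det′)
        open CommutativeRingSolver L.commutativeRing
        ι-charDet : ∀ {n} (M : Matrix ℕ n) q → ι (charDet F M q) L.≈ charDet L M (ι q)
        ι-charDet M q = L.trans (det-homo _) (Determinants.det-cong L.commutativeRing λ i j → charEntry-homo q
              (M i j) i j)
        -- Both sides are polynomial functions on `L` that agree at the integers, where `ι`
        -- transports the identity from `F`; therefore they agree everywhere.
        charDet-splits : ∀ y → charDet L (adjacencyMatrix H) y L.≈ hornerᴹ L (Vec.map ι as) y
        charDet-splits y = L.trans (solve 2 (λ a b → a := (a :- b) :+ b) L.refl _ (hornerᴹ L (Vec.map ι as) y))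
              (L.trans
          (L.+-congʳ (poly-vanishes L.torsion-free
            (poly-sub (charDet-poly L (adjacencyMatrix H)) (Vec.map ι as , λ _ → L.refl))
            (λ k → L.trans (L.+-congʳ (L.trans (PolynomialFunctions.poly-resp L.commutativeRing
                  (charDet-poly L (adjacencyMatrix H)) (L.sym (⨯-homo k)))
                (L.trans (L.sym (ι-charDet (adjacencyMatrix H) _)) (L.trans (⟦⟧-cong (as-charDet _))
                (L.trans (horner-homo as _) (PolynomialFunctions.horner-cong L.commutativeRing (Vec.map ι as) L.refl
                      (⨯-homo k)))))))
              (L.-‿inverseʳ _))
            y))
          (L.+-identityˡ _))
        spectrum : IsSpectrum L.heytingField (adjacencyMatrix H) λs
        spectrum y = L.trans (det≈det′ _) (L.trans (charDet-splits y) (splits y))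
        spectrum′ : IsSpectrum L.heytingField (adjacencyMatrix H′) λs
        spectrum′ = Equivalence.to (cosp L.heytingField L.charZero λs) spectrum
    in different (hom-injective F L hom (L.trans (ι-charDet (adjacencyMatrix H) q) (L.trans
         (L.trans (L.sym (det≈det′ _)) (L.trans (spectrum (ι q)) (L.trans (L.sym (spectrum′ (ι q))) (det≈det′ _))))
         (L.sym (ι-charDet (adjacencyMatrix H′) q)))))
  where
  module F = DiscreteField F
  as = proj₁ (charDet-poly F (adjacencyMatrix H))
  as-charDet : ∀ x → charDet F (adjacencyMatrix H) x F.≈ hornerᴹ F as x
  as-charDet = proj₂ (charDet-poly F (adjacencyMatrix H))

cospectral⇒det : (F : DiscreteField) {m k : ℕ} (H : Pseudograph m) (H′ : Pseudograph k) → Cospectral H H′ → ∀ q →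
  DiscreteField._≈_ F (Determinants.det′ (commutativeRing F) (MatchedPseudographs.Z (commutativeRing F) q H))
                      (Determinants.det′ (commutativeRing F) (MatchedPseudographs.Z (commutativeRing F) q H′))
cospectral⇒det F H H′ cosp q = trans (sym (via H)) (trans (cospectral⇒charDet F H H′ cosp q) (via H′))
  where
  open DiscreteField F using (_≈_; sym; trans)
  open CharacteristicDeterminants (heytingField F)
  via : ∀ {m} (H : Pseudograph m) → charDet F (adjacencyMatrix H) q ≈
        Determinants.det′ (commutativeRing F) (MatchedPseudographs.Z (commutativeRing F) q H)
  via H = trans (sym (det≈det′ _)) (det-charMatrix H q)

rationals : DiscreteField
rationals = record
  { commutativeRing = ℚ.+-*-commutativeRing
  ; _≈?_     = ℚ._≃?_
  ; inverse  = λ x x≉0 → let y , _ , e = HeytingField.#⇒invertible ℚ.+-*-heytingField {x} {ℚ.0ℚᵘ} x≉0 in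
      y , trans (*-congʳ {x = y} (solve 1 (λ x → x := x :- :0) refl x)) e
  ; charZero = λ n e → ℚ.<-irrefl (sym e) (positive n)
  }
  where
  open CommutativeRing ℚ.+-*-commutativeRing using (1#; refl; sym; trans; *-congʳ; semiring)
  open RawSemiringOps (Semiring.rawSemiring semiring) using () renaming (_×_ to _⨯_)
  open CommutativeRingSolver ℚ.+-*-commutativeRing
  positive : ∀ n → ℚ.0ℚᵘ ℚ.< suc n ⨯ 1#
  positive zero    = ℚ.positive⁻¹ ℚ.1ℚᵘ
  positive (suc n) = ℚ.+-mono-< {ℚ.0ℚᵘ} {ℚ.1ℚᵘ} (ℚ.positive⁻¹ ℚ.1ℚᵘ) (positive n)

-- The converse: adjugate entries from hung and bridged vertices.

module ExtendedGraphs (F : DiscreteField) {n} (G : Graph n) (conn : Connected G) where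
  open DiscreteField F hiding (Carrier; commutativeRing; heytingField)
  private
    R = commutativeRing F
  open CommutativeRingSolver R
  open Determinants R
  open Adjugates R
  open BorderedMatrices R
  open Pencils R torsion-free
  open WalkCounts G conn using (edges; edges-sym; walks; DistanceDependent; ∂≡0⇒≡; ∂-refl; ∂-sym; walks⇒distanceRegular)
  open SetoidReasoning setoid

  private
    H₀ = toPseudograph G

  module _ (X : Mat n) where

    -- The bilinear form - p · adj X · q; bilinearity and `borderForm-e` are all that is used of
    -- this description.
    borderForm : Row n → Row n → Carrier F
    borderForm p q = det′ (border 0# p q X)

    borderForm-cong : ∀ {p p′ q q′} → (∀ j → p j ≈ p′ j) → (∀ i → q i ≈ q′ i) → borderForm p q ≈ borderForm p′ q′
    borderForm-cong p≈ q≈ = det-cong (border-cong refl p≈ q≈ λ _ _ → refl)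

    borderForm-linearˡ : ∀ b p p′ q → borderForm (λ j → b * p j + p′ j) q ≈ b * borderForm p q + borderForm p′ q
    borderForm-linearˡ b p p′ q = trans
      (det-cong (border-cong (solve 1 (λ b → :0 := b :* :0 :+ :0) refl b) (λ _ → refl) (λ _ → refl) λ _ _ → refl))
      (det-linear-first-row b 0# 0# p p′ q X)

    borderForm-zeroˡ : ∀ q → borderForm (λ _ → 0#) q ≈ 0#
    borderForm-zeroˡ q = det-zero-row _ zero λ { zero → refl ; (suc _) → refl }

    det-corner : ∀ x p q → det′ (border x p q X) ≈ x * det′ X + borderForm p q
    det-corner x p q = begin
      det′ (border x p q X)
        ≈⟨ det-cong (border-cong (solve 1 (λ x → x := x :* :1 :+ :0) refl x)
             (λ j → solve 2 (λ x a → a := x :* :0 :+ a) refl x (p j)) (λ _ → refl) λ _ _ → refl) ⟩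
      det′ (border (x * 1# + 0#) (λ j → x * 0# + p j) q X)
        ≈⟨ det-linear-first-row x 1# 0# (λ _ → 0#) p q X ⟩
      x * det′ (border 1# (λ _ → 0#) q X) + borderForm p q
        ≈⟨ +-congʳ (*-congˡ (det-border-unit-row q X)) ⟩
      x * det′ X + borderForm p q ∎

    borderForm-e : ∀ u v → borderForm (e v) (e u) ≈ - adj X v u
    borderForm-e u v = begin
      det′ (border 0# (e v) (e u) X)
        ≈⟨ det-border 0# (e v) (e u) X ⟩
      (0# - 1#) * det′ X + det′ (λ i j → X i j - e u i * e v j)
        ≈⟨ +-congˡ (trans (det-cong λ i j → solve 2 (λ x y → x :- y := x :+ (:- :1) :* y) refl (X i j)
             (e u i * e v j)) (det-+= X u v (- 1#))) ⟩
      (0# - 1#) * det′ X + (det′ X + - 1# * adj X v u)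
        ≈⟨ solve 2 (λ d r → (:0 :- :1) :* d :+ (d :+ (:- :1) :* r) := :- r) refl (det′ X) (adj X v u) ⟩
      - adj X v u ∎

  borderForm-transpose : ∀ X p q → borderForm X p q ≈ borderForm (X ᵀ) q p
  borderForm-transpose X p q = det-border-transpose 0# p q X

  module _ (X : Mat n) where

    borderForm-linearʳ : ∀ b p q q′ → borderForm X p (λ i → b * q i + q′ i) ≈ b * borderForm X p q + borderForm X p q′
    borderForm-linearʳ b p q q′ = trans (borderForm-transpose X p _) (trans (borderForm-linearˡ (X ᵀ) b q q′ p)
      (sym (+-cong (*-congˡ (borderForm-transpose X p q)) (borderForm-transpose X p q′))))

    borderForm-zeroʳ : ∀ p → borderForm X p (λ _ → 0#) ≈ 0#
    borderForm-zeroʳ p = trans (borderForm-transpose X p _) (borderForm-zeroˡ (X ᵀ) p)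

    -- The matrix x I - A contains the negated adjacencies of the new vertex, once in its row and
    -- once in its column, and the two signs cancel.
    borderForm-neg : ∀ p q → borderForm X (λ j → - p j) (λ i → - q i) ≈ borderForm X p q
    borderForm-neg p q = begin
      borderForm X (λ j → - p j) (λ i → - q i)
        ≈⟨ borderForm-cong X (λ j → neg (p j)) (λ _ → refl) ⟩
      borderForm X (λ j → - 1# * p j + 0#) (λ i → - q i)
        ≈⟨ trans (borderForm-linearˡ X (- 1#) p (λ _ → 0#) _) (+-congˡ (borderForm-zeroˡ X _)) ⟩
      - 1# * borderForm X p (λ i → - q i) + 0#
        ≈⟨ +-congʳ (*-congˡ (borderForm-cong X (λ _ → refl) λ i → neg (q i))) ⟩
      - 1# * borderForm X p (λ i → - 1# * q i + 0#) + 0#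
        ≈⟨ +-congʳ (*-congˡ (trans (borderForm-linearʳ (- 1#) p q (λ _ → 0#)) (+-congˡ (borderForm-zeroʳ p)))) ⟩
      - 1# * (- 1# * borderForm X p q + 0#) + 0#
        ≈⟨ solve 1 (λ f → (:- :1) :* ((:- :1) :* f :+ :0) :+ :0 := f) refl _ ⟩
      borderForm X p q ∎
      where
      neg : ∀ x → - x ≈ - 1# * x + 0#
      neg = solve 1 (λ x → :- x := (:- :1) :* x :+ :0) refl

    borderForm-sum : (∀ i j → X i j ≈ X j i) → ∀ u v →
      borderForm X (λ j → e u j + e v j) (λ i → e u i + e v i) ≈ - ((adj X u u + adj X v v) + (adj X u v + adj X u v))
    borderForm-sum X-sym u v = begin
      borderForm X (λ j → e u j + e v j) s
        ≈⟨ trans (borderForm-cong X (λ j → +-congʳ (sym (*-identityˡ _))) λ _ → refl)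
             (borderForm-linearˡ X 1# (e u) (e v) s) ⟩
      1# * borderForm X (e u) s + borderForm X (e v) s
        ≈⟨ +-cong (*-congˡ (half u)) (half v) ⟩
      1# * (1# * - adj X u u + - adj X u v) + (1# * - adj X v u + - adj X v v)
        ≈⟨ +-congˡ (+-congʳ (*-congˡ (-‿cong (adj-symmetric X X-sym v u)))) ⟩
      1# * (1# * - adj X u u + - adj X u v) + (1# * - adj X u v + - adj X v v)
        ≈⟨ solve 3 (λ a b c → :1 :* (:1 :* (:- a) :+ (:- b)) :+ (:1 :* (:- b) :+ (:- c)) := :- ((a :+ c) :+ (b :+ b)))
             refl
             (adj X u u) (adj X u v) (adj X v v) ⟩
      - ((adj X u u + adj X v v) + (adj X u v + adj X u v)) ∎
      where
      s : Row n
      s i = e u i + e v i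
      half : ∀ w → borderForm X (e w) s ≈ 1# * - adj X w u + - adj X w v
      half w = trans (borderForm-cong X (λ _ → refl) λ i → +-congʳ (sym (*-identityˡ _)))
        (trans (borderForm-linearʳ 1# (e w) (e u) (e v)) (+-cong (*-congˡ (borderForm-e X u w)) (borderForm-e X v w)))

  extended-det : ∀ q (a : Fin n → ℕ) (p : Row n) → (∀ j → a j ⨯ 1# ≈ p j) →
    det′ (MatchedPseudographs.Z R q (extend a 0 H₀)) ≈ q * det′ (pencil (-A G conn) q) + borderForm
          (pencil (-A G conn) q) p p
  extended-det q a p a≈p = begin
    det′ (Z (extend a 0 H₀))
      ≈⟨ det-cong bordered ⟩
    det′ (border q (λ j → - p j) (λ i → - p i) (pencil (-A G conn) q))
      ≈⟨ det-corner _ q _ _ ⟩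
    q * det′ (pencil (-A G conn) q) + borderForm (pencil (-A G conn) q) (λ j → - p j) (λ i → - p i)
      ≈⟨ +-congˡ (borderForm-neg _ p p) ⟩
    q * det′ (pencil (-A G conn) q) + borderForm (pencil (-A G conn) q) p p ∎
    where
    open MatchedPseudographs R q using (Z; Z-in)
    new : ∀ j → 0# - a j ⨯ 1# ≈ - p j
    new j = trans (+-identityˡ _) (-‿cong (a≈p j))
    bordered : Z (extend a 0 H₀) ≋ border q (λ j → - p j) (λ i → - p i) (pencil (-A G conn) q)
    bordered zero    zero    = trans (Z-in (extend a 0 H₀) here here) (solve 1 (λ q → q :- :0 := q) refl q)
    bordered zero    (suc j) = trans (Z-in (extend a 0 H₀) here (there ∈⊤)) (new j)
    bordered (suc i) zero    = trans (Z-in (extend a 0 H₀) (there ∈⊤) here) (new i)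
    bordered (suc i) (suc j) = trans (Z-in (extend a 0 H₀) (there ∈⊤) (there ∈⊤))
          (sym (charEntry-pencil F q (edges i j) i j))

  module _ (isometric⇒cospectral : ∀ U U′ → Isometric G conn U U′ → PerturbCospectral G U U′) where

    private
      r : Carrier F → Mat n
      r q = adj (pencil (-A G conn) q)

      pencil-sym : ∀ q i j → pencil (-A G conn) q i j ≈ pencil (-A G conn) q j i
      pencil-sym q i j = +-cong (-‿cong (reflexive (≡.cong (_⨯ 1#) (edges-sym i j)))) (*-congˡ (e-sym i j))

      δ≈e : ∀ (u j : Fin n) → δ u j ⨯ 1# ≈ e u j
      δ≈e u j = entry (does (u ≟ j))
        where
        entry : ∀ b → (if b then 1 else 0) ⨯ 1# ≈ (if b then 1# else 0#)
        entry true  = +-identityʳ 1#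
        entry false = refl

      cancel : ∀ {a b x y} → a + - x ≈ b + - y → a ≈ b → x ≈ y
      cancel {a} {b} {x} {y} e a≈b = begin
        x                   ≈⟨ solve 2 (λ a x → x := a :- (a :- x)) refl a x ⟩
        a - (a - x)         ≈⟨ +-cong a≈b (-‿cong e) ⟩
        b - (b - y)         ≈⟨ solve 2 (λ a x → a :- (a :- x) := x) refl b y ⟩
        y                   ∎

      -- Any two singletons are isometric, and the determinant after hanging a vertex on u differs
      -- from a quantity independent of u by exactly this entry.
      diagonal : ∀ u u′ q → r q u u ≈ r q u′ u′
      diagonal u u′ q = step (isometric⇒cospectral ⁅ u ⁆ ⁅ u′ ⁆ ((λ _ → u′) , correspondence , distances))
        where
        correspondence : ⁅ u ⁆ ≅ ⁅ u′ ⁆ via (λ _ → u′)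
        correspondence = record
          { maps-to    = λ _ → x∈⁅x⁆ u′
          ; injective  = λ v∈ w∈ _ → ≡.trans (x∈⁅y⁆⇒x≡y u v∈) (≡.sym (x∈⁅y⁆⇒x≡y u w∈))
          ; surjective = λ w∈ → u , x∈⁅x⁆ u , ≡.sym (x∈⁅y⁆⇒x≡y u′ w∈)
          }
        distances : ∀ {v w} → v ∈ ⁅ u ⁆ → w ∈ ⁅ u ⁆ → ∂ G conn v w ≡ ∂ G conn u′ u′
        distances v∈ w∈ rewrite x∈⁅y⁆⇒x≡y u v∈ | x∈⁅y⁆⇒x≡y u w∈ = ≡.trans (∂-refl u) (≡.sym (∂-refl u′))
        hung : ∀ v → det′ (MatchedPseudographs.Z R q (addPendant v H₀)) ≈ q * det′ (pencil (-A G conn) q) + - r q v v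
        hung v = trans (extended-det q (δ v) (e v) (δ≈e v)) (+-congˡ (borderForm-e _ v v))
        step : PerturbCospectral G ⁅ u ⁆ ⁅ u′ ⁆ → r q u u ≈ r q u′ u′
        step (g , g≅ , cospectral) = cancel (trans (sym (hung u)) (trans
          (cospectral⇒det F (addPendant u H₀) (addPendant (g u) H₀)
                (cospectral (λ x → x) (hanging u (x∈⁅x⁆ u) done)) q)
          (trans (hung (g u)) (+-congˡ (-‿cong (reflexive (≡.cong (λ w → r q w w) gu≡u′))))))) refl
          where
          gu≡u′ : g u ≡ u′
          gu≡u′ = x∈⁅y⁆⇒x≡y u′ (_≅_via_.maps-to g≅ (x∈⁅x⁆ u))

      halve : ∀ {x y} → x + x ≈ y + y → x ≈ y
      halve {x} {y} e = begin
        x             ≈⟨ solve 2 (λ x y → x := (x :- y) :+ y) refl x y ⟩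
        (x - y) + y   ≈⟨ +-congʳ (torsion-free 1 (x - y) (begin
            (1# + (1# + 0#)) * (x - y)   ≈⟨ solve 2 (λ x y → (:1 :+ (:1 :+ :0)) :* (x :- y) := (x :+ x) :- (y :+ y))
                  refl x y ⟩
            (x + x) - (y + y)            ≈⟨ trans (+-congʳ e) (-‿inverseʳ _) ⟩
            0#                           ∎)) ⟩
        0# + y        ≈⟨ +-identityˡ y ⟩
        y             ∎

      -- Bridging shows both diagonal entries and twice the wanted one; the former cancel by
      -- `diagonal`, and 2 is not a zero divisor.
      off-diagonal : ∀ {u v u′ v′} → u ≢ v → u′ ≢ v′ → ∂ G conn u v ≡ ∂ G conn u′ v′ → ∀ q → r q u v ≈ r q u′ v′
      off-diagonal {u} {v} {u′} {v′} u≢v u′≢v′ uv≡u′v′ q = step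
            (isometric⇒cospectral U U′ (f , correspondence , distances))
        where
        U U′ : Subset n
        U  = ⁅ u ⁆ ∪ ⁅ v ⁆
        U′ = ⁅ u′ ⁆ ∪ ⁅ v′ ⁆
        left∈ : ∀ (x y : Fin n) → x ∈ ⁅ x ⁆ ∪ ⁅ y ⁆
        left∈ x y = x∈p∪q⁺ (inj₁ (x∈⁅x⁆ x))
        right∈ : ∀ (x y : Fin n) → y ∈ ⁅ x ⁆ ∪ ⁅ y ⁆
        right∈ x y = x∈p∪q⁺ (inj₂ (x∈⁅x⁆ y))
        pair : ∀ {w} x y → w ∈ ⁅ x ⁆ ∪ ⁅ y ⁆ → w ≡ x ⊎ w ≡ y
        pair x y w∈ = Sum.map (x∈⁅y⁆⇒x≡y x) (x∈⁅y⁆⇒x≡y y) (x∈p∪q⁻ ⁅ x ⁆ ⁅ y ⁆ w∈)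
        f : Fin n → Fin n
        f w = if does (w ≟ u) then u′ else v′
        fu : f u ≡ u′
        fu = ≡.cong (if_then u′ else v′) (dec-true (u ≟ u) ≡.refl)
        fv : f v ≡ v′
        fv = ≡.cong (if_then u′ else v′) (dec-false (v ≟ u) (u≢v ∘ ≡.sym))
        correspondence : U ≅ U′ via f
        correspondence = record { maps-to = maps ; injective = inj ; surjective = surj }
          where
          maps : ∀ {w} → w ∈ U → f w ∈ U′
          maps w∈ with pair u v w∈
          ... | inj₁ ≡.refl = ≡.subst (_∈ U′) (≡.sym fu) (left∈ u′ v′)
          ... | inj₂ ≡.refl = ≡.subst (_∈ U′) (≡.sym fv) (right∈ u′ v′)
          inj : ∀ {w x} → w ∈ U → x ∈ U → f w ≡ f x → w ≡ x
          inj w∈ x∈ e with pair u v w∈ | pair u v x∈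
          ... | inj₁ ≡.refl | inj₁ ≡.refl = ≡.refl
          ... | inj₁ ≡.refl | inj₂ ≡.refl = contradiction (≡.trans (≡.sym fu) (≡.trans e fv)) u′≢v′
          ... | inj₂ ≡.refl | inj₁ ≡.refl = contradiction (≡.trans (≡.sym fu) (≡.trans (≡.sym e) fv)) u′≢v′
          ... | inj₂ ≡.refl | inj₂ ≡.refl = ≡.refl
          surj : ∀ {w} → w ∈ U′ → ∃ λ x → x ∈ U × f x ≡ w
          surj w∈ with pair u′ v′ w∈
          ... | inj₁ ≡.refl = u , left∈ u v , fu
          ... | inj₂ ≡.refl = v , right∈ u v , fv
        distances : ∀ {w x} → w ∈ U → x ∈ U → ∂ G conn w x ≡ ∂ G conn (f w) (f x)
        distances w∈ x∈ with pair u v w∈ | pair u v x∈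
        ... | inj₁ ≡.refl | inj₁ ≡.refl = ≡.trans (∂-refl u) (≡.sym (∂-refl (f u)))
        ... | inj₁ ≡.refl | inj₂ ≡.refl = ≡.trans uv≡u′v′ (≡.sym (≡.cong₂ (∂ G conn) fu fv))
        ... | inj₂ ≡.refl | inj₁ ≡.refl = ≡.trans (∂-sym v u)
              (≡.trans uv≡u′v′ (≡.trans (∂-sym u′ v′) (≡.sym (≡.cong₂ (∂ G conn) fv fu))))
        ... | inj₂ ≡.refl | inj₂ ≡.refl = ≡.trans (∂-refl v) (≡.sym (∂-refl (f v)))

        bridged : ∀ x y → det′ (MatchedPseudographs.Z R q (addCommonNeighbour x y H₀)) ≈
                          q * det′ (pencil (-A G conn) q) + - ((r q x x + r q y y) + (r q x y + r q x y))
        bridged x y = trans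
          (extended-det q (λ j → δ x j ℕ.+ δ y j) (λ j → e x j + e y j)
            (λ j → trans (MonoidMult.×-homo-+ +-monoid 1# (δ x j) (δ y j)) (+-cong (δ≈e x j) (δ≈e y j))))
          (+-congˡ (borderForm-sum _ (pencil-sym q) x y))

        step : PerturbCospectral G U U′ → r q u v ≈ r q u′ v′
        step (g , g≅ , cospectral) = trans
          (halve (cancel-diagonal (cancel (trans (sym (bridged u v)) (trans
            (cospectral⇒det F (addCommonNeighbour u v H₀) (addCommonNeighbour (g u) (g v) H₀)
              (cospectral (λ x → x) (bridging u v (left∈ u v) (right∈ u v) u≢v done)) q)
            (bridged (g u) (g v)))) refl)))
          image
          where
          cancel-diagonal : (r q u u + r q v v) + (r q u v + r q u v) ≈ (r q (g u) (g u) + r q (g v) (g v)) +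
                (r q (g u) (g v) + r q (g u) (g v)) →
            r q u v + r q u v ≈ r q (g u) (g v) + r q (g u) (g v)
          cancel-diagonal eq = begin
            x                     ≈⟨ solve 2 (λ d x → x := (d :+ x) :- d) refl (r q u u + r q v v) x ⟩
            ((r q u u + r q v v) + x) - (r q u u + r q v v)
                                  ≈⟨ +-cong eq (-‿cong (+-cong (diagonal u (g u) q) (diagonal v (g v) q))) ⟩
            ((r q (g u) (g u) + r q (g v) (g v)) + y) - (r q (g u) (g u) + r q (g v) (g v))
                                  ≈⟨ solve 2 (λ d x → (d :+ x) :- d := x) refl (r q (g u) (g u) + r q (g v) (g v)) y ⟩
            y                     ∎
            where
            x = r q u v + r q u v
            y = r q (g u) (g v) + r q (g u) (g v)
          -- The correspondence `g` comes from the hypothesis and may differ from `f`: it maps {u,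
          -- v} onto {u′, v′}, in either order.
          image : r q (g u) (g v) ≈ r q u′ v′
          image with pair u′ v′ (_≅_via_.maps-to g≅ (left∈ u v)) | pair u′ v′ (_≅_via_.maps-to g≅ (right∈ u v))
          ... | inj₁ gu | inj₂ gv = reflexive (≡.cong₂ (r q) gu gv)
          ... | inj₂ gu | inj₁ gv = trans (reflexive (≡.cong₂ (r q) gu gv)) (adj-symmetric _ (pencil-sym q) v′ u′)
          ... | inj₁ gu | inj₁ gv = contradiction (_≅_via_.injective g≅ (left∈ u v) (right∈ u v)
                (≡.trans gu (≡.sym gv))) u≢v
          ... | inj₂ gu | inj₂ gv = contradiction (_≅_via_.injective g≅ (left∈ u v) (right∈ u v)
                (≡.trans gu (≡.sym gv))) u≢v

      adj-dependent : ∀ {u v u′ v′} → ∂ G conn u v ≡ ∂ G conn u′ v′ → ∀ q → r q u v ≈ r q u′ v′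
      adj-dependent {u} {v} {u′} {v′} e q with u ≟ v | u′ ≟ v′
      ... | yes ≡.refl | yes ≡.refl = diagonal u u′ q
      ... | yes ≡.refl | no  u′≢v′  = contradiction (∂≡0⇒≡ (≡.trans (≡.sym e) (∂-refl u))) u′≢v′
      ... | no  u≢v    | yes ≡.refl = contradiction (∂≡0⇒≡ (≡.trans e (∂-refl u′))) u≢v
      ... | no  u≢v    | no  u′≢v′  = off-diagonal u≢v u′≢v′ e q

      ⨯-injective : ∀ i j → i ⨯ 1# ≈ j ⨯ 1# → i ≡ j
      ⨯-injective zero    zero    e = ≡.refl
      ⨯-injective zero    (suc j) e = contradiction (sym e) (charZero j)
      ⨯-injective (suc i) zero    e = contradiction e (charZero i)
      ⨯-injective (suc i) (suc j) e = ≡.cong suc (⨯-injective i j (begin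
        i ⨯ 1#                 ≈⟨ solve 1 (λ x → x := (:1 :+ x) :- :1) refl _ ⟩
        (1# + i ⨯ 1#) - 1#     ≈⟨ +-congʳ e ⟩
        (1# + j ⨯ 1#) - 1#     ≈⟨ solve 1 (λ x → x := (:1 :+ x) :- :1) refl _ ⟨
        j ⨯ 1#                 ∎))

    perturbCospectral⇒distanceRegular : DistanceRegular G conn
    perturbCospectral⇒distanceRegular = walks⇒distanceRegular λ k e →
      ⨯-injective _ _ (walks-from-adj G conn (adj-dependent e) k)

theorem5p3 : (n : ℕ) (G : Graph n) (conn : Connected G) →
    DistanceRegular G conn ⇔
    ((U U′ : Subset n) → Isometric G conn U U′ → PerturbCospectral G U U′)
theorem5p3 n G conn = mk⇔ (distanceRegular⇒perturbCospectral G conn)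
  (ExtendedGraphs.perturbCospectral⇒distanceRegular rationals G conn)
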